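{- Let $q$ be a prime power and let $k \geq 2$ be an integer. Then there exists a number $c_0(k,q)$ such that for all integers $n$ with $\max(k, n-k) \geq c_0(k,q)$, every Boolean degree $1$ function on the $k$-subspaces of an $n$-dimensional vector space $V$ over $\mathbb{F}_q$ is trivial, i.e. it is one of the following families of $k$-subspaces of $V$: (I) the empty family; (II) all $k$-subspaces containing a fixed $1$-dimensional subspace $P$; (III) all $k$-subspaces contained in a fixed hyperplane $H$ of $V$; (IV) the union of (II) and (III) for a $1$-space $P$ and a hyperplane $H$ with $P \not\subseteq H$; (V) the complement (in the set of all $k$-subspaces of $V$) of any family of type (I)–(IV).
   Context: Let $V$ be an $n$-dimensional vector space over the finite field $\mathbb{F}_q$; $1$-dimensional subspaces are called points. A family $Y$ of $k$-dimensional subspaces of $V$ is called a Boolean degree $1$ function on $J_q(n,k)$ (a Cameron–Liebler class) if there is a function $\mathrm{wt}$ from the set of points of $V$ to $\mathbb{R}$ such that for every $k$-subspace $S$ of $V$, $\sum_{P \subseteq S} \mathrm{wt}(P)$ (sum over points $P$ of $S$) equals $1$ if $S \in Y$ and $0$ if $S \notin Y$. (Equivalently, the indicator function of $Y$ is a real polynomial of degree at most $1$ in the point-indicator variables.)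
   Formalization: The weight function wt on the points takes rational instead of real values; since the conditions on wt form a finite linear system with rational coefficients, this describes the same Boolean degree 1 functions. -}

module Defs where

open import Level using (0ℓ)
open import Data.Bool using (Bool; true; false; _∧_; _∨_; not; if_then_else_)
open import Data.Nat using (ℕ; zero; suc; _≤_; _^_)
open import Data.Nat.Primality using (Prime)
open import Data.Fin using (Fin)
import Data.Fin as Fin
open import Data.List using (List; []; _∷_; length; filter; map; foldr; concatMap; allFin)
open import Data.List.Membership.Propositional using (_∈_)
open import Data.List.Relation.Unary.Unique.Propositional using (Unique)
open import Data.Product using (Σ; ∃; _×_; _,_)
open import Data.Sum using (_⊎_)
open import Data.Rational using (ℚ; 0ℚ; 1ℚ) renaming (_+_ to _+ℚ_)
open import Relation.Binary.PropositionalEquality using (_≡_; _≢_)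
open import Relation.Binary.Definitions using (DecidableEquality)
open import Relation.Nullary using (¬_)
open import Relation.Nullary.Decidable using (⌊_⌋)
open import Algebra.Core using (Op₁; Op₂)
open import Algebra.Structures using (IsCommutativeRing)

IsPrimePower : ℕ → Set
IsPrimePower q = Σ ℕ λ p → Σ ℕ λ e → Prime p × 1 ≤ e × q ≡ p ^ e

record FiniteField : Set₁ where
  infixl 6 _+_
  infixl 7 _*_
  field
    Carrier  : Set
    _+_ _*_  : Op₂ Carrier
    -_       : Op₁ Carrier
    0# 1#    : Carrier
    isCommutativeRing : IsCommutativeRing _≡_ _+_ _*_ -_ 0# 1#
    0≢1      : 0# ≢ 1#
    inverse  : ∀ x → x ≢ 0# → ∃ λ y → x * y ≡ 1#
    _≟_      : DecidableEquality Carrier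
    elements : List Carrier
    complete : ∀ x → x ∈ elements
    unique   : Unique elements

  size : ℕ
  size = length elements

allB : {A : Set} → (A → Bool) → List A → Bool
allB p = foldr (λ x b → p x ∧ b) true

anyB : {A : Set} → (A → Bool) → List A → Bool
anyB p = foldr (λ x b → p x ∨ b) false

module VectorSpace (F : FiniteField) where
  open FiniteField F

  Vec : ℕ → Set
  Vec n = Fin n → Carrier

  _==_ : Carrier → Carrier → Bool
  x == y = ⌊ x ≟ y ⌋

  sumF : ∀ {k} → (Fin k → Carrier) → Carrier
  sumF {zero}  c = 0#
  sumF {suc k} c = c Fin.zero + sumF (λ i → c (Fin.suc i))

  zeroV : ∀ {n} → Vec n
  zeroV _ = 0#

  _==V_ : ∀ {n} → Vec n → Vec n → Bool
  _==V_ {n} v w = allB (λ i → v i == w i) (allFin n)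

  cons : ∀ {n} → Carrier → Vec n → Vec (suc n)
  cons x v Fin.zero = x
  cons x v (Fin.suc i) = v i

  allVectors : (n : ℕ) → List (Vec n)
  allVectors zero = (λ ()) ∷ []
  allVectors (suc n) =
    concatMap (λ x → map (λ v → cons x v) (allVectors n)) elements

  linComb : ∀ {n k} → (Fin k → Carrier) → (Fin k → Vec n) → Vec n
  linComb c b j = sumF (λ i → c i * b i j)

  dot : ∀ {n} → Vec n → Vec n → Carrier
  dot a v = sumF (λ i → a i * v i)

  LinearlyIndependent : ∀ {n k} → (Fin k → Vec n) → Set
  LinearlyIndependent {n} {k} b =
    ∀ (c : Fin k → Carrier) → (∀ j → linComb c b j ≡ 0#) → ∀ i → c i ≡ 0#

  -- a k-dimensional subspace of F^n, given by a basis (the subspace is its span)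
  record Subspace (n k : ℕ) : Set where
    constructor subspace
    field
      basis : Fin k → Vec n
      independent : LinearlyIndependent basis

  open Subspace public

  _∈S_ : ∀ {n k} → Vec n → Subspace n k → Bool
  _∈S_ {n} {k} v S = anyB (λ c → v ==V linComb c (basis S)) (allVectors k)

  -- canonical representative of a point (1-space): first nonzero coordinate is 1
  normalized : ∀ {n} → Vec n → Bool
  normalized {zero} v = false
  normalized {suc n} v =
    if v Fin.zero == 0# then normalized (λ i → v (Fin.suc i)) else (v Fin.zero == 1#)

  sumℚ : List ℚ → ℚ
  sumℚ = foldr _+ℚ_ 0ℚ

  -- Σ_{points P ⊆ S} wt(P); a point is represented by its normalized vector
  pointSum : ∀ {n k} → (Vec n → ℚ) → Subspace n k → ℚ
  pointSum {n} wt S = sumℚ (map wt (filter (λ v → normalized v ∧ (v ∈S S) ≟ᵇ true) (allVectors n)))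
    where
      open import Data.Bool.Properties renaming (_≟_ to _≟ᵇ_)

  IsBooleanDegree1 : ∀ {n k} → (Subspace n k → Bool) → Set
  IsBooleanDegree1 {n} {k} Y =
    Σ (Vec n → ℚ) λ wt → ∀ (S : Subspace n k) →
      pointSum wt S ≡ (if Y S then 1ℚ else 0ℚ)

  -- S ⊆ H where H = ker(a) is the hyperplane of a nonzero functional a
  _⊆H_ : ∀ {n k} → Subspace n k → Vec n → Bool
  _⊆H_ {n} {k} S a = allB (λ i → dot a (basis S i) == 0#) (allFin k)

  NonZero : ∀ {n} → Vec n → Set
  NonZero v = ¬ (∀ j → v j ≡ 0#)

  data Basic {n k : ℕ} : (Subspace n k → Bool) → Set where
    typeI   : Basic (λ _ → false)
    typeII  : (p : Vec n) → NonZero p → Basic (λ S → p ∈S S)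
    typeIII : (a : Vec n) → NonZero a → Basic (λ S → S ⊆H a)
    typeIV  : (p a : Vec n) → NonZero p → NonZero a → dot a p ≢ 0# →
              Basic (λ S → (p ∈S S) ∨ (S ⊆H a))

  Trivial : ∀ {n k} → (Subspace n k → Bool) → Set
  Trivial {n} {k} Y = Σ (Subspace n k → Bool) λ T → Basic T ×
    ((∀ S → Y S ≡ T S) ⊎ (∀ S → Y S ≡ not (T S)))

{-# OPTIONS --safe #-}
-- Regard wt as a function g on nonzero vectors, invariant under scalars. The values of g on a small
-- subspace translated by x are determined by finitely many bits, so the Hales–Jewett theorem makes them
-- constant along affine flats of x. Iterating this yields a flag on which g depends only on the level of
-- a vector, and comparing coordinate k-spaces makes g constant on a large subspace U. Up to complement,
-- g = 0 on U.
--
-- On a coset v + U the function g is affine of degree one. Iterating the Ramsey argument k − 1 times, its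
-- values on a fixed k-dimensional T ⊆ U are 0 or q^(1-k) throughout, except that one value may be raised,
-- respectively lowered, by 1. Modulo ℤ, the k-spaces meeting T in dimension k − 2 then show that every line
-- of V / T meets the set of cosets of nonintegral weight in 0 or q points, so the vectors of integral weight
-- form V or a hyperplane H. Finally, two exceptional points, or one inside H ≠ V, would give some k-space a
-- weight outside {0 , 1}. This leaves exactly the four types and their complements.
module Submission where

open import Defs
open import Level using (0ℓ)
open import Algebra.Bundles using (CommutativeRing)
open import Data.Bool using (Bool; true; false; _∧_; _∨_; not; if_then_else_)
import Data.Bool.Properties as BoolP
open import Data.Nat as ℕ using (ℕ; zero; suc; z≤n; s≤s)
import Data.Nat.Properties as ℕP
import Data.Integer as ℤ
open import Data.Rational as ℚ using (ℚ; 0ℚ; 1ℚ)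
open import Data.Rational.Properties as ℚP using (≤-refl; ≤-trans; +-mono-≤)
open import Data.Fin using (Fin; zero; suc)
open import Data.List using (List; []; _∷_; filter; concatMap; allFin)
import Data.List as List
open import Data.List.Membership.Propositional using (_∈_)
open import Data.List.Membership.Propositional.Properties using (∈-concatMap⁺; ∈-concatMap⁻; ∈-map⁺; ∈-map⁻; ∈-allFin)
open import Data.List.Relation.Unary.Any as Any using (here; there)
open import Data.List.Relation.Unary.Any.Properties using (lookup-index)
open import Data.List.Relation.Unary.All as All using (All)
open import Data.List.Relation.Unary.AllPairs using (_∷_)
open import Data.List.Relation.Unary.Unique.Propositional using (Unique)
open import Data.Product using (Σ; ∃; _×_; _,_; proj₁; proj₂)
open import Data.Sum using (_⊎_; inj₁; inj₂)
open import Data.Unit using (⊤; tt)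
open import Data.Empty using (⊥; ⊥-elim)
open import Function using (_∘_)
open import Relation.Nullary using (¬_; Dec; yes; no)
open import Relation.Nullary.Decidable using (dec⇒maybe; _×-dec_; ¬?)
open import Relation.Binary.Definitions using (DecidableEquality)
open import Relation.Binary.PropositionalEquality
open import Tactic.RingSolver using (solve-∀)
open import Tactic.RingSolver.Core.AlmostCommutativeRing using (AlmostCommutativeRing; fromCommutativeRing)

-- Weights have no finite range known in advance, so they cannot be coloured directly; what is
-- finite is the bit of each k-space. The k-spaces used join a point at height 1 to k - 1 lines at
-- height 0, one in each of k - 1 planes. Moving only the coordinate x of the point leaves the part
-- at height 0 alone, and a function on a product of planes is zero once all its sums over products
-- of lines are zero. Hence points x with equal bits have equal weights. The alphabet of the
-- Hales-Jewett words is a whole space F^m, so that a combinatorial line is an m-flat.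
--
-- The number k - 1 of iterations is the dimension of the affine part of a k-space: a base point
-- joined to the k - 1 directions found spans a k-space whose other affine points have a total
-- independent of the base point. So the weight of the base point is a bit plus a constant. On a (k
-- - 1)-flat where this weight does not vary its sum is again a bit, and this is where q^(1-k) comes
-- from.

-- The Hales-Jewett theorem by colour focusing.

module HalesJewett where
  open import Data.Nat using (_+_; _*_; _^_)
  open import Data.Fin using (funToFin; finToFun; combine; remQuot)
  open import Data.Fin.Properties using (finToFun-funToFin; remQuot-combine; pigeonhole; any?) renaming (_≟_ to _≟Fin_)
  open import Data.Maybe using (Maybe; just; nothing; fromMaybe)
  import Data.Maybe as Maybe
  open import Data.Vec using (Vec; []; _∷_; _++_; map; tabulate; lookup)
  open import Data.Vec.Properties using (map-++; tabulate-cong; tabulate∘lookup)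
  open import Data.Vec.Relation.Unary.Any using (Any; here; there)
  open import Data.Vec.Relation.Unary.Any.Properties using (++⁺ˡ; ++⁺ʳ)

  -- A split surjection from `Fin n`, not a bijection: repeated values do no harm, since
  -- enumerations serve to search, to name letters and to encode colourings.
  record Enum (A : Set) (n : ℕ) : Set where
    field
      at     : Fin n → A
      idx    : A → Fin n
      at-idx : ∀ a → at (idx a) ≡ a

  open Enum

  enum-× : ∀ {A B : Set} {m n} → Enum A m → Enum B n → Enum (A × B) (m * n)
  enum-× {m = m} {n} a b = record
    { at     = λ i → at a (proj₁ (remQuot {m} n i)) , at b (proj₂ (remQuot {m} n i))
    ; idx    = λ (x , y) → combine (idx a x) (idx b y)
    ; at-idx = λ (x , y) →
        trans (cong (λ r → at a (proj₁ r) , at b (proj₂ r)) (remQuot-combine {m} {n} (idx a x) (idx b y)))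
              (cong₂ _,_ (at-idx a x) (at-idx b y)) }

  enum-Vec : ∀ s N → Enum (Vec (Fin s) N) (s ^ N)
  enum-Vec s N = record
    { at     = λ i → tabulate (finToFun i)
    ; idx    = λ w → funToFin (lookup w)
    ; at-idx = λ w → trans (tabulate-cong (finToFun-funToFin (lookup w))) (tabulate∘lookup w) }

  -- Packs a family of colourings into a single one with `r ^ M` colours, so that one application of
  -- a Ramsey theorem makes the whole family constant.
  code : ∀ {I : Set} {M} r → Enum I M → (I → Fin r) → Fin (r ^ M)
  code r e f = funToFin (f ∘ at e)

  code-injective : ∀ {I : Set} {M r} (e : Enum I M) (f g : I → Fin r) →
                   code r e f ≡ code r e g → ∀ i → f i ≡ g i
  code-injective e f g eq i = begin
    f i                                             ≡⟨ cong f (at-idx e i) ⟨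
    f (at e (idx e i))                              ≡⟨ finToFun-funToFin (f ∘ at e) (idx e i) ⟨
    finToFun (funToFin (f ∘ at e)) (idx e i)        ≡⟨ cong (λ c → finToFun c (idx e i)) eq ⟩
    finToFun (funToFin (g ∘ at e)) (idx e i)        ≡⟨ finToFun-funToFin (g ∘ at e) (idx e i) ⟩
    g (at e (idx e i))                              ≡⟨ cong g (at-idx e i) ⟩
    g i                                             ∎
    where open ≡-Reasoning

  search : ∀ {A : Set} {n} → Enum A n → {P : A → Set} → (∀ a → Dec (P a)) → ∃ P ⊎ (∀ a → ¬ P a)
  search e {P} P? with any? (P? ∘ at e)
  ... | yes (i , p) = inj₁ (at e i , p)
  ... | no ¬p       = inj₂ λ a p → ¬p (idx e a , subst P (sym (at-idx e a)) p)

  Word : ℕ → ℕ → Set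
  Word s N = Vec (Fin s) N

  -- A variable word, with 'nothing' as the variable.
  Pattern : ℕ → ℕ → Set
  Pattern s N = Vec (Maybe (Fin s)) N

  HasStar : ∀ {s N} → Pattern s N → Set
  HasStar = Any (_≡ nothing)

  _⟦_⟧ : ∀ {s N} → Pattern s N → Fin s → Word s N
  w ⟦ a ⟧ = map (fromMaybe a) w

  constant : ∀ {s N} → Word s N → Pattern s N
  constant = map just

  constant-⟦⟧ : ∀ {s N} (w : Word s N) a → constant w ⟦ a ⟧ ≡ w
  constant-⟦⟧ []      a = refl
  constant-⟦⟧ (x ∷ w) a = cong (x ∷_) (constant-⟦⟧ w a)

  raise : ∀ {s N} → Pattern s N → Pattern (suc s) N
  raise = map (Maybe.map suc)

  raise-⟦⟧ : ∀ {s N} (w : Pattern s N) a → raise w ⟦ suc a ⟧ ≡ map suc (w ⟦ a ⟧)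
  raise-⟦⟧ []            a = refl
  raise-⟦⟧ (just x ∷ w)  a = cong (suc x ∷_) (raise-⟦⟧ w a)
  raise-⟦⟧ (nothing ∷ w) a = cong (suc a ∷_) (raise-⟦⟧ w a)

  raise-star : ∀ {s N} (w : Pattern s N) → HasStar w → HasStar (raise w)
  raise-star (nothing ∷ w) (here refl) = here refl
  raise-star (x ∷ w)       (there p)   = there (raise-star w p)

  Mono : ∀ {s r N} → (Word s N → Fin r) → Set
  Mono {s} {r} {N} χ = Σ (Pattern s N) λ w → HasStar w × (∀ a b → χ (w ⟦ a ⟧) ≡ χ (w ⟦ b ⟧))

  HJ : ℕ → Set
  HJ s = ∀ r → Σ ℕ λ N → (χ : Word s N → Fin r) → Mono χ

  -- The colour of the focus either equals one of the `t` colours, which completes a line, or is a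
  -- new colour; the latter can happen at most `r` times.
  record Focused {s r N} (χ : Word (suc s) N → Fin r) (t : ℕ) : Set where
    field
      focus   : Word (suc s) N
      lines   : Fin t → Pattern (suc s) N
      star    : ∀ i → HasStar (lines i)
      at-zero : ∀ i → lines i ⟦ zero ⟧ ≡ focus
      colour  : Fin t → Fin r
      at-suc  : ∀ i a → χ (lines i ⟦ suc a ⟧) ≡ colour i
      differ  : ∀ i j → i ≢ j → colour i ≢ colour j

  -- Let v* be a variable word along whose letters suc a the colour χ (u ++ v*) is constant, for every u. If the
  -- lines w are focused for χ (u ++ v* ⟦ suc zero ⟧), then the lines w ++ v* and focus ++ v* are focused for χ;
  -- the colour of the last one is new, unless some w is monochromatic.
  focusing : ∀ {s} → HJ (suc s) → ∀ r t →
             Σ ℕ λ N → (χ : Word (suc (suc s)) N → Fin r) → Mono χ ⊎ Focused χ t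
  focusing hj r zero = 0 , λ χ → inj₂ record
    { focus = [] ; lines = λ () ; star = λ () ; at-zero = λ () ; colour = λ () ; at-suc = λ ()
    ; differ = λ () }
  focusing {s} hj r (suc t) = N + M , step
    where
    ih = focusing hj r t
    N = proj₁ ih
    words = enum-Vec (suc (suc s)) N
    -- One colour for every colouring of the prefixes of length `N`.
    rM = r ^ (suc (suc s) ^ N)
    M = proj₁ (hj rM)

    step : (χ : Word (suc (suc s)) (N + M) → Fin r) → Mono χ ⊎ Focused χ (suc t)
    step χ = go (proj₂ ih χ′)
      where
      mono = proj₂ (hj rM) (λ v → code r words (λ u → χ (u ++ map suc v)))
      v* = proj₁ mono

      mono-v : ∀ u a b → χ (u ++ (raise v* ⟦ suc a ⟧)) ≡ χ (u ++ (raise v* ⟦ suc b ⟧))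
      mono-v u a b = trans (cong (λ v → χ (u ++ v)) (raise-⟦⟧ v* a))
        (trans (code-injective words _ _ (proj₂ (proj₂ mono) a b) u)
               (cong (λ v → χ (u ++ v)) (sym (raise-⟦⟧ v* b))))

      χ′ : Word (suc (suc s)) N → Fin r
      χ′ u = χ (u ++ (raise v* ⟦ suc zero ⟧))

      ++-⟦⟧ : ∀ {m n} (w : Pattern (suc (suc s)) m) (v : Pattern (suc (suc s)) n) a →
              (w ++ v) ⟦ a ⟧ ≡ (w ⟦ a ⟧) ++ (v ⟦ a ⟧)
      ++-⟦⟧ w v a = map-++ _ w v

      lift-mono : Mono χ′ → Mono χ
      lift-mono (w , st , m) = (w ++ constant z , ++⁺ˡ st , λ a b →
        trans (cong χ (eq a)) (trans (m a b) (cong χ (sym (eq b)))))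
        where
        z = raise v* ⟦ suc zero ⟧
        eq : ∀ a → (w ++ constant z) ⟦ a ⟧ ≡ (w ⟦ a ⟧) ++ z
        eq a = trans (++-⟦⟧ w _ a) (cong ((w ⟦ a ⟧) ++_) (constant-⟦⟧ z a))

      go : Mono χ′ ⊎ Focused χ′ t → Mono χ ⊎ Focused χ (suc t)
      go (inj₁ m) = inj₁ (lift-mono m)
      go (inj₂ foc) with any? (λ i → Focused.colour foc i ≟Fin χ′ (Focused.focus foc))
      ... | yes (i , e) =
        inj₁ (lift-mono (lines i , star i , λ a b → trans (same a) (sym (same b))))
        where
        open Focused foc
        same : ∀ a → χ′ (lines i ⟦ a ⟧) ≡ colour i
        same zero    = trans (cong χ′ (at-zero i)) (sym e)
        same (suc a) = at-suc i a
      ... | no new = inj₂ record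
        { focus   = focus ++ (raise v* ⟦ zero ⟧)
        ; lines   = λ { zero → constant focus ++ raise v* ; (suc i) → lines i ++ raise v* }
        ; star    = λ { zero → ++⁺ʳ (constant focus) (raise-star v* (proj₁ (proj₂ mono)))
                      ; (suc i) → ++⁺ˡ (star i) }
        ; at-zero = λ { zero → trans (++-⟦⟧ (constant focus) (raise v*) zero)
                                 (cong (_++ (raise v* ⟦ zero ⟧)) (constant-⟦⟧ focus zero))
                      ; (suc i) → trans (++-⟦⟧ (lines i) (raise v*) zero)
                                 (cong (_++ (raise v* ⟦ zero ⟧)) (at-zero i)) }
        ; colour  = λ { zero → χ′ focus ; (suc i) → colour i }
        ; at-suc  = λ { zero a → trans (cong χ (trans (++-⟦⟧ (constant focus) (raise v*) (suc a))
                                   (cong (_++ (raise v* ⟦ suc a ⟧)) (constant-⟦⟧ focus (suc a)))))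
                                 (mono-v focus a zero)
                      ; (suc i) a → trans (cong χ (++-⟦⟧ (lines i) (raise v*) (suc a)))
                                 (trans (mono-v (lines i ⟦ suc a ⟧) a zero) (at-suc i a)) }
        ; differ  = λ { zero zero n → ⊥-elim (n refl)
                      ; zero (suc j) n e → new (j , sym e)
                      ; (suc i) zero n e → new (i , e)
                      ; (suc i) (suc j) n → differ i j (n ∘ cong suc) } }
        where open Focused foc

  -- Induction on the alphabet. Of `suc r` focused lines two would share one of the `r` colours, so
  -- the focusing must have ended in a monochromatic line.
  hales-jewett : ∀ s → HJ (suc s)
  hales-jewett zero r = 1 , λ χ → nothing ∷ [] , here refl , λ { zero zero → refl }
  hales-jewett (suc s) r = proj₁ foc , λ χ → finish χ (proj₂ foc χ)
    where
    foc = focusing (hales-jewett s) r (suc r)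
    finish : ∀ χ → Mono χ ⊎ Focused χ (suc r) → Mono χ
    finish χ (inj₁ m) = m
    finish χ (inj₂ f) with pigeonhole ℕP.≤-refl (Focused.colour f)
    ... | i , j , i<j , e = ⊥-elim (Focused.differ f i j (λ { refl → <-irr i<j }) e)
      where
      <-irr : ∀ {n} {i : Fin n} → i Data.Fin.< i → ⊥
      <-irr = ℕP.<-irrefl refl

  -- Includes the empty alphabet, so that sizes such as `q ^ m` need not be visibly positive.
  hj : ∀ s → HJ s
  hj zero    r = 1 , λ χ → nothing ∷ [] , here refl , λ ()
  hj (suc s) r = hales-jewett s r

  abstract
    hjN : ℕ → ℕ → ℕ
    hjN s r = proj₁ (hj s r)

    hj-mono : ∀ s r (χ : Word s (hjN s r) → Fin r) → Mono χ
    hj-mono s r = proj₂ (hj s r)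

open HalesJewett

-- Rational sums over lists, bits and integrality.

module RationalSums where
  open import Data.Rational using (_+_; _*_; _-_; -_; _≤_; _<_)

  ℚring : AlmostCommutativeRing 0ℓ 0ℓ
  ℚring = fromCommutativeRing ℚP.+-*-commutativeRing (λ x → dec⇒maybe (0ℚ ℚP.≟ x))

  ≤-by : ∀ {a b c} → 0ℚ ≤ c → a + c ≡ b → a ≤ b
  ≤-by {a} {b} {c} 0≤c eq = subst₂ _≤_ (ℚP.+-identityʳ a) eq (+-mono-≤ (≤-refl {a}) 0≤c)

  0≤b-a : ∀ {a b} → a ≤ b → 0ℚ ≤ b - a
  0≤b-a {a} {b} a≤b = subst (_≤ b - a) (ℚP.+-inverseʳ a) (+-mono-≤ a≤b (≤-refl { - a}))

  0≤1 : 0ℚ ≤ 1ℚ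
  0≤1 = ℚ.*≤* (ℤ.+≤+ ℕ.z≤n)

  0<1 : 0ℚ < 1ℚ
  0<1 = ℚP.positive⁻¹ 1ℚ

  <≤-absurd : ∀ {a b} → a < b → b ≤ a → ⊥
  <≤-absurd lt le = ℚP.<-irrefl refl (ℚP.<-≤-trans lt le)

  0≢1ℚ : 0ℚ ≢ 1ℚ
  0≢1ℚ ()

  0≤-+ : ∀ {a b} → 0ℚ ≤ a → 0ℚ ≤ b → 0ℚ ≤ a + b
  0≤-+ {a} {b} p r = subst (_≤ a + b) (ℚP.+-identityˡ 0ℚ) (+-mono-≤ p r)

  0≤-* : ∀ {a b} → 0ℚ ≤ a → 0ℚ ≤ b → 0ℚ ≤ a * b
  0≤-* {a} {b} p r = subst (_≤ a * b) (ℚP.*-zeroʳ a) (ℚP.*-monoˡ-≤-nonNeg a {{ℚ.nonNegative p}} r)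

  Bit : ℚ → Set
  Bit x = x ≡ 0ℚ ⊎ x ≡ 1ℚ

  0≤bit : ∀ {x} → Bit x → 0ℚ ≤ x
  0≤bit (inj₁ refl) = ≤-refl
  0≤bit (inj₂ refl) = 0≤1

  bit≤1 : ∀ {x} → Bit x → x ≤ 1ℚ
  bit≤1 (inj₁ refl) = 0≤1
  bit≤1 (inj₂ refl) = ≤-refl

  sumL : {A : Set} → (A → ℚ) → List A → ℚ
  sumL f []       = 0ℚ
  sumL f (x ∷ xs) = f x + sumL f xs

  module _ {A : Set} where

    sumL-cong : ∀ {f g : A → ℚ} xs → (∀ x → x ∈ xs → f x ≡ g x) → sumL f xs ≡ sumL g xs
    sumL-cong []       eq = refl
    sumL-cong (x ∷ xs) eq = cong₂ _+_ (eq x (here refl)) (sumL-cong xs (λ y m → eq y (there m)))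

    sumL-+ : ∀ (f g : A → ℚ) xs → sumL (λ x → f x + g x) xs ≡ sumL f xs + sumL g xs
    sumL-+ f g []       = refl
    sumL-+ f g (x ∷ xs) = trans (cong (f x + g x +_) (sumL-+ f g xs))
      (lem (f x) (g x) (sumL f xs) (sumL g xs))
      where
      lem : ∀ a b c d → (a + b) + (c + d) ≡ (a + c) + (b + d)
      lem = solve-∀ ℚring

    sumL-* : ∀ c (f : A → ℚ) xs → sumL (λ x → c * f x) xs ≡ c * sumL f xs
    sumL-* c f []       = sym (ℚP.*-zeroʳ c)
    sumL-* c f (x ∷ xs) = trans (cong (c * f x +_) (sumL-* c f xs)) (sym (ℚP.*-distribˡ-+ c _ _))

    sumL-0 : ∀ (xs : List A) → sumL (λ _ → 0ℚ) xs ≡ 0ℚ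
    sumL-0 []       = refl
    sumL-0 (x ∷ xs) = trans (ℚP.+-identityˡ _) (sumL-0 xs)

    sumL-mono : ∀ {f g : A → ℚ} xs → (∀ x → f x ≤ g x) → sumL f xs ≤ sumL g xs
    sumL-mono []       le = ≤-refl
    sumL-mono (x ∷ xs) le = +-mono-≤ (le x) (sumL-mono xs le)

    sumL-single : ∀ (f : A → ℚ) {a xs} → a ∈ xs → Unique xs →
                  (∀ x → x ≢ a → f x ≡ 0ℚ) → sumL f xs ≡ f a
    sumL-single f {a} {x ∷ xs} (here refl) (x∉ ∷ _) z =
      trans (cong (f x +_) (trans (sumL-cong xs λ y m → z y λ e → All.lookup x∉ m (sym e)) (sumL-0 xs)))
            (ℚP.+-identityʳ _)
    sumL-single f {a} {x ∷ xs} (there m) (x∉ ∷ u) z =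
      trans (cong₂ _+_ (z x (All.lookup x∉ m)) (sumL-single f m u z)) (ℚP.+-identityˡ _)

    sumL-swap : ∀ {B : Set} (f : A → B → ℚ) xs (ys : List B) →
                sumL (λ x → sumL (f x) ys) xs ≡ sumL (λ y → sumL (λ x → f x y) xs) ys
    sumL-swap f []       ys = sym (sumL-0′ ys)
      where
      sumL-0′ : ∀ {B : Set} (xs : List B) → sumL (λ _ → 0ℚ) xs ≡ 0ℚ
      sumL-0′ []       = refl
      sumL-0′ (x ∷ xs) = trans (ℚP.+-identityˡ _) (sumL-0′ xs)
    sumL-swap {B} f (x ∷ xs) ys = trans (cong (sumL (f x) ys +_) (sumL-swap f xs ys)) (sym (sumL-+′ ys))
      where
      sumL-+′ : ∀ ys → sumL (λ y → f x y + sumL (λ x → f x y) xs) ys ≡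
                sumL (f x) ys + sumL (λ y → sumL (λ x → f x y) xs) ys
      sumL-+′ []       = refl
      sumL-+′ (y ∷ ys) = trans (cong (f x y + sumL (λ x → f x y) xs +_) (sumL-+′ ys))
        (lem (f x y) (sumL (λ x → f x y) xs) (sumL (f x) ys) (sumL (λ y → sumL (λ x → f x y) xs) ys))
        where
        lem : ∀ a b c d → (a + b) + (c + d) ≡ (a + c) + (b + d)
        lem = solve-∀ ℚring

  x-y≡0⇒x≡y : ∀ x y → x - y ≡ 0ℚ → x ≡ y
  x-y≡0⇒x≡y x y e = trans (lem x y) (trans (cong (_+ y) e) (ℚP.+-identityˡ y))
    where
    lem : ∀ a b → a ≡ (a - b) + b
    lem = solve-∀ ℚring

  <-or-≥ : ∀ a b → a < b ⊎ b ≤ a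
  <-or-≥ a b with a ℚP.<? b
  ... | yes lt = inj₁ lt
  ... | no ge  = inj₂ (ℚP.≮⇒≥ ge)

  nat : ℕ → ℚ
  nat zero    = 0ℚ
  nat (suc n) = 1ℚ + nat n

  nat-+ : ∀ m n → nat (m ℕ.+ n) ≡ nat m + nat n
  nat-+ zero    n = sym (ℚP.+-identityˡ (nat n))
  nat-+ (suc m) n = trans (cong (1ℚ +_) (nat-+ m n)) (sym (ℚP.+-assoc 1ℚ (nat m) (nat n)))

  0≤nat : ∀ n → 0ℚ ≤ nat n
  0≤nat zero    = ≤-refl
  0≤nat (suc n) = 0≤-+ 0≤1 (0≤nat n)

  nat-mono : ∀ {m n} → m ℕ.≤ n → nat m ≤ nat n
  nat-mono {n = n} z≤n = 0≤nat n
  nat-mono (s≤s le) = ℚP.+-monoʳ-≤ 1ℚ (nat-mono le)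

  IsInt : ℚ → Set
  IsInt x = Σ ℕ λ m → Σ ℕ λ n → x ≡ nat m - nat n

  int-bit : ∀ {x} → Bit x → IsInt x
  int-bit (inj₁ refl) = 0 , 0 , refl
  int-bit (inj₂ refl) = 1 , 0 , refl

  int-+ : ∀ {x y} → IsInt x → IsInt y → IsInt (x + y)
  int-+ (m , n , refl) (m′ , n′ , refl) = m ℕ.+ m′ , n ℕ.+ n′ ,
    trans (lem (nat m) (nat n) (nat m′) (nat n′)) (sym (cong₂ _-_ (nat-+ m m′) (nat-+ n n′)))
    where
    lem : ∀ a b c d → (a - b) + (c - d) ≡ (a + c) - (b + d)
    lem = solve-∀ ℚring

  int-neg : ∀ {x} → IsInt x → IsInt (- x)
  int-neg (m , n , refl) = n , m , lem (nat m) (nat n)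
    where
    lem : ∀ a b → - (a - b) ≡ b - a
    lem = solve-∀ ℚring

  int-gap : ∀ {x} → IsInt x → 0ℚ < x → x < 1ℚ → ⊥
  int-gap (m , n , refl) 0<x x<1 with ℕP.≤-<-connex m n
  ... | inj₁ m≤n = <≤-absurd 0<x (subst (nat m - nat n ≤_) (ℚP.+-inverseʳ (nat n)) (ℚP.+-monoˡ-≤ (- nat n) (nat-mono m≤n)))
  ... | inj₂ n<m = <≤-absurd x<1 (subst (_≤ nat m - nat n) (lem (nat n)) (ℚP.+-monoˡ-≤ (- nat n) (nat-mono n<m)))
    where
    lem : ∀ a → (1ℚ + a) - a ≡ 1ℚ
    lem = solve-∀ ℚring

  int-sumL : ∀ {A : Set} (f : A → ℚ) xs → (∀ x → IsInt (f x)) → IsInt (sumL f xs)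
  int-sumL f []       ints = 0 , 0 , refl
  int-sumL f (x ∷ xs) ints = int-+ (ints x) (int-sumL f xs ints)

  ind : Bool → ℚ
  ind b = if b then 1ℚ else 0ℚ

  ind-injective : ∀ b c → ind b ≡ ind c → b ≡ c
  ind-injective true  true  e = refl
  ind-injective false false e = refl
  ind-injective true  false e = ⊥-elim (0≢1ℚ (sym e))
  ind-injective false true  e = ⊥-elim (0≢1ℚ e)

  guard : Bool → ℚ → ℚ
  guard b x = if b then x else 0ℚ

  sumL-++ : ∀ {A : Set} (f : A → ℚ) xs ys → sumL f (xs List.++ ys) ≡ sumL f xs + sumL f ys
  sumL-++ f []       ys = sym (ℚP.+-identityˡ (sumL f ys))
  sumL-++ f (x ∷ xs) ys = trans (cong (f x +_) (sumL-++ f xs ys)) (sym (ℚP.+-assoc (f x) (sumL f xs) (sumL f ys)))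

  sumL-concatMap : ∀ {A B : Set} (f : B → ℚ) (h : A → List B) xs →
                   sumL f (concatMap h xs) ≡ sumL (λ x → sumL f (h x)) xs
  sumL-concatMap f h []       = refl
  sumL-concatMap f h (x ∷ xs) = trans (sumL-++ f (h x) (concatMap h xs)) (cong (sumL f (h x) +_) (sumL-concatMap f h xs))

  sumL-map : ∀ {A B : Set} (f : B → ℚ) (h : A → B) xs → sumL f (List.map h xs) ≡ sumL (λ x → f (h x)) xs
  sumL-map f h []       = refl
  sumL-map f h (x ∷ xs) = cong (f (h x) +_) (sumL-map f h xs)

open RationalSums

-- Boolean quantifiers over lists.

allB-sound : ∀ {A : Set} (p : A → Bool) xs → allB p xs ≡ true → ∀ x → x ∈ xs → p x ≡ true
allB-sound p (x ∷ xs) e y m with p x in px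
allB-sound p (x ∷ xs) e y (here refl) | true = px
allB-sound p (x ∷ xs) e y (there m)   | true = allB-sound p xs e y m
allB-sound p (x ∷ xs) () y m          | false

allB-complete : ∀ {A : Set} (p : A → Bool) xs → (∀ x → p x ≡ true) → allB p xs ≡ true
allB-complete p []       all = refl
allB-complete p (x ∷ xs) all = cong₂ _∧_ (all x) (allB-complete p xs all)

anyB-sound : ∀ {A : Set} (p : A → Bool) xs → anyB p xs ≡ true → ∃ λ x → x ∈ xs × p x ≡ true
anyB-sound p (x ∷ xs) e with p x in px
... | true  = x , here refl , px
... | false = let y , m , py = anyB-sound p xs e in y , there m , py

anyB-complete : ∀ {A : Set} (p : A → Bool) xs x → x ∈ xs → p x ≡ true → anyB p xs ≡ true
anyB-complete p (x ∷ xs) .x (here refl) px = cong (_∨ anyB p xs) px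
anyB-complete p (x ∷ xs) y (there m) py = trans (cong (p x ∨_) (anyB-complete p xs y m py)) (BoolP.∨-zeroʳ (p x))

head-or : ∀ {A : Set} → A → List A → A
head-or d []      = d
head-or d (x ∷ _) = x

∧-split : ∀ {a b} → a ∧ b ≡ true → a ≡ true × b ≡ true
∧-split {true} {true} e = refl , refl

-- Vector spaces over a finite field and their linear maps.

module Linear (F : FiniteField) where
  open FiniteField F public
    renaming (_+_ to _+F_; _*_ to _*F_; -_ to -F_; _≟_ to _≟F_; inverse to inverseF)
    hiding (size)
  q : ℕ
  q = FiniteField.size F

  Fring : CommutativeRing 0ℓ 0ℓ
  Fring = record { isCommutativeRing = isCommutativeRing }

  module R = CommutativeRing Fring

  enum-F : Enum Carrier q
  enum-F = record
    { at = List.lookup elements ; idx = λ a → Any.index (complete a)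
    ; at-idx = λ a → sym (lookup-index (complete a)) }

  -- Negatives are derived: by `smul-0` the multiple by -1 is an inverse. Subspaces appear as
  -- injective linear maps out of such spaces, not as subsets.
  record VS : Set₁ where
    no-eta-equality
    field
      Car : Set
      add : Car → Car → Car
      smul : Carrier → Car → Car
      𝟘 : Car
      add-assoc : ∀ u v w → add (add u v) w ≡ add u (add v w)
      add-comm  : ∀ u v → add u v ≡ add v u
      add-idˡ   : ∀ v → add 𝟘 v ≡ v
      smul-add  : ∀ s v w → smul s (add v w) ≡ add (smul s v) (smul s w)
      add-smul  : ∀ s t v → smul (s +F t) v ≡ add (smul s v) (smul t v)
      smul-smul : ∀ s t v → smul (s *F t) v ≡ smul s (smul t v)
      smul-1    : ∀ v → smul 1# v ≡ v
      smul-0    : ∀ v → smul 0# v ≡ 𝟘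
      _≟V_      : DecidableEquality Car
  open VS public using (Car)

  infixl 6 add-syntax
  infixr 7 smul-syntax
  add-syntax : (V : VS) → Car V → Car V → Car V
  add-syntax = VS.add
  smul-syntax : (V : VS) → Carrier → Car V → Car V
  smul-syntax = VS.smul
  syntax add-syntax V v w = v +[ V ] w
  syntax smul-syntax V s v = s ·[ V ] v

  0[_] : (V : VS) → Car V
  0[ V ] = VS.𝟘 V

  module VSProps (V : VS) where
    open VS V

    add-idʳ : ∀ v → add v 𝟘 ≡ v
    add-idʳ v = trans (add-comm v 𝟘) (add-idˡ v)

    smul-𝟘 : ∀ s → smul s 𝟘 ≡ 𝟘
    smul-𝟘 s = begin
      smul s 𝟘             ≡⟨ cong (smul s) (smul-0 𝟘) ⟨
      smul s (smul 0# 𝟘)   ≡⟨ smul-smul s 0# 𝟘 ⟨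
      smul (s *F 0#) 𝟘     ≡⟨ cong (λ t → smul t 𝟘) (R.zeroʳ s) ⟩
      smul 0# 𝟘            ≡⟨ smul-0 𝟘 ⟩
      𝟘                    ∎
      where open ≡-Reasoning

    neg : Car V → Car V
    neg v = smul (-F 1#) v

    neg-inverse : ∀ v → add v (neg v) ≡ 𝟘
    neg-inverse v = begin
      add v (neg v)                  ≡⟨ cong (λ w → add w (neg v)) (smul-1 v) ⟨
      add (smul 1# v) (neg v)        ≡⟨ add-smul 1# (-F 1#) v ⟨
      smul (1# +F (-F 1#)) v         ≡⟨ cong (λ t → smul t v) (R.-‿inverseʳ 1#) ⟩
      smul 0# v                      ≡⟨ smul-0 v ⟩
      𝟘                              ∎
      where open ≡-Reasoning

    interchange : ∀ a b c d → add (add a b) (add c d) ≡ add (add a c) (add b d)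
    interchange a b c d = begin
      add (add a b) (add c d)   ≡⟨ add-assoc a b (add c d) ⟩
      add a (add b (add c d))   ≡⟨ cong (add a) (add-assoc b c d) ⟨
      add a (add (add b c) d)   ≡⟨ cong (λ z → add a (add z d)) (add-comm b c) ⟩
      add a (add (add c b) d)   ≡⟨ cong (add a) (add-assoc c b d) ⟩
      add a (add c (add b d))   ≡⟨ add-assoc a c (add b d) ⟨
      add (add a c) (add b d)   ∎
      where open ≡-Reasoning

    isolate : ∀ a b → add a b ≡ 𝟘 → a ≡ neg b
    isolate a b e = begin
      a                         ≡⟨ add-idʳ a ⟨
      add a 𝟘                   ≡⟨ cong (add a) (neg-inverse b) ⟨
      add a (add b (neg b))     ≡⟨ add-assoc a b (neg b) ⟨
      add (add a b) (neg b)     ≡⟨ cong (λ z → add z (neg b)) e ⟩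
      add 𝟘 (neg b)             ≡⟨ add-idˡ (neg b) ⟩
      neg b                     ∎
      where open ≡-Reasoning

    sub-zero : ∀ a b → add a (neg b) ≡ 𝟘 → a ≡ b
    sub-zero a b e = begin
      a                         ≡⟨ isolate a (neg b) e ⟩
      neg (neg b)               ≡⟨ smul-smul (-F 1#) (-F 1#) b ⟨
      smul ((-F 1#) *F (-F 1#)) b ≡⟨ cong (λ t → smul t b) neg² ⟩
      smul 1# b                 ≡⟨ smul-1 b ⟩
      b                         ∎
      where
      open ≡-Reasoning
      open import Algebra.Properties.Ring (R.ring) using (-‿distribˡ-*; -‿involutive)
      neg² : (-F 1#) *F (-F 1#) ≡ 1#
      neg² = trans (sym (-‿distribˡ-* 1# (-F 1#)))
               (trans (cong -F_ (R.*-identityˡ (-F 1#))) (-‿involutive 1#))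

    cancel-smul : ∀ s v → s ≢ 0# → smul s v ≡ 𝟘 → v ≡ 𝟘
    cancel-smul s v s≢0 e with inverseF s s≢0
    ... | t , st = begin
      v                    ≡⟨ smul-1 v ⟨
      smul 1# v            ≡⟨ cong (λ z → smul z v) (trans (R.*-comm t s) st) ⟨
      smul (t *F s) v      ≡⟨ smul-smul t s v ⟩
      smul t (smul s v)    ≡⟨ cong (smul t) e ⟩
      smul t 𝟘             ≡⟨ smul-𝟘 t ⟩
      𝟘                    ∎
      where open ≡-Reasoning

  𝟙 : VS
  VS.Car 𝟙 = ⊤
  VS.add 𝟙 = λ _ _ → tt
  VS.smul 𝟙 = λ _ _ → tt
  VS.𝟘 𝟙 = tt
  VS.add-assoc 𝟙 = λ _ _ _ → refl
  VS.add-comm 𝟙 = λ _ _ → refl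
  VS.add-idˡ 𝟙 = λ _ → refl
  VS.smul-add 𝟙 = λ _ _ _ → refl
  VS.add-smul 𝟙 = λ _ _ _ → refl
  VS.smul-smul 𝟙 = λ _ _ _ → refl
  VS.smul-1 𝟙 = λ _ → refl
  VS.smul-0 𝟙 = λ _ → refl
  VS._≟V_ 𝟙 = λ _ _ → yes refl

  𝔽 : VS
  VS.Car 𝔽 = Carrier
  VS.add 𝔽 = _+F_
  VS.smul 𝔽 = _*F_
  VS.𝟘 𝔽 = 0#
  VS.add-assoc 𝔽 = R.+-assoc
  VS.add-comm 𝔽 = R.+-comm
  VS.add-idˡ 𝔽 = R.+-identityˡ
  VS.smul-add 𝔽 = R.distribˡ
  VS.add-smul 𝔽 = λ s t v → R.distribʳ v s t
  VS.smul-smul 𝔽 = R.*-assoc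
  VS.smul-1 𝔽 = R.*-identityˡ
  VS.smul-0 𝔽 = R.zeroˡ
  VS._≟V_ 𝔽 = _≟F_

  infixr 5 _⊗_
  _⊗_ : VS → VS → VS
  VS.Car (V ⊗ W) = Car V × Car W
  VS.add (V ⊗ W) = λ (v , w) (v′ , w′) → VS.add V v v′ , VS.add W w w′
  VS.smul (V ⊗ W) = λ s (v , w) → VS.smul V s v , VS.smul W s w
  VS.𝟘 (V ⊗ W) = VS.𝟘 V , VS.𝟘 W
  VS.add-assoc (V ⊗ W) = λ _ _ _ → cong₂ _,_ (VS.add-assoc V _ _ _) (VS.add-assoc W _ _ _)
  VS.add-comm (V ⊗ W) = λ _ _ → cong₂ _,_ (VS.add-comm V _ _) (VS.add-comm W _ _)
  VS.add-idˡ (V ⊗ W) = λ _ → cong₂ _,_ (VS.add-idˡ V _) (VS.add-idˡ W _)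
  VS.smul-add (V ⊗ W) = λ _ _ _ → cong₂ _,_ (VS.smul-add V _ _ _) (VS.smul-add W _ _ _)
  VS.add-smul (V ⊗ W) = λ _ _ _ → cong₂ _,_ (VS.add-smul V _ _ _) (VS.add-smul W _ _ _)
  VS.smul-smul (V ⊗ W) = λ _ _ _ → cong₂ _,_ (VS.smul-smul V _ _ _) (VS.smul-smul W _ _ _)
  VS.smul-1 (V ⊗ W) = λ _ → cong₂ _,_ (VS.smul-1 V _) (VS.smul-1 W _)
  VS.smul-0 (V ⊗ W) = λ _ → cong₂ _,_ (VS.smul-0 V _) (VS.smul-0 W _)
  VS._≟V_ (V ⊗ W) (v , w) (v′ , w′) with VS._≟V_ V v v′ | VS._≟V_ W w w′
  ... | yes refl | yes refl = yes refl
  ... | no ne    | _        = no λ { refl → ne refl }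
  ... | _        | no ne    = no λ { refl → ne refl }

  Pow : VS → ℕ → VS
  Pow V zero    = 𝟙
  Pow V (suc n) = V ⊗ Pow V n

  Fⁿ : ℕ → VS
  Fⁿ = Pow 𝔽

  enum-Pow : ∀ {V s} → Enum (Car V) s → ∀ n → Enum (Car (Pow V n)) (s ℕ.^ n)
  enum-Pow e zero    = record { at = λ _ → tt ; idx = λ _ → zero ; at-idx = λ _ → refl }
  enum-Pow e (suc n) = enum-× e (enum-Pow e n)

  infix 4 _⊸_
  record _⊸_ (V W : VS) : Set where
    infixr 8 _$_
    field
      _$_   : Car V → Car W
      +-hom : ∀ v w → _$_ (v +[ V ] w) ≡ (_$_ v) +[ W ] (_$_ w)
      ·-hom : ∀ s v → _$_ (s ·[ V ] v) ≡ s ·[ W ] (_$_ v)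
  open _⊸_ public

  Inj : ∀ {V W} → V ⊸ W → Set
  Inj {V} {W} φ = ∀ v → φ $ v ≡ 0[ W ] → v ≡ 0[ V ]

  module _ {V W : VS} (φ : V ⊸ W) where
    0-hom : φ $ 0[ V ] ≡ 0[ W ]
    0-hom = trans (cong (φ $_) (sym (VS.smul-0 V 0[ V ]))) (trans (·-hom φ 0# 0[ V ]) (VS.smul-0 W _))

    inj-≢0 : Inj φ → ∀ {v} → v ≢ 0[ V ] → φ $ v ≢ 0[ W ]
    inj-≢0 inj ne e = ne (inj _ e)

    injective : Inj φ → ∀ {v w} → φ $ v ≡ φ $ w → v ≡ w
    injective inj {v} {w} e = VSProps.sub-zero V v w (inj _ (begin
      φ $ (v +[ V ] (VSProps.neg V w))            ≡⟨ +-hom φ v _ ⟩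
      (φ $ v) +[ W ] (φ $ (VSProps.neg V w))      ≡⟨ cong₂ (VS.add W) e (·-hom φ _ w) ⟩
      (φ $ w) +[ W ] (VSProps.neg W (φ $ w))      ≡⟨ VSProps.neg-inverse W (φ $ w) ⟩
      0[ W ]                                      ∎))
      where open ≡-Reasoning

  idL : ∀ {V} → V ⊸ V
  idL = record { _$_ = λ v → v ; +-hom = λ _ _ → refl ; ·-hom = λ _ _ → refl }

  infixr 9 _∘L_
  _∘L_ : ∀ {U V W} → V ⊸ W → U ⊸ V → U ⊸ W
  φ ∘L ψ = record
    { _$_ = λ u → φ $ (ψ $ u)
    ; +-hom = λ u v → trans (cong (φ $_) (+-hom ψ u v)) (+-hom φ _ _)
    ; ·-hom = λ s v → trans (cong (φ $_) (·-hom ψ s v)) (·-hom φ _ _) }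

  ∘-inj : ∀ {U V W} (φ : V ⊸ W) (ψ : U ⊸ V) → Inj φ → Inj ψ → Inj (φ ∘L ψ)
  ∘-inj φ ψ i j u e = j u (i _ e)

  fstL : ∀ {V W} → V ⊗ W ⊸ V
  fstL = record { _$_ = proj₁ ; +-hom = λ _ _ → refl ; ·-hom = λ _ _ → refl }

  sndL : ∀ {V W} → V ⊗ W ⊸ W
  sndL = record { _$_ = proj₂ ; +-hom = λ _ _ → refl ; ·-hom = λ _ _ → refl }

  infixr 5 _&_
  _&_ : ∀ {U V W} → U ⊸ V → U ⊸ W → U ⊸ V ⊗ W
  φ & ψ = record
    { _$_ = λ u → φ $ u , ψ $ u
    ; +-hom = λ u v → cong₂ _,_ (+-hom φ u v) (+-hom ψ u v)
    ; ·-hom = λ s v → cong₂ _,_ (·-hom φ s v) (·-hom ψ s v) }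

  zeroL : ∀ {V W} → V ⊸ W
  zeroL {V} {W} = record
    { _$_ = λ _ → 0[ W ] ; +-hom = λ _ _ → sym (VS.add-idˡ W _)
    ; ·-hom = λ s _ → sym (VSProps.smul-𝟘 W s) }

  ray : ∀ V → Car V → 𝔽 ⊸ V
  ray V v = record
    { _$_ = λ s → s ·[ V ] v ; +-hom = λ s t → VS.add-smul V s t v
    ; ·-hom = λ s t → VS.smul-smul V s t v }

  infixl 6 _⊹_
  _⊹_ : ∀ {V W} → V ⊸ W → V ⊸ W → V ⊸ W
  _⊹_ {V} {W} φ ψ = record
    { _$_ = λ v → (φ $ v) +[ W ] (ψ $ v)
    ; +-hom = λ u v → trans (cong₂ (VS.add W) (+-hom φ u v) (+-hom ψ u v))
                            (VSProps.interchange W _ _ _ _)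
    ; ·-hom = λ s v → trans (cong₂ (VS.add W) (·-hom φ s v) (·-hom ψ s v))
                            (sym (VS.smul-add W s _ _)) }

  infixr 5 _⊗L_
  _⊗L_ : ∀ {V V′ W W′} → V ⊸ V′ → W ⊸ W′ → V ⊗ W ⊸ V′ ⊗ W′
  φ ⊗L ψ = (φ ∘L fstL) & (ψ ∘L sndL)

  ⊗-inj : ∀ {V V′ W W′} (φ : V ⊸ V′) (ψ : W ⊸ W′) → Inj φ → Inj ψ → Inj (φ ⊗L ψ)
  ⊗-inj φ ψ i j (v , w) e = cong₂ _,_ (i v (cong proj₁ e)) (j w (cong proj₂ e))

  append : ∀ m n → Fⁿ m ⊗ Fⁿ n ⊸ Fⁿ (m ℕ.+ n)
  append zero    n = sndL
  append (suc m) n = (fstL ∘L fstL) & append m n ∘L ((sndL ∘L fstL) & sndL)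

  append-inj : ∀ m n → Inj (append m n)
  append-inj zero    n (tt , w) e = cong (tt ,_) e
  append-inj (suc m) n ((x , v) , w) e = cong₂ _,_ (cong₂ _,_ (cong proj₁ e) (cong proj₁ ih)) (cong proj₂ ih)
    where ih = append-inj m n (v , w) (cong proj₂ e)

  pad : ∀ {m n} → m ℕ.≤ n → Fⁿ m ⊸ Fⁿ n
  pad z≤n     = zeroL
  pad (s≤s p) = fstL & pad p ∘L sndL

  pad-inj : ∀ {m n} (p : m ℕ.≤ n) → Inj (pad p)
  pad-inj z≤n     tt      e = refl
  pad-inj (s≤s p) (x , v) e = cong₂ _,_ (cong proj₁ e) (pad-inj p v (cong proj₂ e))

  -- Spaces are assembled from `⊗` and `Pow` in whatever shape an argument calls for; this records
  -- the dimension that they cost.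
  record Embeds (V : VS) (n : ℕ) : Set where
    constructor embeds
    field
      emb     : V ⊸ Fⁿ n
      emb-inj : Inj emb
  open Embeds public

  embeds-Fⁿ : ∀ n → Embeds (Fⁿ n) n
  embeds-Fⁿ n = embeds idL λ _ e → e

  embeds-𝔽 : Embeds 𝔽 1
  embeds-𝔽 = embeds (idL & zeroL) λ _ e → cong proj₁ e

  embeds-⊗ : ∀ {V W m n} → Embeds V m → Embeds W n → Embeds (V ⊗ W) (m ℕ.+ n)
  embeds-⊗ {m = m} {n} (embeds φ i) (embeds ψ j) =
    embeds (append m n ∘L (φ ⊗L ψ)) (∘-inj (append m n) (φ ⊗L ψ) (append-inj m n) (⊗-inj φ ψ i j))

  embeds-Pow : ∀ {V m} n → Embeds V m → Embeds (Pow V n) (n ℕ.* m)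
  embeds-Pow zero    e = embeds idL λ _ e → e
  embeds-Pow (suc n) e = embeds-⊗ e (embeds-Pow n e)

-- Sums over all vectors and over all points of a coordinate space.

module Summation (F : FiniteField) where
  open import Data.Rational using (_+_; _*_; _-_; -_; _≤_; _<_)
  open Linear F public

  Vecs : ℕ → Set
  Vecs n = Car (Fⁿ n)

  ΣF : (Carrier → ℚ) → ℚ
  ΣF f = sumL f elements

  Sum : ∀ n → (Vecs n → ℚ) → ℚ
  Sum zero    f = f tt
  Sum (suc n) f = ΣF (λ x → Sum n (λ v → f (x , v)))

  Sum-cong : ∀ n {f g : Vecs n → ℚ} → (∀ v → f v ≡ g v) → Sum n f ≡ Sum n g
  Sum-cong zero    eq = eq tt
  Sum-cong (suc n) eq = sumL-cong elements λ x _ → Sum-cong n (λ v → eq (x , v))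

  Sum-+ : ∀ n (f g : Vecs n → ℚ) → Sum n (λ v → f v + g v) ≡ Sum n f + Sum n g
  Sum-+ zero    f g = refl
  Sum-+ (suc n) f g = trans (sumL-cong elements λ x _ → Sum-+ n (λ v → f (x , v)) (λ v → g (x , v)))
                            (sumL-+ _ _ elements)

  Sum-* : ∀ n c (f : Vecs n → ℚ) → Sum n (λ v → c * f v) ≡ c * Sum n f
  Sum-* zero    c f = refl
  Sum-* (suc n) c f = trans (sumL-cong elements λ x _ → Sum-* n c (λ v → f (x , v)))
                            (sumL-* c _ elements)

  Sum-- : ∀ n (f g : Vecs n → ℚ) → Sum n (λ v → f v - g v) ≡ Sum n f - Sum n g
  Sum-- n f g = begin
    Sum n (λ v → f v - g v)                  ≡⟨ Sum-cong n (λ v → lem (f v) (g v)) ⟩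
    Sum n (λ v → f v + (- 1ℚ) * g v)         ≡⟨ Sum-+ n f _ ⟩
    Sum n f + Sum n (λ v → (- 1ℚ) * g v)     ≡⟨ cong (Sum n f +_) (Sum-* n (- 1ℚ) g) ⟩
    Sum n f + (- 1ℚ) * Sum n g               ≡⟨ lem (Sum n f) (Sum n g) ⟨
    Sum n f - Sum n g                        ∎
    where
    open ≡-Reasoning
    lem : ∀ a b → a - b ≡ a + (- 1ℚ) * b
    lem = solve-∀ ℚring

  Sum-mono : ∀ n {f g : Vecs n → ℚ} → (∀ v → f v ≤ g v) → Sum n f ≤ Sum n g
  Sum-mono zero    le = le tt
  Sum-mono (suc n) le = sumL-mono elements λ x → Sum-mono n (λ v → le (x , v))

  Sum-0 : ∀ n → Sum n (λ _ → 0ℚ) ≡ 0ℚ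
  Sum-0 zero    = refl
  Sum-0 (suc n) = trans (sumL-cong elements λ _ _ → Sum-0 n) (sumL-0 elements)

  Sum-zero : ∀ n {f : Vecs n → ℚ} → (∀ v → f v ≡ 0ℚ) → Sum n f ≡ 0ℚ
  Sum-zero n eq = trans (Sum-cong n eq) (Sum-0 n)

  Sum-nonneg : ∀ n {f : Vecs n → ℚ} → (∀ v → 0ℚ ≤ f v) → 0ℚ ≤ Sum n f
  Sum-nonneg n {f} le = subst (_≤ Sum n f) (Sum-0 n) (Sum-mono n le)

  Sum-single : ∀ n (f : Vecs n → ℚ) a → (∀ v → v ≢ a → f v ≡ 0ℚ) → Sum n f ≡ f a
  Sum-single zero    f tt      z = refl
  Sum-single (suc n) f (x , a) z =
    trans (sumL-single _ (complete x) unique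
            (λ y ne → Sum-zero n (λ v → z (y , v) (ne ∘ cong proj₁))))
          (Sum-single n _ a (λ v ne → z (x , v) (ne ∘ cong proj₂)))

  Sum-ΣF : ∀ n (f : Vecs n → Carrier → ℚ) →
           Sum n (λ v → ΣF (f v)) ≡ ΣF (λ x → Sum n (λ v → f v x))
  Sum-ΣF zero    f = refl
  Sum-ΣF (suc n) f = trans (sumL-cong elements λ x _ → Sum-ΣF n (λ v → f (x , v)))
                           (sumL-swap _ elements elements)

  Sum-swap : ∀ m n (f : Vecs m → Vecs n → ℚ) →
             Sum m (λ v → Sum n (f v)) ≡ Sum n (λ w → Sum m (λ v → f v w))
  Sum-swap m zero    f = refl
  Sum-swap m (suc n) f = trans (Sum-ΣF m _) (sumL-cong elements λ x _ → Sum-swap m n (λ v w → f v (x , w)))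

  without : ∀ n → Vecs n → (Vecs n → ℚ) → Vecs n → ℚ
  without n a f v with VS._≟V_ (Fⁿ n) v a
  ... | yes _ = 0ℚ
  ... | no _  = f v

  without-≢ : ∀ n (a : Vecs n) f {v} → v ≢ a → without n a f v ≡ f v
  without-≢ n a f {v} ne with VS._≟V_ (Fⁿ n) v a
  ... | yes e = ⊥-elim (ne e)
  ... | no _  = refl

  without-≡ : ∀ n (a : Vecs n) f → without n a f a ≡ 0ℚ
  without-≡ n a f with VS._≟V_ (Fⁿ n) a a
  ... | yes _ = refl
  ... | no ne = ⊥-elim (ne refl)

  without-nonneg : ∀ n (a : Vecs n) {f} → (∀ v → 0ℚ ≤ f v) → ∀ v → 0ℚ ≤ without n a f v
  without-nonneg n a le v with VS._≟V_ (Fⁿ n) v a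
  ... | yes _ = ≤-refl
  ... | no _  = le v

  Sum-without : ∀ n (f : Vecs n → ℚ) a → Sum n f ≡ f a + Sum n (without n a f)
  Sum-without n f a = begin
    Sum n f                                                        ≡⟨ Sum-cong n (λ v → lem (f v) (without n a f v)) ⟩
    Sum n (λ v → (f v - without n a f v) + without n a f v)            ≡⟨ Sum-+ n (λ v → f v - without n a f v) (without n a f) ⟩
    Sum n (λ v → f v - without n a f v) + Sum n (without n a f)        ≡⟨ cong (_+ Sum n (without n a f)) single ⟩
    f a + Sum n (without n a f)                                      ∎
    where
    open ≡-Reasoning
    lem : ∀ x y → x ≡ (x - y) + y
    lem = solve-∀ ℚring
    at-a : f a - without n a f a ≡ f a
    at-a = trans (cong (λ z → f a - z) (without-≡ n a f)) (ℚP.+-identityʳ (f a))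
    single : Sum n (λ v → f v - without n a f v) ≡ f a
    single = trans (Sum-single n (λ v → f v - without n a f v) a
               (λ v ne → trans (cong (λ z → f v - z) (without-≢ n a f ne)) (ℚP.+-inverseʳ (f v)))) at-a

  Sum-≥ : ∀ n {f : Vecs n → ℚ} → (∀ v → 0ℚ ≤ f v) → ∀ a → f a ≤ Sum n f
  Sum-≥ n {f} le a = ≤-by (Sum-nonneg n (without-nonneg n a le)) (sym (Sum-without n f a))

  Sum-≥₂ : ∀ n {f : Vecs n → ℚ} → (∀ v → 0ℚ ≤ f v) → ∀ a b → a ≢ b → f a + f b ≤ Sum n f
  Sum-≥₂ n {f} le a b ne = subst (f a + f b ≤_) (sym (Sum-without n f a))
    (+-mono-≤ (≤-refl {f a}) (subst (_≤ Sum n (without n a f)) (without-≢ n a f (ne ∘ sym)) (Sum-≥ n (without-nonneg n a le) b)))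

  -- Used to pass from the total of a k-space to the weight of its only point that is not yet under
  -- control.
  Sum-agree-off : ∀ n (f g : Vecs n → ℚ) a → (∀ v → v ≢ a → f v ≡ g v) →
                  Sum n f - Sum n g ≡ f a - g a
  Sum-agree-off n f g a eq = trans (sym (Sum-- n f g))
    (Sum-single n _ a λ v ne → trans (cong (_- g v) (eq v ne)) (ℚP.+-inverseʳ (g v)))

  q̂ : ℚ
  q̂ = ΣF (λ _ → 1ℚ)

  2≤q̂ : 1ℚ + 1ℚ ≤ q̂
  2≤q̂ = Sum-≥₂ 1 {λ _ → 1ℚ} (λ _ → 0≤1) (0# , tt) (1# , tt) (0≢1 ∘ cong proj₁)

  0<q̂ : 0ℚ < q̂
  0<q̂ = ℚP.<-≤-trans (ℚP.positive⁻¹ (1ℚ + 1ℚ)) 2≤q̂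

  ΣF-const : ∀ c → ΣF (λ _ → c) ≡ q̂ * c
  ΣF-const c = trans (sumL-cong elements λ _ _ → sym (ℚP.*-identityʳ c))
                     (trans (sumL-* c _ elements) (ℚP.*-comm c q̂))

  abstract
    q⁻¹ : ℚ
    q⁻¹ = ℚ.1/_ q̂ {{ℚ.>-nonZero 0<q̂}}

    q̂*q⁻¹ : q̂ * q⁻¹ ≡ 1ℚ
    q̂*q⁻¹ = ℚP.*-inverseʳ q̂ {{ℚ.>-nonZero 0<q̂}}

  q̂-cancel : ∀ x y → q̂ * x ≡ q̂ * y → x ≡ y
  q̂-cancel x y e = begin
    x                 ≡⟨ lem x ⟨
    q⁻¹ * (q̂ * x)     ≡⟨ cong (q⁻¹ *_) e ⟩
    q⁻¹ * (q̂ * y)     ≡⟨ lem y ⟩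
    y                 ∎
    where
    open ≡-Reasoning
    lem : ∀ z → q⁻¹ * (q̂ * z) ≡ z
    lem z = begin
      q⁻¹ * (q̂ * z)    ≡⟨ ℚP.*-assoc q⁻¹ q̂ z ⟨
      (q⁻¹ * q̂) * z    ≡⟨ cong (_* z) (ℚP.*-comm q⁻¹ q̂) ⟩
      (q̂ * q⁻¹) * z    ≡⟨ cong (_* z) q̂*q⁻¹ ⟩
      1ℚ * z            ≡⟨ ℚP.*-identityˡ z ⟩
      z                 ∎

  0≤q⁻¹ : 0ℚ ≤ q⁻¹
  0≤q⁻¹ with ℚP.≤-total 0ℚ q⁻¹
  ... | inj₁ le = le
  ... | inj₂ le = ⊥-elim (<≤-absurd 0<1 (subst₂ _≤_ q̂*q⁻¹ (ℚP.*-zeroʳ q̂)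
                    (ℚP.*-monoˡ-≤-nonNeg q̂ {{ℚ.nonNegative (ℚP.<⇒≤ 0<q̂)}} le)))

  -- The power q^(-n): the constant value whose sum over an n-flat is 1.
  α : ℕ → ℚ
  α zero    = 1ℚ
  α (suc n) = q⁻¹ * α n

  q̂*α : ∀ n → q̂ * α (suc n) ≡ α n
  q̂*α n = trans (sym (ℚP.*-assoc q̂ q⁻¹ (α n))) (trans (cong (_* α n) q̂*q⁻¹) (ℚP.*-identityˡ (α n)))

  Sum-const-α : ∀ n m → Sum n (λ _ → α (n ℕ.+ m)) ≡ α m
  Sum-const-α zero    m = refl
  Sum-const-α (suc n) m = begin
    ΣF (λ _ → Sum n (λ _ → α (suc (n ℕ.+ m))))  ≡⟨ ΣF-const (Sum n (λ _ → α (suc (n ℕ.+ m)))) ⟩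
    q̂ * Sum n (λ _ → α (suc (n ℕ.+ m)))         ≡⟨ cong (λ j → q̂ * Sum n (λ _ → α j)) (ℕP.+-suc n m) ⟨
    q̂ * Sum n (λ _ → α (n ℕ.+ suc m))           ≡⟨ cong (q̂ *_) (Sum-const-α n (suc m)) ⟩
    q̂ * α (suc m)                               ≡⟨ q̂*α m ⟩
    α m                                         ∎
    where open ≡-Reasoning

  0≤α : ∀ n → 0ℚ ≤ α n
  0≤α zero    = 0≤1
  0≤α (suc n) = 0≤-* 0≤q⁻¹ (0≤α n)

  -- The sum over the points of Fⁿ, each represented by its vector with first nonzero coordinate 1.
  ksum : ∀ n → (Vecs n → ℚ) → ℚ
  ksum zero    f = 0ℚ
  ksum (suc n) f = Sum n (λ v → f (1# , v)) + ksum n (λ v → f (0# , v))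

  ksum-cong : ∀ n {f g : Vecs n → ℚ} → (∀ v → v ≢ 0[ Fⁿ n ] → f v ≡ g v) → ksum n f ≡ ksum n g
  ksum-cong zero    eq = refl
  ksum-cong (suc n) eq = cong₂ _+_ (Sum-cong n λ v → eq (1# , v) (λ e → 0≢1 (sym (cong proj₁ e))))
                                   (ksum-cong n λ v ne → eq (0# , v) (ne ∘ cong proj₂))

  ksum-0 : ∀ n → ksum n (λ _ → 0ℚ) ≡ 0ℚ
  ksum-0 zero    = refl
  ksum-0 (suc n) = cong₂ _+_ (Sum-0 n) (ksum-0 n)

  ksum-zero : ∀ n {f : Vecs n → ℚ} → (∀ v → v ≢ 0[ Fⁿ n ] → f v ≡ 0ℚ) → ksum n f ≡ 0ℚ
  ksum-zero n eq = trans (ksum-cong n eq) (ksum-0 n)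

  ksum-- : ∀ n (f g : Vecs n → ℚ) → ksum n (λ v → f v - g v) ≡ ksum n f - ksum n g
  ksum-- zero    f g = refl
  ksum-- (suc n) f g = trans (cong₂ _+_ (Sum-- n (f ∘ (1# ,_)) (g ∘ (1# ,_))) (ksum-- n (f ∘ (0# ,_)) (g ∘ (0# ,_))))
    (lem (Sum n (f ∘ (1# ,_))) (Sum n (g ∘ (1# ,_))) (ksum n (f ∘ (0# ,_))) (ksum n (g ∘ (0# ,_))))
    where
    lem : ∀ a b c d → (a - b) + (c - d) ≡ (a + c) - (b + d)
    lem = solve-∀ ℚring

  ksum-mono : ∀ n {f g : Vecs n → ℚ} → (∀ v → v ≢ 0[ Fⁿ n ] → f v ≤ g v) → ksum n f ≤ ksum n g
  ksum-mono zero    le = ≤-refl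
  ksum-mono (suc n) le = +-mono-≤ (Sum-mono n λ v → le (1# , v) (λ e → 0≢1 (sym (cong proj₁ e))))
                                  (ksum-mono n λ v ne → le (0# , v) (ne ∘ cong proj₂))

  ksum-nonneg : ∀ n {f : Vecs n → ℚ} → (∀ v → v ≢ 0[ Fⁿ n ] → 0ℚ ≤ f v) → 0ℚ ≤ ksum n f
  ksum-nonneg n {f} le = subst (_≤ ksum n f) (ksum-0 n) (ksum-mono n le)

-- Monochromatic flats, and weights made uniform on a flat.

opaque
  -- The dimension of `Z` in `Uniformization`: two for each of `k₁` planes, one for the height, and
  -- `m` for each letter of a Hales-Jewett word over the `q ^ m` vectors of F^m. The colours carry
  -- one bit for each of `e` choices of t and `P` choices each of b and v.
  dim : (q k₁ e m : ℕ) → ℕ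
  dim q k₁ e m = k₁ ℕ.* 2 ℕ.+ (1 ℕ.+ hjN (q ℕ.^ m) (2 ℕ.^ (e ℕ.* (P ℕ.* P))) ℕ.* m)
    where
    P : ℕ
    P = (q ℕ.* q) ℕ.^ k₁

  k₁≤dim : ∀ q k₁ e m → k₁ ℕ.≤ dim q k₁ e m
  k₁≤dim q k₁ e m = ℕP.≤-trans (ℕP.m≤m*n k₁ 2) (ℕP.m≤m+n (k₁ ℕ.* 2) (1 ℕ.+ hjN (q ℕ.^ m) (2 ℕ.^ (e ℕ.* ((q ℕ.* q) ℕ.^ k₁ ℕ.* (q ℕ.* q) ℕ.^ k₁))) ℕ.* m))

module AffineRamsey (F : FiniteField) where
  open import Data.Rational using (_+_; _*_; _-_; -_; _≤_; _<_)
  open Summation F public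
  open import Data.Maybe using (just; nothing)
  open import Data.Vec using ([]; _∷_)
  open import Data.Vec.Relation.Unary.Any using (here; there)

  module _ {V : VS} {s : ℕ} (e : Enum (Car V) s) where
    open Enum e

    decode : ∀ {N} → Word s N → Car (Pow V N)
    decode []      = tt
    decode (a ∷ w) = at a , decode w

    base : ∀ {N} → Pattern s N → Car (Pow V N)
    base []            = tt
    base (just a ∷ w)  = at a , base w
    base (nothing ∷ w) = 0[ V ] , base w

    direction : ∀ {N} → Pattern s N → V ⊸ Pow V N
    direction []            = zeroL
    direction (just a ∷ w)  = zeroL & direction w
    direction (nothing ∷ w) = idL & direction w

    direction-inj : ∀ {N} (w : Pattern s N) → HasStar w → Inj (direction w)
    direction-inj (nothing ∷ w) (here refl) v eq = cong proj₁ eq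
    direction-inj (nothing ∷ w) (there st)  v eq = cong proj₁ eq
    direction-inj (just _ ∷ w)  (there st)  v eq = direction-inj w st v (cong proj₂ eq)

    decode-⟦⟧ : ∀ {N} (w : Pattern s N) a →
                decode (w ⟦ a ⟧) ≡ base w +[ Pow V N ] (direction w $ at a)
    decode-⟦⟧ []            a = refl
    decode-⟦⟧ (just b ∷ w)  a = cong₂ _,_ (sym (VSProps.add-idʳ V (at b))) (decode-⟦⟧ w a)
    decode-⟦⟧ (nothing ∷ w) a = cong₂ _,_ (sym (VS.add-idˡ V (at a))) (decode-⟦⟧ w a)

    MonoFlat : ∀ {r} W → (Car W → Fin r) → Set
    MonoFlat W χ = Σ (Car W) λ u → Σ (V ⊸ W) λ ψ → Inj ψ ×
      (∀ c c′ → χ (u +[ W ] (ψ $ c)) ≡ χ (u +[ W ] (ψ $ c′)))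

    flat-of : ∀ {r} N (χ : Car (Pow V N) → Fin r) → Mono {s} {r} {N} (λ w → χ (decode w)) → MonoFlat (Pow V N) χ
    flat-of N χ (w , st , mono) = base w , direction w , direction-inj w st , λ c c′ →
      trans (cong χ (sym (eq c))) (trans (mono (idx c) (idx c′)) (cong χ (eq c′)))
      where
      eq : ∀ c → decode (w ⟦ idx c ⟧) ≡ base w +[ Pow V N ] (direction w $ c)
      eq c = trans (decode-⟦⟧ w (idx c)) (cong (λ v → base w +[ Pow V N ] (direction w $ v)) (at-idx c))

    abstract
      -- With V itself as alphabet, the variable coordinates of a combinatorial line run through V
      -- together. The line is a translate of a diagonal copy of V, and the copy is faithful because
      -- some coordinate is variable.
      affine-ramsey : ∀ r (χ : Car (Pow V (hjN s r)) → Fin r) → MonoFlat (Pow V (hjN s r)) χ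
      affine-ramsey r χ = flat-of (hjN s r) χ (hj-mono s r (λ w → χ (decode w)))

  -- A weight of points lifted to vectors; its value at 0 is arbitrary and enters no `ksum`. Since
  -- `bit` quantifies over injections, restricting to a subspace is just composition.
  record Boolean (k : ℕ) (V : VS) (g : Car V → ℚ) : Set where
    field
      homogeneous : ∀ s v → s ≢ 0# → g (s ·[ V ] v) ≡ g v
      bit         : ∀ (φ : Fⁿ k ⊸ V) → Inj φ → Bit (ksum k (λ c → g (φ $ c)))
  open Boolean public

  pullback : ∀ {k V W g} (ψ : V ⊸ W) → Inj ψ → Boolean k W g → Boolean k V (λ v → g (ψ $ v))
  pullback {g = g} ψ i b = record
    { homogeneous = λ s v ne → trans (cong g (·-hom ψ s v)) (homogeneous b s (ψ $ v) ne)
    ; bit         = λ φ j → bit b (ψ ∘L φ) (∘-inj ψ φ i j) }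

  plane-vanish : (D : Car (𝔽 ⊗ 𝔽) → ℚ) →
    (∀ p v → v ≢ 0[ 𝔽 ⊗ 𝔽 ] → ΣF (λ μ → D (p +[ 𝔽 ⊗ 𝔽 ] μ ·[ 𝔽 ⊗ 𝔽 ] v)) ≡ 0ℚ) →
    ∀ p → D p ≡ 0ℚ
  -- Sum over all lines through p except the vertical one; the points off the vertical line through p
  -- fill vertical lines.
  plane-vanish D lines p@(a , b) = q̂-cancel (D p) 0ℚ (begin
    q̂ * D p                                        ≡⟨ ΣF-const (D p) ⟨
    ΣF (λ _ → D p)                                 ≡⟨ sumL-cong elements (λ l _ → cong D (at-zero l)) ⟨
    ΣF (λ l → point 0# l)                          ≡⟨ sumL-single (λ μ → ΣF (point μ)) (complete 0#) unique vertical ⟨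
    ΣF (λ μ → ΣF (λ l → point μ l))                ≡⟨ sumL-swap point elements elements ⟩
    ΣF (λ l → ΣF (λ μ → point μ l))                ≡⟨ sumL-cong elements (λ l _ → lines p (1# , l) (λ e → 0≢1 (sym (cong proj₁ e)))) ⟩
    ΣF (λ _ → 0ℚ)                                  ≡⟨ sumL-0 elements ⟩
    0ℚ                                             ≡⟨ ℚP.*-zeroʳ q̂ ⟨
    q̂ * 0ℚ                                         ∎)
    where
    open ≡-Reasoning
    point : Carrier → Carrier → ℚ
    point μ l = D (p +[ 𝔽 ⊗ 𝔽 ] μ ·[ 𝔽 ⊗ 𝔽 ] (1# , l))
    at-zero : ∀ l → p +[ 𝔽 ⊗ 𝔽 ] 0# ·[ 𝔽 ⊗ 𝔽 ] (1# , l) ≡ p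
    at-zero l = trans (cong (VS.add (𝔽 ⊗ 𝔽) p) (VS.smul-0 (𝔽 ⊗ 𝔽) (1# , l))) (VSProps.add-idʳ (𝔽 ⊗ 𝔽) p)
    vertical : ∀ μ → μ ≢ 0# → ΣF (point μ) ≡ 0ℚ
    vertical μ μ≢0 = trans
      (sumL-cong elements λ l _ → cong D (cong₂ _,_
        (sym (trans (cong (a +F μ *F 1# +F_) (R.zeroʳ l)) (R.+-identityʳ _)))
        (cong (b +F_) (R.*-comm μ l))))
      (lines (a +F μ *F 1# , b) (0# , μ) (μ≢0 ∘ cong proj₂))

  Planes : ℕ → VS
  Planes = Pow (𝔽 ⊗ 𝔽)

  NonZeros : ∀ n → Car (Planes n) → Set
  NonZeros zero    tt       = ⊤
  NonZeros (suc n) (v , vs) = v ≢ 0[ 𝔽 ⊗ 𝔽 ] × NonZeros n vs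

  spread : ∀ n → Car (Planes n) → Fⁿ n ⊸ Planes n
  spread zero    tt       = idL
  spread (suc n) (v , vs) = ray (𝔽 ⊗ 𝔽) v ⊗L spread n vs

  ray-inj : ∀ V v → v ≢ 0[ V ] → Inj (ray V v)
  ray-inj V v ne s e with s ≟F 0#
  ... | yes s≡0 = s≡0
  ... | no s≢0  = ⊥-elim (ne (VSProps.cancel-smul V s v s≢0 e))

  spread-inj : ∀ n v → NonZeros n v → Inj (spread n v)
  spread-inj zero    tt       _          v e = refl
  spread-inj (suc n) (v , vs) (ne , nes) = ⊗-inj (ray (𝔽 ⊗ 𝔽) v) (spread n vs) (ray-inj (𝔽 ⊗ 𝔽) v ne) (spread-inj n vs nes)

  -- Induction on the number of planes: for a fixed product of lines in the other planes, the sum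
  -- over it is a function on the first plane all of whose line sums vanish, so `plane-vanish`
  -- applies.
  planes-vanish : ∀ n (D : Car (Planes n) → ℚ) →
    (∀ p v → NonZeros n v → Sum n (λ μ → D (p +[ Planes n ] (spread n v $ μ))) ≡ 0ℚ) → ∀ p → D p ≡ 0ℚ
  planes-vanish zero    D flats tt = flats tt tt tt
  planes-vanish (suc n) D flats (p , ps) = planes-vanish n (λ r → D (p , r))
    (λ r vs nes → plane-vanish (λ p → Sum n (λ μ → D (p , r +[ Planes n ] (spread n vs $ μ))))
       (λ p v ne → flats (p , r) (v , vs) (ne , nes)) p) ps

  bit-unique : ∀ {x y} → Bit x → Bit y → (x ≡ 0ℚ → y ≡ 0ℚ) → (y ≡ 0ℚ → x ≡ 0ℚ) → x ≡ y
  bit-unique (inj₁ refl) y      f g = sym (f refl)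
  bit-unique (inj₂ refl) (inj₁ refl) f g = g refl
  bit-unique (inj₂ refl) (inj₂ refl) f g = refl

  -- Two colours are enough for totals of k-spaces, because bits that vanish together are equal.
  isZero : ℚ → Fin 2
  isZero x with x ℚP.≟ 0ℚ
  ... | yes _ = zero
  ... | no _  = suc zero

  isZero-≡ : ∀ {x y} → isZero x ≡ isZero y → x ≡ 0ℚ → y ≡ 0ℚ
  isZero-≡ {x} {y} e x≡0 with x ℚP.≟ 0ℚ | y ℚP.≟ 0ℚ
  ... | yes _ | yes y≡0 = y≡0
  ... | no ne | _       = ⊥-elim (ne x≡0)
  isZero-≡ () x≡0 | yes _ | no _

  module Uniformization (k₁ : ℕ) {T : VS} {e : ℕ} (enum-T : Enum (Car T) e) (m : ℕ) where
    k : ℕ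
    k = suc k₁

    N : ℕ
    N = hjN (q ℕ.^ m) (2 ℕ.^ (e ℕ.* ((q ℕ.* q) ℕ.^ k₁ ℕ.* (q ℕ.* q) ℕ.^ k₁)))

    X : VS
    X = Pow (Fⁿ m) N

    Z : VS
    Z = Planes k₁ ⊗ 𝔽 ⊗ X

    opaque
      unfolding dim

      embeds-Z : Embeds Z (dim q k₁ e m)
      embeds-Z = embeds-⊗ (embeds-Pow k₁ (embeds-⊗ embeds-𝔽 embeds-𝔽))
                          (embeds-⊗ embeds-𝔽 (embeds-Pow N (embeds-Fⁿ m)))

    enum-Planes : Enum (Car (Planes k₁)) ((q ℕ.* q) ℕ.^ k₁)
    enum-Planes = enum-Pow (enum-× enum-F enum-F) k₁

    enum-I : Enum (Car T × Car (Planes k₁) × Car (Planes k₁)) (e ℕ.* ((q ℕ.* q) ℕ.^ k₁ ℕ.* (q ℕ.* q) ℕ.^ k₁))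
    enum-I = enum-× enum-T (enum-× enum-Planes enum-Planes)

    frame : Car T → Car (Planes k₁) → Car (Planes k₁) → Car X → Fⁿ k ⊸ T ⊗ Z
    frame t b v x = ray T t ∘L fstL & (ray (Planes k₁) b ∘L fstL ⊹ spread k₁ v ∘L sndL) & fstL & ray X x ∘L fstL

    frame-inj : ∀ t b v x → NonZeros k₁ v → Inj (frame t b v x)
    frame-inj t b v x nz (s , μ) eq with cong (proj₁ ∘ proj₂ ∘ proj₂) eq
    ... | refl = cong (0# ,_) (spread-inj k₁ v nz μ
      (trans (sym (trans (cong (λ z → z +[ Planes k₁ ] (spread k₁ v $ μ)) (VS.smul-0 (Planes k₁) b))
                         (VS.add-idˡ (Planes k₁) (spread k₁ v $ μ))))
             (cong (proj₁ ∘ proj₂) eq)))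

    -- The flat has to serve all t at once. The levels of a flag take T = `𝟙`; the cosets take T =
    -- `A`, which keeps the coset and the position in it free.
    Uniform : (Car (T ⊗ Z) → ℚ) → Set
    Uniform g = Σ (Fⁿ m ⊗ 𝔽 ⊸ Z) λ ζ → Inj ζ × (∀ t c → g (t , ζ $ (c , 1#)) ≡ g (t , ζ $ (0[ Fⁿ m ] , 1#)))

    -- Colour x by the vanishing of g on the k-spaces spanned by (t , b , 1 , x) and k₁ lines, one in each plane:
    -- by planes-vanish, points x of equal colour have equal weights.
    uniformize-by : (g : Car (T ⊗ Z) → ℚ) → Boolean k (T ⊗ Z) g → Uniform g
    uniformize-by g bool = ζ , ζ-inj , result
      where
      total : Car X → Car T × Car (Planes k₁) × Car (Planes k₁) → ℚ
      total x (t , b , v) = ksum k (λ c → g (frame t b v x $ c))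

      colour : Car X → Fin (2 ℕ.^ (e ℕ.* ((q ℕ.* q) ℕ.^ k₁ ℕ.* (q ℕ.* q) ℕ.^ k₁)))
      colour x = code 2 enum-I (isZero ∘ total x)

      ram = affine-ramsey (enum-Pow enum-F m) _ colour

      u₀ : Car X
      u₀ = proj₁ ram
      ψ : Fⁿ m ⊸ X
      ψ = proj₁ (proj₂ ram)
      ψ-inj : Inj ψ
      ψ-inj = proj₁ (proj₂ (proj₂ ram))

      -- The linear hull of the monochromatic flat: the height s multiplies `u₀`, so the flat
      -- reappears at height 1.
      ζ : Fⁿ m ⊗ 𝔽 ⊸ Z
      ζ = zeroL & sndL & (ray X u₀ ∘L sndL ⊹ ψ ∘L fstL)

      ζ-inj : Inj ζ
      ζ-inj (c , s) eq with cong (proj₁ ∘ proj₂) eq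
      ... | refl = cong (_, 0#) (ψ-inj c (trans (sym (trans (cong (λ z → z +[ X ] (ψ $ c)) (VS.smul-0 X u₀))
                                                             (VS.add-idˡ X (ψ $ c))))
                                                (cong (proj₂ ∘ proj₂) eq)))

      module _ (t : Car T) (x x′ : Car X) (same : colour x ≡ colour x′) where
        G : Car X → Car (Planes k₁) → ℚ
        G y b = g (t , b , 1# , y)

        -- The points of the frame at height 0 contribute equally for `x` and `x′` and cancel in the
        -- comparison.
        at-infinity : Car (Planes k₁) → Car X → ℚ
        at-infinity v y = ksum k₁ (λ μ → g (0[ T ] , spread k₁ v $ μ , 0# , 0[ X ]))

        total-≡ : ∀ b v y → total y (t , b , v) ≡
                  Sum k₁ (λ μ → G y (b +[ Planes k₁ ] (spread k₁ v $ μ))) + at-infinity v y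
        total-≡ b v y = cong₂ _+_
          (Sum-cong k₁ λ μ → cong g (cong₂ _,_ (VS.smul-1 T t) (cong₂ _,_
            (cong (λ z → z +[ Planes k₁ ] (spread k₁ v $ μ)) (VS.smul-1 (Planes k₁) b))
            (cong (1# ,_) (VS.smul-1 X y)))))
          (ksum-cong k₁ λ μ _ → cong g (cong₂ _,_ (VS.smul-0 T t) (cong₂ _,_
            (trans (cong (λ z → z +[ Planes k₁ ] (spread k₁ v $ μ)) (VS.smul-0 (Planes k₁) b))
                   (VS.add-idˡ (Planes k₁) _))
            (cong (0# ,_) (VS.smul-0 X y)))))

        flats : ∀ b v → NonZeros k₁ v →
          Sum k₁ (λ μ → G x (b +[ Planes k₁ ] (spread k₁ v $ μ)) - G x′ (b +[ Planes k₁ ] (spread k₁ v $ μ))) ≡ 0ℚ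
        flats b v nz = trans (Sum-- k₁ _ _) (trans (lem A A′ (at-infinity v x)) (trans
            (cong₂ _-_ (sym (total-≡ b v x)) (sym (total-≡ b v x′)))
            (trans (cong (_- total x′ (t , b , v)) same-total) (ℚP.+-inverseʳ (total x′ (t , b , v))))))
          where
          A A′ : ℚ
          A  = Sum k₁ (λ μ → G x (b +[ Planes k₁ ] (spread k₁ v $ μ)))
          A′ = Sum k₁ (λ μ → G x′ (b +[ Planes k₁ ] (spread k₁ v $ μ)))
          lem : ∀ a b c → a - b ≡ (a + c) - (b + c)
          lem = solve-∀ ℚring
          bits : ∀ y → Bit (total y (t , b , v))
          bits y = bit bool (frame t b v y) (frame-inj t b v y nz)
          zeros : isZero (total x (t , b , v)) ≡ isZero (total x′ (t , b , v))
          zeros = code-injective enum-I (isZero ∘ total x) (isZero ∘ total x′) same (t , b , v)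
          same-total : total x (t , b , v) ≡ total x′ (t , b , v)
          same-total = bit-unique (bits x) (bits x′) (isZero-≡ zeros) (isZero-≡ (sym zeros))

        G-≡ : ∀ b → G x b ≡ G x′ b
        G-≡ b = trans (lem (G x b) (G x′ b)) (trans
          (cong (_+ G x′ b) (planes-vanish k₁ (λ b → G x b - G x′ b) flats b)) (ℚP.+-identityˡ (G x′ b)))
          where
          lem : ∀ a b → a ≡ (a - b) + b
          lem = solve-∀ ℚring

      result : ∀ t c → g (t , ζ $ (c , 1#)) ≡ g (t , ζ $ (0[ Fⁿ m ] , 1#))
      result t c = trans (cong g (ζ-at-1 c)) (trans
        (G-≡ t _ _ (proj₂ (proj₂ (proj₂ ram)) c 0[ Fⁿ m ]) 0[ Planes k₁ ]) (cong g (sym (ζ-at-1 _))))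
        where
        ζ-at-1 : ∀ c → (t , ζ $ (c , 1#)) ≡ (t , 0[ Planes k₁ ] , 1# , u₀ +[ X ] (ψ $ c))
        ζ-at-1 c = cong (λ z → t , 0[ Planes k₁ ] , 1# , z +[ X ] (ψ $ c)) (VS.smul-1 X u₀)

    abstract
      uniformize : (g : Car (T ⊗ Z) → ℚ) → Boolean k (T ⊗ Z) g → Uniform g
      uniformize = uniformize-by

-- A flag of levels and a large subspace of constant weight.

-- Each level costs one uniformization over the one-element space, whence e = 1; its flat must have
-- room for all later levels.
levelDim : (q k₁ M : ℕ) → ℕ
levelDim q k₁ zero    = 0
levelDim q k₁ (suc M) = dim q k₁ 1 (levelDim q k₁ M)

module ConstantSubspace (F : FiniteField) (k′ : ℕ) where
  open import Data.Rational using (_+_; _*_; _-_; -_; _≤_; _<_)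
  open AffineRamsey F public

  k₁ k : ℕ
  k₁ = suc k′
  k = suc k₁

  inv : ∀ x → x ≢ 0# → Carrier
  inv x ne = proj₁ (inverseF x ne)

  inv-* : ∀ x ne → inv x ne *F x ≡ 1#
  inv-* x ne = trans (R.*-comm (inv x ne) x) (proj₂ (inverseF x ne))

  inv≢0 : ∀ x ne → inv x ne ≢ 0#
  inv≢0 x ne e = 0≢1 (trans (sym (R.zeroˡ x)) (trans (cong (_*F x) (sym e)) (inv-* x ne)))

  -- The level of a vector is the position of its first nonzero coordinate, which homogeneity allows
  -- to be scaled to 1.
  Level : ∀ M → (Vecs M → ℚ) → Set
  Level zero    g = ⊤
  Level (suc M) g = (∀ c → g (1# , c) ≡ g (1# , 0[ Fⁿ M ])) × Level M (λ c → g (0# , c))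

  enum-𝟙 : Enum (Car 𝟙) 1
  enum-𝟙 = record { at = λ _ → tt ; idx = λ _ → zero ; at-idx = λ _ → refl }

  Levels : ∀ M n → (Vecs n → ℚ) → Set
  Levels M n g = Σ (Fⁿ M ⊸ Fⁿ n) λ ψ → Inj ψ × Level M (λ c → g (ψ $ c))

  build-levels : ∀ M n → levelDim q k₁ M ℕ.≤ n → (g : Vecs n → ℚ) → Boolean k (Fⁿ n) g → Levels M n g
  build-levels zero    n le g bool = zeroL , (λ _ _ → refl) , tt
  build-levels (suc M) n le g bool = ψ , ψ-inj , top , proj₂ (proj₂ ih)
    where
    m = levelDim q k₁ M
    module U = Uniformization k₁ {𝟙} enum-𝟙 m
    ε : U.Z ⊸ Fⁿ n
    ε = pad le ∘L emb U.embeds-Z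
    ε-inj : Inj ε
    ε-inj = ∘-inj (pad le) (emb U.embeds-Z) (pad-inj le) (emb-inj U.embeds-Z)
    ε′ : 𝟙 ⊗ U.Z ⊸ Fⁿ n
    ε′ = ε ∘L sndL
    ε′-inj : Inj ε′
    ε′-inj (tt , z) e = cong (tt ,_) (ε-inj z e)
    unif = U.uniformize (λ z → g (ε′ $ z)) (pullback ε′ ε′-inj bool)
    ζ : Fⁿ m ⊗ 𝔽 ⊸ U.Z
    ζ = proj₁ unif
    ζ-inj : Inj ζ
    ζ-inj = proj₁ (proj₂ unif)
    -- The later levels are built inside the direction space of the uniform flat; uniformity at
    -- height 1 survives the passage to a smaller direction space.
    lower : Fⁿ m ⊸ Fⁿ n
    lower = ε ∘L ζ ∘L (idL & zeroL)
    lower-inj : Inj lower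
    lower-inj v e = cong proj₁ (ζ-inj _ (ε-inj _ e))
    ih = build-levels M m ℕP.≤-refl (λ c → g (lower $ c)) (pullback lower lower-inj bool)
    ψ′ : Fⁿ M ⊸ Fⁿ m
    ψ′ = proj₁ ih
    ψ : Fⁿ (suc M) ⊸ Fⁿ n
    ψ = ε ∘L ζ ∘L (ψ′ ∘L sndL & fstL)
    ψ-inj : Inj ψ
    ψ-inj (s , c) e = cong₂ _,_ (cong proj₂ eq) (proj₁ (proj₂ ih) c (cong proj₁ eq))
      where
      eq : (ψ′ $ c , s) ≡ (0[ Fⁿ m ] , 0#)
      eq = ζ-inj _ (ε-inj _ e)
    top : ∀ c → g (ψ $ (1# , c)) ≡ g (ψ $ (1# , 0[ Fⁿ M ]))
    top c = trans (proj₂ (proj₂ unif) tt (ψ′ $ c)) (sym (proj₂ (proj₂ unif) tt (ψ′ $ 0[ Fⁿ M ])))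

  abstract
    levels : ∀ M n → levelDim q k₁ M ℕ.≤ n → (g : Vecs n → ℚ) → Boolean k (Fⁿ n) g → Levels M n g
    levels = build-levels

  Sum-const-cancel : ∀ n x y → Sum n (λ _ → x) ≡ Sum n (λ _ → y) → x ≡ y
  Sum-const-cancel zero    x y e = e
  Sum-const-cancel (suc n) x y e = Sum-const-cancel n x y
    (q̂-cancel (Sum n (λ _ → x)) (Sum n (λ _ → y))
      (trans (sym (ΣF-const (Sum n (λ _ → x)))) (trans e (ΣF-const (Sum n (λ _ → y))))))

  bits-close : ∀ {x y} → Bit x → Bit y → x - y ≡ 0ℚ ⊎ x - y ≡ 1ℚ ⊎ x - y ≡ - 1ℚ
  bits-close (inj₁ refl) (inj₁ refl) = inj₁ refl
  bits-close (inj₁ refl) (inj₂ refl) = inj₂ (inj₂ refl)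
  bits-close (inj₂ refl) (inj₁ refl) = inj₂ (inj₁ refl)
  bits-close (inj₂ refl) (inj₂ refl) = inj₁ refl

  1<q̂ : 1ℚ < q̂
  1<q̂ = ℚP.<-≤-trans (ℚP.+-mono-<-≤ 0<1 (≤-refl {1ℚ})) 2≤q̂

  diff≤1 : ∀ {x y} → Bit x → Bit y → x - y ≤ 1ℚ
  diff≤1 {x} {y} bx by = subst (x - y ≤_) (ℚP.+-identityʳ 1ℚ) (ℚP.+-mono-≤ (bit≤1 bx) (ℚP.neg-antimono-≤ (0≤bit by)))

  -- A nonzero difference of bits is 1 or -1, and q times it is too large in absolute value to be a
  -- difference of bits.
  scaled-close : ∀ {x y x′ y′} → Bit x → Bit y → Bit x′ → Bit y′ → q̂ * (x - y) ≡ x′ - y′ → x - y ≡ 0ℚ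
  scaled-close {x} {y} {x′} {y′} bx by bx′ by′ e with bits-close bx by
  ... | inj₁ e₀ = e₀
  ... | inj₂ (inj₁ e₁) = ⊥-elim (<≤-absurd 1<q̂ (subst (_≤ 1ℚ) (trans (sym e) (trans (cong (q̂ *_) e₁) (ℚP.*-identityʳ q̂))) (diff≤1 bx′ by′)))
  ... | inj₂ (inj₂ e₁) = ⊥-elim (<≤-absurd 1<q̂ (subst (_≤ 1ℚ) (trans (lem x′ y′) (trans (cong (-_) (sym e)) (trans (cong (λ z → - (q̂ * z)) e₁) (lem′ q̂)))) (diff≤1 by′ bx′)))
    where
    lem : ∀ a b → b - a ≡ - (a - b)
    lem = solve-∀ ℚring
    lem′ : ∀ a → - (a * (- 1ℚ)) ≡ a
    lem′ = solve-∀ ℚring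

  -- Exchanging levels 1 and 2 in a coordinate k-space changes its weight by q^(k-1) (c₁ − c₂) when level 3 is
  -- the next one used, and by q^(k-2) (c₁ − c₂) when level 0 is the previous one.
  adjacent-levels : ∀ b → k₁ ℕ.≤ b → (g : Vecs (3 ℕ.+ b) → ℚ) → Boolean k (Fⁿ (3 ℕ.+ b)) g →
    Level (3 ℕ.+ b) g →
    g (0# , 1# , 0# , 0[ Fⁿ b ]) ≡ g (0# , 0# , 1# , 0[ Fⁿ b ])
  adjacent-levels (suc b) (s≤s le) g bool (l₀ , l₁ , l₂ , l₃ , _) =
    Sum-const-cancel k′ c₁ c₂ (x-y≡0⇒x≡y S₁ S₂ (trans diff₂ (scaled-close (bits frame₀₁ inj₀₁) (bits frame₀₂ inj₀₂) (bits frame₁₃ inj₁₃) (bits frame₂₃ inj₂₃)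
      (trans (cong (q̂ *_) (sym diff₂)) diff₁))))
    where
    n = 4 ℕ.+ b
    P : Fⁿ k ⊸ Fⁿ b
    P = pad le ∘L sndL ∘L sndL
    x₁ x₂ : Fⁿ k ⊸ 𝔽
    x₁ = fstL
    x₂ = fstL ∘L sndL
    frame₁₃ frame₂₃ frame₀₁ frame₀₂ : Fⁿ k ⊸ Fⁿ n
    frame₁₃ = zeroL & x₁ & zeroL & x₂ & P
    frame₂₃ = zeroL & zeroL & x₁ & x₂ & P
    frame₀₁ = x₁ & x₂ & zeroL & zeroL & P
    frame₀₂ = x₁ & zeroL & x₂ & zeroL & P
    combine′ : ∀ {x y : Carrier} {r : Vecs k′} → x ≡ 0# → y ≡ 0# → pad le $ r ≡ 0[ Fⁿ b ] → (x , y , r) ≡ 0[ Fⁿ k ]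
    combine′ refl refl e = cong (λ z → 0# , 0# , z) (pad-inj le _ e)
    inj₁₃ : Inj frame₁₃
    inj₁₃ (x , y , r) e = combine′ (cong (proj₁ ∘ proj₂) e) (cong (proj₁ ∘ proj₂ ∘ proj₂ ∘ proj₂) e) (cong (proj₂ ∘ proj₂ ∘ proj₂ ∘ proj₂) e)
    inj₂₃ : Inj frame₂₃
    inj₂₃ (x , y , r) e = combine′ (cong (proj₁ ∘ proj₂ ∘ proj₂) e) (cong (proj₁ ∘ proj₂ ∘ proj₂ ∘ proj₂) e) (cong (proj₂ ∘ proj₂ ∘ proj₂ ∘ proj₂) e)
    inj₀₁ : Inj frame₀₁
    inj₀₁ (x , y , r) e = combine′ (cong proj₁ e) (cong (proj₁ ∘ proj₂) e) (cong (proj₂ ∘ proj₂ ∘ proj₂ ∘ proj₂) e)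
    inj₀₂ : Inj frame₀₂
    inj₀₂ (x , y , r) e = combine′ (cong proj₁ e) (cong (proj₁ ∘ proj₂ ∘ proj₂) e) (cong (proj₂ ∘ proj₂ ∘ proj₂ ∘ proj₂) e)
    c₀ c₁ c₂ c₃ S₀ S₁ S₂ S₃ tail : ℚ
    c₀ = g (1# , 0[ Fⁿ (3 ℕ.+ b) ])
    c₁ = g (0# , 1# , 0[ Fⁿ (2 ℕ.+ b) ])
    c₂ = g (0# , 0# , 1# , 0[ Fⁿ (1 ℕ.+ b) ])
    c₃ = g (0# , 0# , 0# , 1# , 0[ Fⁿ b ])
    S₀ = Sum k₁ (λ _ → c₀)
    S₁ = Sum k′ (λ _ → c₁)
    S₂ = Sum k′ (λ _ → c₂)
    S₃ = Sum k′ (λ _ → c₃)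
    tail = ksum k′ (λ r → g (0# , 0# , 0# , 0# , pad le $ r))
    total : Fⁿ k ⊸ Fⁿ n → ℚ
    total φ = ksum k (λ c → g (φ $ c))
    bits : ∀ φ → Inj φ → Bit (total φ)
    bits = bit bool
    t₁₃ : total frame₁₃ ≡ q̂ * S₁ + (S₃ + tail)
    t₁₃ = cong₂ _+_ (trans (Sum-cong k₁ λ _ → l₁ _) (ΣF-const S₁)) (cong (_+ tail) (Sum-cong k′ λ _ → l₃ _))
    t₂₃ : total frame₂₃ ≡ q̂ * S₂ + (S₃ + tail)
    t₂₃ = cong₂ _+_ (trans (Sum-cong k₁ λ _ → l₂ _) (ΣF-const S₂)) (cong (_+ tail) (Sum-cong k′ λ _ → l₃ _))
    t₀₁ : total frame₀₁ ≡ S₀ + (S₁ + tail)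
    t₀₁ = cong₂ _+_ (Sum-cong k₁ λ _ → l₀ _) (cong (_+ tail) (Sum-cong k′ λ _ → l₁ _))
    t₀₂ : total frame₀₂ ≡ S₀ + (S₂ + tail)
    t₀₂ = cong₂ _+_ (Sum-cong k₁ λ _ → l₀ _) (cong (_+ tail) (Sum-cong k′ λ _ → l₂ _))
    diff₁ : q̂ * (S₁ - S₂) ≡ total frame₁₃ - total frame₂₃
    diff₁ = trans (lem q̂ S₁ S₂ (S₃ + tail)) (sym (cong₂ _-_ t₁₃ t₂₃))
      where
      lem : ∀ a b c d → a * (b - c) ≡ (a * b + d) - (a * c + d)
      lem = solve-∀ ℚring
    diff₂ : S₁ - S₂ ≡ total frame₀₁ - total frame₀₂
    diff₂ = trans (lem S₀ S₁ S₂ tail) (sym (cong₂ _-_ t₀₁ t₀₂))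
      where
      lem : ∀ a b c d → b - c ≡ (a + (b + d)) - (a + (c + d))
      lem = solve-∀ ℚring

  -- Level 0 and the last `b` levels are given up: comparing two adjacent levels takes one level
  -- before them and `k₁` levels after them.
  middle : ∀ m b → Fⁿ m ⊸ Fⁿ (suc (m ℕ.+ b))
  middle m b = zeroL & append m b ∘L (idL & zeroL)

  middle-inj : ∀ m b → Inj (middle m b)
  middle-inj m b v e = cong proj₁ (append-inj m b (v , 0[ Fⁿ b ]) (cong proj₂ e))

  scale-to-1 : ∀ {V g} → Boolean k (𝔽 ⊗ 𝔽 ⊗ V) g → ∀ x (ne : x ≢ 0#) w →
               g (0# , x , w) ≡ g (0# , 1# , inv x ne ·[ V ] w)
  scale-to-1 {V} {g} bool x ne w = trans (sym (homogeneous bool (inv x ne) (0# , x , w) (inv≢0 x ne)))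
    (cong g (cong₂ _,_ (R.zeroʳ (inv x ne)) (cong (_, inv x ne ·[ V ] w) (inv-* x ne))))

  MiddleConstant : ∀ m b → (Vecs (suc (m ℕ.+ b)) → ℚ) → Set
  MiddleConstant m b g = Σ ℚ λ c → ∀ v → v ≢ 0[ Fⁿ m ] → g (middle m b $ v) ≡ c

  -- A vector that is nonzero in the first middle coordinate scales to level 1. `adjacent-levels`
  -- carries its weight to level 2, which is already a middle level of the tail.
  middle-constant-step : ∀ m b → k₁ ℕ.≤ b → (g : Vecs (suc (suc (suc m) ℕ.+ b)) → ℚ) →
    Boolean k (Fⁿ (suc (suc (suc m) ℕ.+ b))) g → Level (suc (suc (suc m) ℕ.+ b)) g →
    MiddleConstant (suc m) b (λ v → g (0# , v)) → MiddleConstant (suc (suc m)) b g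
  middle-constant-step m b le g bool lev@(l₀ , l₁ , l₂ , ls) (c , ih) = c , const
    where
    const : ∀ v → v ≢ 0[ Fⁿ (suc (suc m)) ] → g (middle (suc (suc m)) b $ v) ≡ c
    const (x , v) ne with x ≟F 0#
    ... | yes refl = ih v (λ e → ne (cong (0# ,_) e))
    ... | no x≢0 = begin
      g (middle (suc (suc m)) b $ (x , v))            ≡⟨ scale-to-1 bool x x≢0 _ ⟩
      g (0# , 1# , _)                                 ≡⟨ l₁ _ ⟩
      g (0# , 1# , 0# , 0[ Fⁿ (m ℕ.+ b) ])            ≡⟨ adjacent-levels (m ℕ.+ b) (ℕP.≤-trans le (ℕP.m≤n+m b m)) g bool lev ⟩
      g (0# , 0# , 1# , 0[ Fⁿ (m ℕ.+ b) ])            ≡⟨ l₂ _ ⟨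
      g (0# , middle (suc m) b $ (1# , 0[ Fⁿ m ]))    ≡⟨ ih (1# , 0[ Fⁿ m ]) (λ e → 0≢1 (sym (cong proj₁ e))) ⟩
      c                                               ∎
      where open ≡-Reasoning

  middle-constant : ∀ m b → k₁ ℕ.≤ b → (g : Vecs (suc (m ℕ.+ b)) → ℚ) →
    Boolean k (Fⁿ (suc (m ℕ.+ b))) g → Level (suc (m ℕ.+ b)) g → MiddleConstant m b g
  middle-constant zero b le g bool lev = 0ℚ , λ v ne → ⊥-elim (ne refl)
  middle-constant (suc zero) b le g bool (l₀ , l₁ , _) = g (0# , 1# , 0[ Fⁿ b ]) ,
    λ { (x , tt) ne → trans (scale-to-1 bool x (λ e → ne (cong (_, tt) e)) 0[ Fⁿ b ]) (l₁ _) }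
  middle-constant (suc (suc m)) b le g bool lev = middle-constant-step m b le g bool lev
    (middle-constant (suc m) b le (λ v → g (0# , v))
      (pullback {V = Fⁿ (suc (suc m ℕ.+ b))} (zeroL & idL) (λ v e → cong proj₂ e) bool) (proj₂ lev))

  constant-subspace : ∀ m n → levelDim q k₁ (suc (m ℕ.+ k₁)) ℕ.≤ n → (g : Vecs n → ℚ) → Boolean k (Fⁿ n) g →
    Σ (Fⁿ m ⊸ Fⁿ n) λ ψ → Inj ψ × Σ ℚ λ c → ∀ v → v ≢ 0[ Fⁿ m ] → g (ψ $ v) ≡ c
  constant-subspace m n le g bool = ψ ∘L middle m k₁ , ∘-inj ψ (middle m k₁) inj (middle-inj m k₁) ,
    middle-constant m k₁ ℕP.≤-refl (λ v → g (ψ $ v)) (pullback ψ inj bool) (proj₂ (proj₂ lev))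
    where
    lev = levels (suc (m ℕ.+ k₁)) n le g bool
    ψ : Fⁿ (suc (m ℕ.+ k₁)) ⊸ Fⁿ n
    ψ = proj₁ lev
    inj : Inj ψ
    inj = proj₁ (proj₂ lev)

  Complementary : ∀ n → (g g′ : Vecs n → ℚ) → Set
  Complementary n g g′ = ∀ (φ : Fⁿ k ⊸ Fⁿ n) → Inj φ → ksum k (λ c → g′ (φ $ c)) ≡ 1ℚ - ksum k (λ c → g (φ $ c))

  bit-complement : ∀ {x} → Bit x → Bit (1ℚ - x)
  bit-complement (inj₁ refl) = inj₂ refl
  bit-complement (inj₂ refl) = inj₁ refl

  ksum-const-nonneg : ∀ c → 0ℚ ≤ c → ksum k (λ _ → c) ≡ 0ℚ → c ≡ 0ℚ
  ksum-const-nonneg c 0≤c e = ℚP.≤-antisym (subst (c ≤_) e (≤-trans {c} {S} {S + K}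
      (Sum-≥ k₁ {λ _ → c} (λ _ → 0≤c) 0[ Fⁿ k₁ ])
      (≤-by {S} {S + K} {K} (ksum-nonneg k₁ {λ _ → c} (λ _ _ → 0≤c)) refl))) 0≤c
    where
    S K : ℚ
    S = Sum k₁ (λ _ → c)
    K = ksum k₁ (λ _ → c)

  ksum-const≡0 : ∀ c → ksum k (λ _ → c) ≡ 0ℚ → c ≡ 0ℚ
  ksum-const≡0 c e with ℚP.≤-total 0ℚ c
  ... | inj₁ 0≤c = ksum-const-nonneg c 0≤c e
  ... | inj₂ c≤0 = sym (x-y≡0⇒x≡y 0ℚ c (ksum-const-nonneg (0ℚ - c) (0≤b-a {c} {0ℚ} c≤0)
    (trans (ksum-- k (λ _ → 0ℚ) (λ _ → c)) (cong₂ _-_ (ksum-0 k) e))))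

  ZeroSubspace : ∀ m n → (Vecs n → ℚ) → Set
  ZeroSubspace m n g = Σ (Vecs n → ℚ) λ g′ → Boolean k (Fⁿ n) g′ × (g′ ≡ g ⊎ Complementary n g g′) ×
    Σ (Fⁿ m ⊸ Fⁿ n) λ ψ → Inj ψ × (∀ v → v ≢ 0[ Fⁿ m ] → g′ (ψ $ v) ≡ 0ℚ)

  -- A k-space inside the subspace has total c times its number of points. Total 0 forces c = 0.
  -- With total 1, the constant c is a weight for the family of all k-spaces, so `c - g` is a weight
  -- for the complement.
  constant-to-zero : ∀ m n → k ℕ.≤ m → (g : Vecs n → ℚ) → Boolean k (Fⁿ n) g →
    (ψ : Fⁿ m ⊸ Fⁿ n) → Inj ψ → ∀ c → (∀ v → v ≢ 0[ Fⁿ m ] → g (ψ $ v) ≡ c) → ZeroSubspace m n g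
  constant-to-zero m n k≤m g bool ψ inj c const = split (bit bool (ψ ∘L pad k≤m) inj′)
    where
    inj′ : Inj (ψ ∘L pad k≤m)
    inj′ = ∘-inj ψ (pad k≤m) inj (pad-inj k≤m)
    on-ψ : ksum k (λ v → g (ψ $ pad k≤m $ v)) ≡ ksum k (λ _ → c)
    on-ψ = ksum-cong k λ v ne → const (pad k≤m $ v) (inj-≢0 (pad k≤m) (pad-inj k≤m) ne)
    split : Bit (ksum k (λ v → g (ψ $ pad k≤m $ v))) → ZeroSubspace m n g
    split (inj₁ e) = g , bool , inj₁ refl , ψ , inj , λ v ne →
      trans (const v ne) (ksum-const≡0 c (trans (sym on-ψ) e))
    split (inj₂ e) = (λ v → c - g v) , bool′ , inj₂ comp , ψ , inj , λ v ne →
      trans (cong (λ z → c - z) (const v ne)) (ℚP.+-inverseʳ c)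
      where
      comp : Complementary n g (λ v → c - g v)
      comp φ i = trans (ksum-- k (λ _ → c) (λ v → g (φ $ v))) (cong (_- ksum k (λ v → g (φ $ v))) (trans (sym on-ψ) e))
      bool′ : Boolean k (Fⁿ n) (λ v → c - g v)
      bool′ = record
        { homogeneous = λ s v ne → cong (λ z → c - z) (homogeneous bool s v ne)
        ; bit = λ φ i → subst Bit (sym (comp φ i)) (bit-complement (bit bool φ i)) }

  zero-subspace : ∀ m n → k ℕ.≤ m → levelDim q k₁ (suc (m ℕ.+ k₁)) ℕ.≤ n → (g : Vecs n → ℚ) → Boolean k (Fⁿ n) g →
    ZeroSubspace m n g
  zero-subspace m n k≤m le g bool =
    let ψ , inj , c , const = constant-subspace m n le g bool
    in constant-to-zero m n k≤m g bool ψ inj c const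

-- Weights on one coset of the zero subspace: the tower and the flats.

-- Each step is a uniformization over 𝔽 ⊗ F^k, which has `q * q ^ k` elements.
iterDim : (q k′ : ℕ) → (j m : ℕ) → ℕ
iterDim q k′ zero    m = m
iterDim q k′ (suc j) m = iterDim q k′ j (dim q (suc k′) (q ℕ.* q ℕ.^ suc (suc k′)) m)

-- The first summand gives room for any (k - 1)-flat, the second for the words in which two colours
-- leave a monochromatic (k - 1)-flat.
flatDim : (q k′ : ℕ) → ℕ
flatDim q k′ = suc k′ ℕ.+ hjN (q ℕ.^ suc k′) 2 ℕ.* suc k′

cosetDim : (q k′ : ℕ) → ℕ
cosetDim q k′ = iterDim q k′ (suc k′) (flatDim q k′)

module Cosets (F : FiniteField) (k′ : ℕ) where
  open import Data.Rational using (_+_; _*_; _-_; -_; _≤_; _<_)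
  open ConstantSubspace F k′ public

  T : VS
  T = Fⁿ k

  -- The scalar is the coefficient of a coset representative v, so (1 , t) stands for v + t and (0 ,
  -- t) for a vector of the zero subspace.
  A : VS
  A = 𝔽 ⊗ T

  enum-A : Enum (Car A) (q ℕ.* q ℕ.^ k)
  enum-A = enum-× enum-F (enum-Pow enum-F k)

  ΣF-nonneg-zero : ∀ (b : Carrier → ℚ) → (∀ x → 0ℚ ≤ b x) → ΣF b ≡ 0ℚ → ∀ x → b x ≡ 0ℚ
  ΣF-nonneg-zero b le e x = ℚP.≤-antisym (subst (b x ≤_) e (Sum-≥ 1 {b ∘ proj₁} (le ∘ proj₁) (x , tt))) (le x)

  -- X is the mean of the q bits, and a mean equal to 0 or 1 leaves no room for variation.
  all-or-none : ∀ (b : Carrier → ℚ) X → (∀ x → Bit (b x)) → Bit X → ΣF b ≡ q̂ * X → ∀ x y → b x ≡ b y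
  all-or-none b X bits (inj₁ refl) e x y = trans (zeros x) (sym (zeros y))
    where
    zeros : ∀ x → b x ≡ 0ℚ
    zeros = ΣF-nonneg-zero b (0≤bit ∘ bits) (trans e (ℚP.*-zeroʳ q̂))
  all-or-none b X bits (inj₂ refl) e x y = trans (ones x) (sym (ones y))
    where
    zeros : ∀ x → 1ℚ - b x ≡ 0ℚ
    zeros = ΣF-nonneg-zero (λ x → 1ℚ - b x) (λ x → 0≤bit (bit-complement (bits x)))
      (trans (Sum-- 1 (λ _ → 1ℚ) (b ∘ proj₁)) (trans (cong (λ z → q̂ - z) (trans e (ℚP.*-identityʳ q̂))) (ℚP.+-inverseʳ q̂)))
    ones : ∀ x → b x ≡ 1ℚ
    ones x = sym (x-y≡0⇒x≡y 1ℚ (b x) (zeros x))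

  0·+ : ∀ V u w → 0# ·[ V ] u +[ V ] w ≡ w
  0·+ V u w = trans (cong (λ z → z +[ V ] w) (VS.smul-0 V u)) (VS.add-idˡ V w)

  1·+ : ∀ V u w → 1# ·[ V ] u +[ V ] w ≡ u +[ V ] w
  1·+ V u w = cong (λ z → z +[ V ] w) (VS.smul-1 V u)

  -- The points with coefficient 0 lie where g vanishes, so only an affine flat of dimension k - 1
  -- contributes.
  affine-sum : ∀ W (g : Car (A ⊗ W) → ℚ) → (∀ t z → g ((0# , t) , z) ≡ 0ℚ) →
    (φ : Fⁿ k ⊸ A ⊗ W) → (∀ μ → proj₁ (proj₁ (φ $ (0# , μ))) ≡ 0#) →
    ksum k (λ c → g (φ $ c)) ≡ Sum k₁ (λ μ → g (φ $ (1# , μ)))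
  affine-sum W g z0 φ aff = trans
    (cong (Sum k₁ (λ μ → g (φ $ (1# , μ))) +_) (ksum-zero k₁ {λ μ → g (φ $ (0# , μ))} λ μ _ →
      trans (cong (λ s → g ((s , proj₂ (proj₁ (φ $ (0# , μ)))) , proj₂ (φ $ (0# , μ)))) (aff μ)) (z0 _ _)))
    (ℚP.+-identityʳ (Sum k₁ (λ μ → g (φ $ (1# , μ)))))

  module LevelConstant (m : ℕ) (k₁≤m : k₁ ℕ.≤ m) (g : Car (A ⊗ Fⁿ m ⊗ 𝔽) → ℚ)
    (bool : Boolean k (A ⊗ Fⁿ m ⊗ 𝔽) g)
    (zero-at-0 : ∀ t z → g ((0# , t) , z) ≡ 0ℚ)
    (uniform : ∀ a c → g (a , c , 1#) ≡ g (a , 0[ Fⁿ m ] , 1#))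
    (l : Carrier) (l≢0 : l ≢ 0#) where

    -- Uniformity is available at height 1 only. Dividing by l reaches it, but replaces (1 , t) by a
    -- multiple, which is why `uniform` quantifies over all of `A`.
    to-1 : ∀ t c → g ((1# , t) , c , l) ≡ g (inv l l≢0 ·[ A ] (1# , t) , 0[ Fⁿ m ] , 1#)
    to-1 t c = trans (sym (homogeneous bool (inv l l≢0) ((1# , t) , c , l) (inv≢0 l l≢0)))
      (trans (cong (λ z → g (inv l l≢0 ·[ A ] (1# , t) , inv l l≢0 ·[ Fⁿ m ] c , z)) (inv-* l l≢0)) (uniform _ _))

    h : Car T → ℚ
    h t = g ((1# , t) , 0[ Fⁿ m ] , l)

    constant-in-c : ∀ t c → g ((1# , t) , c , l) ≡ h t
    constant-in-c t c = trans (to-1 t c) (sym (to-1 t 0[ Fⁿ m ]))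

    point-frame : Car T → Fⁿ k ⊸ A ⊗ Fⁿ m ⊗ 𝔽
    point-frame t = (fstL & ray T t ∘L fstL) & pad k₁≤m ∘L sndL & ray 𝔽 l ∘L fstL

    point-inj : ∀ t → Inj (point-frame t)
    point-inj t (s , μ) e = cong₂ _,_ (cong (proj₁ ∘ proj₁) e) (pad-inj k₁≤m μ (cong (proj₁ ∘ proj₂) e))

    point-bit : ∀ t → Bit (Sum k₁ (λ _ → h t))
    point-bit t = subst Bit eq (bit bool (point-frame t) (point-inj t))
      where
      eq : ksum k (λ c → g (point-frame t $ c)) ≡ Sum k₁ (λ _ → h t)
      eq = trans (affine-sum (Fⁿ m ⊗ 𝔽) g zero-at-0 (point-frame t) (λ _ → refl)) (Sum-cong k₁ λ μ → trans
             (cong₂ (λ y z → g ((1# , y) , pad k₁≤m $ μ , z)) (VS.smul-1 T t) (R.*-identityˡ l))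
             (constant-in-c t (pad k₁≤m $ μ)))

    k′≤m : k′ ℕ.≤ m
    k′≤m = ℕP.≤-trans (ℕP.n≤1+n k′) k₁≤m

    line-frame : Car T → Car T → Fⁿ k ⊸ A ⊗ Fⁿ m ⊗ 𝔽
    line-frame t t′ = (fstL & (ray T t ∘L fstL ⊹ ray T t′ ∘L fstL ∘L sndL)) & pad k′≤m ∘L sndL ∘L sndL & ray 𝔽 l ∘L fstL

    line-inj : ∀ t t′ → t′ ≢ 0[ T ] → Inj (line-frame t t′)
    line-inj t t′ ne (s , ν , μ) e with cong (proj₁ ∘ proj₁) e
    ... | refl = cong₂ (λ x y → 0# , x , y)
      (ray-inj T t′ ne ν (trans (sym (0·+ T t (ν ·[ T ] t′))) (cong (proj₂ ∘ proj₁) e)))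
      (pad-inj k′≤m μ (cong (proj₁ ∘ proj₂) e))

    line-bit : ∀ t t′ → t′ ≢ 0[ T ] → Bit (ΣF (λ ν → Sum k′ (λ _ → h (t +[ T ] ν ·[ T ] t′))))
    line-bit t t′ ne = subst Bit eq (bit bool (line-frame t t′) (line-inj t t′ ne))
      where
      S : ℚ
      S = ΣF (λ ν → Sum k′ (λ _ → h (t +[ T ] ν ·[ T ] t′)))
      eq : ksum k (λ c → g (line-frame t t′ $ c)) ≡ S
      eq = trans (affine-sum (Fⁿ m ⊗ 𝔽) g zero-at-0 (line-frame t t′) (λ _ → refl))
             (sumL-cong elements λ ν _ → Sum-cong k′ λ μ → trans
             (cong₂ (λ y z → g ((1# , y) , pad k′≤m $ μ , z)) (1·+ T t (ν ·[ T ] t′)) (R.*-identityˡ l))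
             (constant-in-c (t +[ T ] ν ·[ T ] t′) (pad k′≤m $ μ)))

    -- On the line through 0 and t, the values q^(k-1) h are bits by `point-bit`, and their mean is
    -- the bit of `line-bit`; so `all-or-none` applies.
    constant-in-t : ∀ t → h t ≡ h 0[ T ]
    constant-in-t t with VS._≟V_ T t 0[ T ]
    ... | yes refl = refl
    ... | no ne = Sum-const-cancel k₁ (h t) (h 0[ T ]) (begin
      Sum k₁ (λ _ → h t)                  ≡⟨ cong (λ y → Sum k₁ (λ _ → h y)) at-1 ⟨
      Sum k₁ (λ _ → h (pt 1#))            ≡⟨ all-or-none (λ ν → Sum k₁ (λ _ → h (pt ν))) S (λ ν → point-bit (pt ν)) (line-bit 0[ T ] t ne) total 1# 0# ⟩
      Sum k₁ (λ _ → h (pt 0#))            ≡⟨ cong (λ y → Sum k₁ (λ _ → h y)) at-0 ⟩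
      Sum k₁ (λ _ → h 0[ T ])             ∎)
      where
      open ≡-Reasoning
      pt : Carrier → Car T
      pt ν = 0[ T ] +[ T ] ν ·[ T ] t
      S : ℚ
      S = ΣF (λ ν → Sum k′ (λ _ → h (pt ν)))
      at-1 : pt 1# ≡ t
      at-1 = trans (VS.add-idˡ T (1# ·[ T ] t)) (VS.smul-1 T t)
      at-0 : pt 0# ≡ 0[ T ]
      at-0 = trans (VS.add-idˡ T (0# ·[ T ] t)) (VS.smul-0 T t)
      total : ΣF (λ ν → Sum k₁ (λ _ → h (pt ν))) ≡ q̂ * S
      total = trans (sumL-cong elements λ ν _ → ΣF-const (Sum k′ (λ _ → h (pt ν))))
                    (sumL-* q̂ (λ ν → Sum k′ (λ _ → h (pt ν))) elements)

    level-constant : ∀ t c → g ((1# , t) , c , l) ≡ g ((1# , 0[ T ]) , 0[ Fⁿ m ] , l)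
    level-constant t c = trans (constant-in-c t c) (constant-in-t t)

  iter : ℕ → ℕ → ℕ
  iter = iterDim q k′

  -- Directions x along which every flat sum is, up to one constant, the value at its base point x = 0.
  Tower : ∀ j m → (Car (A ⊗ Fⁿ (iter j m)) → ℚ) → Set
  Tower j m g = Σ (Fⁿ m ⊗ Fⁿ j ⊸ Fⁿ (iter j m)) λ ζ → Inj ζ ×
    (∀ t c x → x ≢ 0[ Fⁿ j ] → g ((1# , t) , ζ $ (c , x)) ≡ g ((1# , 0[ T ]) , ζ $ (0[ Fⁿ m ] , x)))

  stepDim : ℕ → ℕ
  stepDim m = dim q k₁ (q ℕ.* q ℕ.^ k) m

  module TowerStep (j m : ℕ) (k₁≤m : k₁ ℕ.≤ m) (g : Car (A ⊗ Fⁿ (iter j (stepDim m))) → ℚ)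
    (bool : Boolean k (A ⊗ Fⁿ (iter j (stepDim m))) g) (z0 : ∀ t z → g ((0# , t) , z) ≡ 0ℚ)
    (ζ₁ : Fⁿ (stepDim m) ⊗ Fⁿ j ⊸ Fⁿ (iter j (stepDim m))) (ζ₁-inj : Inj ζ₁)
    (uniform₁ : ∀ t c x → x ≢ 0[ Fⁿ j ] →
      g ((1# , t) , ζ₁ $ (c , x)) ≡ g ((1# , 0[ T ]) , ζ₁ $ (0[ Fⁿ (stepDim m) ] , x))) where

    module U = Uniformization k₁ {A} enum-A m

    N : ℕ
    N = iter j (stepDim m)

    low : U.Z ⊸ Fⁿ N
    low = ζ₁ ∘L (emb U.embeds-Z & zeroL)

    low-inj : Inj low
    low-inj z e = emb-inj U.embeds-Z z (cong proj₁ (ζ₁-inj _ e))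

    lowA : A ⊗ U.Z ⊸ A ⊗ Fⁿ N
    lowA = idL ⊗L low

    g₁ : Car (A ⊗ U.Z) → ℚ
    g₁ z = g (lowA $ z)

    bool₁ : Boolean k (A ⊗ U.Z) g₁
    bool₁ = pullback lowA (⊗-inj {A} {A} {U.Z} {Fⁿ N} idL low (λ _ e → e) low-inj) bool

    unif : U.Uniform g₁
    unif = U.uniformize g₁ bool₁

    ζ₂ : Fⁿ m ⊗ 𝔽 ⊸ U.Z
    ζ₂ = proj₁ unif

    lowA₂ : A ⊗ Fⁿ m ⊗ 𝔽 ⊸ A ⊗ U.Z
    lowA₂ = idL ⊗L ζ₂

    g₂ : Car (A ⊗ Fⁿ m ⊗ 𝔽) → ℚ
    g₂ z = g₁ (lowA₂ $ z)

    bool₂ : Boolean k (A ⊗ Fⁿ m ⊗ 𝔽) g₂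
    bool₂ = pullback lowA₂ (⊗-inj {A} {A} {Fⁿ m ⊗ 𝔽} {U.Z} idL ζ₂ (λ _ e → e) (proj₁ (proj₂ unif))) bool₁

    ζ : Fⁿ m ⊗ Fⁿ (suc j) ⊸ Fⁿ N
    ζ = ζ₁ ∘L (emb U.embeds-Z ∘L ζ₂ ∘L (fstL & fstL ∘L sndL) & sndL ∘L sndL)

    ζ-inj : Inj ζ
    ζ-inj (c , l , x) e = cong₂ (λ p x → proj₁ p , proj₂ p , x)
      (proj₁ (proj₂ unif) (c , l) (emb-inj U.embeds-Z (ζ₂ $ (c , l)) (cong proj₁ e₁))) (cong proj₂ e₁)
      where
      e₁ : (emb U.embeds-Z $ ζ₂ $ (c , l) , x) ≡ 0[ Fⁿ (stepDim m) ⊗ Fⁿ j ]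
      e₁ = ζ₁-inj (emb U.embeds-Z $ ζ₂ $ (c , l) , x) e

    level : ∀ l → l ≢ 0# → ∀ t c → g₂ ((1# , t) , c , l) ≡ g₂ ((1# , 0[ T ]) , 0[ Fⁿ m ] , l)
    level = LevelConstant.level-constant m k₁≤m g₂ bool₂ (λ t z → z0 t (low $ ζ₂ $ z)) (proj₂ (proj₂ unif))

    -- If x ≠ 0 the previous tower decides, since the new coordinates only move its argument c. If x
    -- = 0 then l ≠ 0, and this is the newly uniformized part.
    uniform-dec : ∀ t c l x → (l , x) ≢ 0[ Fⁿ (suc j) ] → Dec (x ≡ 0[ Fⁿ j ]) →
                  g ((1# , t) , ζ $ (c , l , x)) ≡ g ((1# , 0[ T ]) , ζ $ (0[ Fⁿ m ] , l , x))
    uniform-dec t c l x ne (no x≢0) = trans (uniform₁ t (emb U.embeds-Z $ ζ₂ $ (c , l)) x x≢0)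
                         (sym (uniform₁ 0[ T ] (emb U.embeds-Z $ ζ₂ $ (0[ Fⁿ m ] , l)) x x≢0))
    uniform-dec t c l x ne (yes refl) = level l (λ e → ne (cong (_, 0[ Fⁿ j ]) e)) t c

    uniform : ∀ t c x → x ≢ 0[ Fⁿ (suc j) ] →
              g ((1# , t) , ζ $ (c , x)) ≡ g ((1# , 0[ T ]) , ζ $ (0[ Fⁿ m ] , x))
    uniform t c (l , x) ne = uniform-dec t c l x ne (VS._≟V_ (Fⁿ j) x 0[ Fⁿ j ])

  build-tower : ∀ j m → k₁ ℕ.≤ m → (g : Car (A ⊗ Fⁿ (iter j m)) → ℚ) → Boolean k (A ⊗ Fⁿ (iter j m)) g →
    (∀ t z → g ((0# , t) , z) ≡ 0ℚ) → Tower j m g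
  build-tower zero    m k₁≤m g bool z0 = fstL , (λ _ e → cong (_, tt) e) , λ t c x ne → ⊥-elim (ne refl)
  build-tower (suc j) m k₁≤m g bool z0 =
    let ζ₁ , ζ₁-inj , uniform₁ = build-tower j (stepDim m) (k₁≤dim q k₁ (q ℕ.* q ℕ.^ k) m) g bool z0
        open TowerStep j m k₁≤m g bool z0 ζ₁ ζ₁-inj uniform₁
    in ζ , ζ-inj , uniform

  abstract
    tower : ∀ j m → k₁ ℕ.≤ m → (g : Car (A ⊗ Fⁿ (iter j m)) → ℚ) → Boolean k (A ⊗ Fⁿ (iter j m)) g →
      (∀ t z → g ((0# , t) , z) ≡ 0ℚ) → Tower j m g
    tower = build-tower

  α₁ : ℚ
  α₁ = α k₁

  Sum-α₁ : Sum k₁ (λ _ → α₁) ≡ 1ℚ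
  Sum-α₁ = subst (λ n → Sum k₁ (λ _ → α n) ≡ 1ℚ) (ℕP.+-identityʳ k₁) (Sum-const-α k₁ 0)

  OneAtMost : (Car T → ℚ) → Set
  OneAtMost f = (∀ t → Bit (f t)) × (∀ t t′ → t ≢ t′ → f t ≡ 1ℚ → f t′ ≡ 1ℚ → ⊥)

  TrivialCoset : (Car T → ℚ) → Set
  TrivialCoset h = OneAtMost h ⊎ OneAtMost (λ t → α₁ - h t)

  module Flats (m : ℕ) (k₁≤m : k₁ ℕ.≤ m) where
    Y : VS
    Y = T ⊗ Fⁿ m

    flatSum : (Car Y → ℚ) → Car Y → Fⁿ k₁ ⊸ Y → ℚ
    flatSum f p φ = Sum k₁ (λ μ → f (p +[ Y ] (φ $ μ)))

    vertical : Fⁿ k₁ ⊸ Y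
    vertical = zeroL & pad k₁≤m

    vertical-inj : Inj vertical
    vertical-inj μ e = pad-inj k₁≤m μ (cong proj₂ e)

    k′≤m : k′ ℕ.≤ m
    k′≤m = ℕP.≤-trans (ℕP.n≤1+n k′) k₁≤m

    join : Car T → Fⁿ k₁ ⊸ Y
    join t = ray T t ∘L fstL & pad k′≤m ∘L sndL

    join-inj : ∀ t → t ≢ 0[ T ] → Inj (join t)
    join-inj t ne (ν , μ) e = cong₂ _,_ (ray-inj T t ne ν (cong proj₁ e)) (pad-inj k′≤m μ (cong proj₂ e))

    module _ (f : Car Y → ℚ) (bits : ∀ y → Bit (f y)) where

      -- A flat through the point has nonnegative values, so a sum of at most 0 kills each of them.
      vanish : (∀ p φ → Inj φ → flatSum f p φ ≤ 0ℚ) → ∀ t → f (t , 0[ Fⁿ m ]) ≡ 0ℚ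
      vanish small t = ℚP.≤-antisym
        (≤-trans (subst (λ y → f y ≤ flatSum f p vertical) at-0
                   (Sum-≥ k₁ {λ μ → f (p +[ Y ] (vertical $ μ))} (λ μ → 0≤bit (bits _)) 0[ Fⁿ k₁ ]))
                 (small p vertical vertical-inj))
        (0≤bit (bits p))
        where
        p : Car Y
        p = t , 0[ Fⁿ m ]
        at-0 : p +[ Y ] (vertical $ 0[ Fⁿ k₁ ]) ≡ p
        at-0 = trans (cong (VS.add Y p) (0-hom vertical)) (VSProps.add-idʳ Y p)

      -- Two points over 0 lie on a common (k - 1)-flat: their difference and k - 2 directions of
      -- `Fⁿ m` span it. Two values 1 would make its sum at least 2.
      one-at-most : (∀ p φ → Inj φ → flatSum f p φ ≤ 1ℚ) → OneAtMost (λ t → f (t , 0[ Fⁿ m ]))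
      one-at-most small = (λ t → bits (t , 0[ Fⁿ m ])) , two
        where
        two : ∀ t t′ → t ≢ t′ → f (t , 0[ Fⁿ m ]) ≡ 1ℚ → f (t′ , 0[ Fⁿ m ]) ≡ 1ℚ → ⊥
        two t t′ ne e e′ = <≤-absurd 1<2 (≤-trans (subst₂ (λ x y → x + y ≤ flatSum f p φ)
            (trans (cong f at-0) e) (trans (cong f at-1) e′)
            (Sum-≥₂ k₁ {λ μ → f (p +[ Y ] (φ $ μ))} (λ μ → 0≤bit (bits _)) 0[ Fⁿ k₁ ] (1# , 0[ Fⁿ k′ ])
              (λ e → 0≢1 (cong proj₁ e))))
            (small p φ (join-inj d d≢0)))
          where
          1<2 : 1ℚ < 1ℚ + 1ℚ
          1<2 = ℚP.+-mono-<-≤ 0<1 (≤-refl {1ℚ})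
          d : Car T
          d = t′ +[ T ] VSProps.neg T t
          d≢0 : d ≢ 0[ T ]
          d≢0 e = ne (sym (VSProps.sub-zero T t′ t e))
          φ : Fⁿ k₁ ⊸ Y
          φ = join d
          p : Car Y
          p = t , 0[ Fⁿ m ]
          at-0 : p +[ Y ] (φ $ 0[ Fⁿ k₁ ]) ≡ p
          at-0 = trans (cong (VS.add Y p) (0-hom φ)) (VSProps.add-idʳ Y p)
          at-1 : p +[ Y ] (φ $ (1# , 0[ Fⁿ k′ ])) ≡ (t′ , 0[ Fⁿ m ])
          at-1 = cong₂ _,_ (begin
            t +[ T ] 1# ·[ T ] d                     ≡⟨ cong (VS.add T t) (VS.smul-1 T d) ⟩
            t +[ T ] (t′ +[ T ] VSProps.neg T t)     ≡⟨ cong (VS.add T t) (VS.add-comm T t′ (VSProps.neg T t)) ⟩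
            t +[ T ] (VSProps.neg T t +[ T ] t′)     ≡⟨ VS.add-assoc T t (VSProps.neg T t) t′ ⟨
            (t +[ T ] VSProps.neg T t) +[ T ] t′     ≡⟨ cong (λ z → z +[ T ] t′) (VSProps.neg-inverse T t) ⟩
            0[ T ] +[ T ] t′                         ≡⟨ VS.add-idˡ T t′ ⟩
            t′                                       ∎)
            (trans (VS.add-idˡ (Fⁿ m) (pad k′≤m $ 0[ Fⁿ k′ ])) (0-hom (pad k′≤m)))
            where open ≡-Reasoning

    flatSum-- : ∀ f f′ p φ → flatSum (λ y → f y - f′ y) p φ ≡ flatSum f p φ - flatSum f′ p φ
    flatSum-- f f′ p φ = Sum-- k₁ (λ μ → f (p +[ Y ] (φ $ μ))) (λ μ → f′ (p +[ Y ] (φ $ μ)))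

    -- The monochromatic flat forces b + ξ ∈ {0 , α₁}. In each of the four cases ± (h − τ) is bit-valued with
    -- flat sums at most 0 or at most 1, where τ ∈ {0 , α₁}.
    trivial-coset : ∀ (h X : Car Y → ℚ) b → (∀ y → Bit (X y)) → (∀ y → h y ≡ b + X y) →
      (∀ p φ → Inj φ → Bit (flatSum h p φ)) →
      ∀ ξ → Bit ξ → Bit (Sum k₁ (λ _ → b + ξ)) → TrivialCoset (λ t → h (t , 0[ Fⁿ m ]))
    trivial-coset h X b bits h≡ flats ξ bξ mono = go bξ mono
      where
      0-flat : ∀ p φ → flatSum (λ _ → 0ℚ) p φ ≡ 0ℚ
      0-flat p φ = Sum-0 k₁
      b+ξ≡0 : Sum k₁ (λ _ → b + ξ) ≡ 0ℚ → b + ξ ≡ 0ℚ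
      b+ξ≡0 e = Sum-const-cancel k₁ (b + ξ) 0ℚ (trans e (sym (Sum-0 k₁)))
      b+ξ≡α : Sum k₁ (λ _ → b + ξ) ≡ 1ℚ → b + ξ ≡ α₁
      b+ξ≡α e = Sum-const-cancel k₁ (b + ξ) α₁ (trans e (sym Sum-α₁))
      solve-b : ∀ {c d} → b + c ≡ d → b ≡ d - c
      solve-b {c} refl = lem b c
        where
        lem : ∀ b c → b ≡ (b + c) - c
        lem = solve-∀ ℚring
      trivial-zero : (f : Car T → ℚ) → (∀ t → f t ≡ 0ℚ) → OneAtMost f
      trivial-zero f z = (λ t → inj₁ (z t)) , λ t _ _ e _ → ⊥-elim (0≢1ℚ (trans (sym (z t)) e))
      go : Bit ξ → Bit (Sum k₁ (λ _ → b + ξ)) → TrivialCoset (λ t → h (t , 0[ Fⁿ m ]))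
      go (inj₁ refl) (inj₁ e) = inj₁ (one-at-most h (λ y → subst Bit (sym (h≡X y)) (bits y)) λ p φ i → bit≤1 (flats p φ i))
        where
        h≡X : ∀ y → h y ≡ X y
        h≡X y = trans (h≡ y) (trans (cong (_+ X y) (trans (sym (ℚP.+-identityʳ b)) (b+ξ≡0 e))) (ℚP.+-identityˡ (X y)))
      go (inj₂ refl) (inj₁ e) = inj₁ (trivial-zero _ λ t → negate (h (t , 0[ Fⁿ m ])) (vanish (λ y → 0ℚ - h y)
          (λ y → subst Bit (sym (h≡1-X y)) (bit-complement (bits y)))
          (λ p φ i → subst (_≤ 0ℚ) (sym (trans (flatSum-- (λ _ → 0ℚ) h p φ) (cong (_- flatSum h p φ) (0-flat p φ))))
            (neg-nonneg (flatSum h p φ) (0≤bit (flats p φ i)))) t))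
        where
        lem : ∀ x → 0ℚ - ((0ℚ - 1ℚ) + x) ≡ 1ℚ - x
        lem = solve-∀ ℚring
        h≡1-X : ∀ y → 0ℚ - h y ≡ 1ℚ - X y
        h≡1-X y = trans (cong (λ z → 0ℚ - z) (trans (h≡ y) (cong (_+ X y) (solve-b (b+ξ≡0 e))))) (lem (X y))
        negate : ∀ x → 0ℚ - x ≡ 0ℚ → x ≡ 0ℚ
        negate x e = sym (x-y≡0⇒x≡y 0ℚ x e)
        neg-nonneg : ∀ x → 0ℚ ≤ x → 0ℚ - x ≤ 0ℚ
        neg-nonneg x le = ≤-by {0ℚ - x} {0ℚ} {x} le (lem′ x)
          where
          lem′ : ∀ x → (0ℚ - x) + x ≡ 0ℚ
          lem′ = solve-∀ ℚring
      go (inj₁ refl) (inj₂ e) = inj₂ (trivial-zero _ λ t → flip-sign (h (t , 0[ Fⁿ m ])) (vanish (λ y → h y - α₁)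
          (λ y → subst Bit (sym (h-α≡X y)) (bits y))
          (λ p φ i → subst (_≤ 0ℚ) (sym (trans (flatSum-- h (λ _ → α₁) p φ) (cong (λ z → flatSum h p φ - z) Sum-α₁)))
            (minus-1 (flatSum h p φ) (bit≤1 (flats p φ i)))) t))
        where
        lem : ∀ a x → (a + x) - a ≡ x
        lem = solve-∀ ℚring
        h-α≡X : ∀ y → h y - α₁ ≡ X y
        h-α≡X y = trans (cong (_- α₁) (trans (h≡ y) (cong (_+ X y) (trans (sym (ℚP.+-identityʳ b)) (b+ξ≡α e))))) (lem α₁ (X y))
        flip-sign : ∀ x → x - α₁ ≡ 0ℚ → α₁ - x ≡ 0ℚ
        flip-sign x e = trans (cong (λ z → α₁ - z) (x-y≡0⇒x≡y x α₁ e)) (ℚP.+-inverseʳ α₁)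
        minus-1 : ∀ x → x ≤ 1ℚ → x - 1ℚ ≤ 0ℚ
        minus-1 x le = subst (x - 1ℚ ≤_) (ℚP.+-inverseʳ 1ℚ) (ℚP.+-monoˡ-≤ (- 1ℚ) le)
      go (inj₂ refl) (inj₂ e) = inj₂ (one-at-most (λ y → α₁ - h y)
          (λ y → subst Bit (sym (α-h≡1-X y)) (bit-complement (bits y)))
          λ p φ i → subst (_≤ 1ℚ) (sym (trans (flatSum-- (λ _ → α₁) h p φ) (cong (_- flatSum h p φ) Sum-α₁)))
            (bit≤1 (bit-complement (flats p φ i))))
        where
        lem : ∀ a x → a - ((a - 1ℚ) + x) ≡ 1ℚ - x
        lem = solve-∀ ℚring
        α-h≡1-X : ∀ y → α₁ - h y ≡ 1ℚ - X y
        α-h≡1-X y = trans (cong (λ z → α₁ - z) (trans (h≡ y) (cong (_+ X y) (solve-b (b+ξ≡α e))))) (lem α₁ (X y))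

-- The possible weights on a coset.

module CosetTheorem (F : FiniteField) (k′ : ℕ) where
  open import Data.Rational using (_+_; _*_; _-_; -_; _≤_; _<_)
  open Cosets F k′ public

  OneAtMost-cong : ∀ {f f′} → (∀ t → f t ≡ f′ t) → OneAtMost f → OneAtMost f′
  OneAtMost-cong eq (bits , two) = (λ t → subst Bit (eq t) (bits t)) ,
    λ t t′ ne e e′ → two t t′ ne (trans (eq t) e) (trans (eq t′) e′)

  TrivialCoset-cong : ∀ {h h′} → (∀ t → h t ≡ h′ t) → TrivialCoset h → TrivialCoset h′
  TrivialCoset-cong eq (inj₁ o) = inj₁ (OneAtMost-cong eq o)
  TrivialCoset-cong eq (inj₂ o) = inj₂ (OneAtMost-cong (λ t → cong (λ z → α₁ - z) (eq t)) o)

  mm : ℕ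
  mm = flatDim q k′

  N : ℕ
  N = iter k₁ mm

  k₁≤mm : k₁ ℕ.≤ mm
  k₁≤mm = ℕP.m≤m+n k₁ (hjN (q ℕ.^ k₁) 2 ℕ.* k₁)

  open Flats mm k₁≤mm

  module _ (g : Car (A ⊗ Fⁿ N) → ℚ) (bool : Boolean k (A ⊗ Fⁿ N) g) (z0 : ∀ t z → g ((0# , t) , z) ≡ 0ℚ)
    (ζ : Fⁿ mm ⊗ Fⁿ k₁ ⊸ Fⁿ N) (ζ-inj : Inj ζ)
    (uniform : ∀ t c x → x ≢ 0[ Fⁿ k₁ ] → g ((1# , t) , ζ $ (c , x)) ≡ g ((1# , 0[ T ]) , ζ $ (0[ Fⁿ mm ] , x))) where

    h : Car Y → ℚ
    h (t , c) = g ((1# , t) , ζ $ (c , 0[ Fⁿ k₁ ]))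

    X : Car Y → ℚ
    X (t , c) = Sum k₁ (λ μ → g ((1# , t) , ζ $ (c , μ)))

    X-frame : Car Y → Fⁿ k ⊸ A ⊗ Fⁿ N
    X-frame (t , c) = (fstL & ray T t ∘L fstL) & ζ ∘L (ray (Fⁿ mm) c ∘L fstL & sndL)

    X-inj : ∀ y → Inj (X-frame y)
    X-inj (t , c) (s , μ) e = cong₂ _,_ (cong (proj₁ ∘ proj₁) e)
      (cong proj₂ (ζ-inj (s ·[ Fⁿ mm ] c , μ) (cong proj₂ e)))

    X-bit : ∀ y → Bit (X y)
    X-bit (t , c) = subst Bit (trans (affine-sum (Fⁿ N) g z0 (X-frame (t , c)) (λ _ → refl))
        (Sum-cong k₁ λ μ → cong₂ (λ y z → g ((1# , y) , ζ $ (z , μ))) (VS.smul-1 T t) (VS.smul-1 (Fⁿ mm) c)))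
      (bit bool (X-frame (t , c)) (X-inj (t , c)))

    b : ℚ
    b = h 0[ Y ] - X 0[ Y ]

    -- X is the total of the k-space on the base point and the tower directions. Its summands with μ
    -- ≠ 0 are the same for all base points, so X varies exactly as its summand h does.
    h≡b+X : ∀ y → h y ≡ b + X y
    h≡b+X (t , c) = trans (lem₁ (h (t , c)) (h 0[ Y ])) (trans (cong (h 0[ Y ] +_) (sym diff)) (lem₂ (h 0[ Y ]) (X (t , c)) (X 0[ Y ])))
      where
      diff : X (t , c) - X 0[ Y ] ≡ h (t , c) - h 0[ Y ]
      diff = Sum-agree-off k₁ (λ μ → g ((1# , t) , ζ $ (c , μ))) (λ μ → g ((1# , 0[ T ]) , ζ $ (0[ Fⁿ mm ] , μ)))
               0[ Fⁿ k₁ ] (uniform t c)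
      lem₁ : ∀ x y → x ≡ y + (x - y)
      lem₁ = solve-∀ ℚring
      lem₂ : ∀ x y z → x + (y - z) ≡ (x - z) + y
      lem₂ = solve-∀ ℚring

    module _ (p : Car Y) (φ : Fⁿ k₁ ⊸ Y) where
      y-map : Fⁿ k ⊸ Y
      y-map = ray Y p ∘L fstL ⊹ φ ∘L sndL

      flat-frame : Fⁿ k ⊸ A ⊗ Fⁿ N
      flat-frame = (fstL & fstL ∘L y-map) & ζ ∘L (sndL ∘L y-map & zeroL)

      flat-inj : Inj φ → Inj flat-frame
      flat-inj i (s , μ) e = on-0 s (cong (proj₁ ∘ proj₁) e) μ
          (cong₂ _,_ (cong (proj₂ ∘ proj₁) e) (cong proj₁ (ζ-inj (proj₂ (y-map $ (s , μ)) , 0[ Fⁿ k₁ ]) (cong proj₂ e))))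
        where
        on-0 : ∀ s → s ≡ 0# → ∀ μ → y-map $ (s , μ) ≡ 0[ Y ] → (s , μ) ≡ 0[ Fⁿ k ]
        on-0 s refl μ e = cong (0# ,_) (i μ (trans (sym (0·+ Y p (φ $ μ))) e))

      flat-bit : Inj φ → Bit (flatSum h p φ)
      flat-bit i = subst Bit (trans (affine-sum (Fⁿ N) g z0 flat-frame (λ _ → refl))
          (Sum-cong k₁ λ μ → cong h (1·+ Y p (φ $ μ))))
        (bit bool flat-frame (flat-inj i))

    n₂ : ℕ
    n₂ = hjN (q ℕ.^ k₁) 2

    W : VS
    W = Pow (Fⁿ k₁) n₂

    embeds-W : Embeds W (n₂ ℕ.* k₁)
    embeds-W = embeds-Pow n₂ (embeds-Fⁿ k₁)

    W≤mm : n₂ ℕ.* k₁ ℕ.≤ mm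
    W≤mm = ℕP.m≤n+m (n₂ ℕ.* k₁) k₁

    ε : W ⊸ Fⁿ mm
    ε = pad W≤mm ∘L emb embeds-W

    ε-inj : Inj ε
    ε-inj = ∘-inj (pad W≤mm) (emb embeds-W) (pad-inj W≤mm) (emb-inj embeds-W)

    on-W : Car W → ℚ
    on-W w = X (0[ T ] , ε $ w)

    -- X is a bit, so two colours give a (k - 1)-flat on which h equals b + ξ throughout. Its sum is
    -- the total of a k-space, which supplies the bit that `trivial-coset` asks for.
    coset-trivial-by : MonoFlat (enum-Pow enum-F k₁) W (λ w → isZero (on-W w)) →
                       TrivialCoset (λ t → g ((1# , t) , 0[ Fⁿ N ]))
    coset-trivial-by (u , ψ , ψ-inj , mono) = TrivialCoset-cong
      (λ t → cong (λ z → g ((1# , t) , z)) (0-hom ζ))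
      (trivial-coset h X b X-bit h≡b+X flat-bit ξ (X-bit (0[ T ] , ε $ w₀)) mono-bit)
      where
      w₀ : Car W
      w₀ = u +[ W ] (ψ $ 0[ Fⁿ k₁ ])
      ξ : ℚ
      ξ = on-W w₀
      same : ∀ μ → on-W (u +[ W ] (ψ $ μ)) ≡ ξ
      same μ = bit-unique (X-bit _) (X-bit _) (isZero-≡ (mono μ 0[ Fⁿ k₁ ])) (isZero-≡ (mono 0[ Fⁿ k₁ ] μ))
      p : Car Y
      p = 0[ T ] , ε $ u
      φ : Fⁿ k₁ ⊸ Y
      φ = zeroL & ε ∘L ψ
      φ-inj : Inj φ
      φ-inj μ e = ψ-inj μ (ε-inj (ψ $ μ) (cong proj₂ e))
      on-flat : ∀ μ → h (p +[ Y ] (φ $ μ)) ≡ b + ξ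
      on-flat μ = trans (h≡b+X (p +[ Y ] (φ $ μ))) (cong (b +_) (trans
        (cong X (cong₂ _,_ (VS.add-idˡ T 0[ T ]) (sym (+-hom ε u (ψ $ μ))))) (same μ)))
      mono-bit : Bit (Sum k₁ (λ _ → b + ξ))
      mono-bit = subst Bit (Sum-cong k₁ on-flat) (flat-bit p φ φ-inj)

  abstract
    coset-trivial : (g : Car (A ⊗ Fⁿ N) → ℚ) → Boolean k (A ⊗ Fⁿ N) g → (∀ t z → g ((0# , t) , z) ≡ 0ℚ) →
                    TrivialCoset (λ t → g ((1# , t) , 0[ Fⁿ N ]))
    coset-trivial g bool z0 =
      let ζ , ζ-inj , uniform = tower k₁ mm k₁≤mm g bool z0
      in coset-trivial-by g bool z0 ζ ζ-inj uniform
           (affine-ramsey (enum-Pow enum-F k₁) 2 (λ w → isZero (on-W g bool z0 ζ ζ-inj uniform w)))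

-- Vectors of integral weight: closure under sums, and a point on every relevant line.

module GlobalShape (F : FiniteField) (k′ : ℕ) (n : ℕ) where
  open import Data.Rational using (_+_; _*_; _-_; -_; _≤_; _<_)
  open CosetTheorem F k′ public

  V : VS
  V = Fⁿ n

  int-Sum : ∀ m (f : Vecs m → ℚ) → (∀ v → IsInt (f v)) → IsInt (Sum m f)
  int-Sum zero    f ints = ints tt
  int-Sum (suc m) f ints = int-sumL (λ x → Sum m (λ v → f (x , v))) elements λ x → int-Sum m (λ v → f (x , v)) (λ v → ints (x , v))

  0<α₁ : 0ℚ < α₁
  0<α₁ with <-or-≥ 0ℚ α₁
  ... | inj₁ lt = lt
  ... | inj₂ le = ⊥-elim (<≤-absurd 0<1 (subst₂ _≤_ Sum-α₁ (Sum-0 k₁) (Sum-mono k₁ {λ _ → α₁} {λ _ → 0ℚ} (λ _ → le))))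

  1<2 : 1ℚ < 1ℚ + 1ℚ
  1<2 = ℚP.+-mono-<-≤ 0<1 (≤-refl {1ℚ})

  α₁<1 : α₁ < 1ℚ
  α₁<1 with <-or-≥ α₁ 1ℚ
  ... | inj₁ lt = lt
  ... | inj₂ le = ⊥-elim (<≤-absurd 1<2 (≤-trans
        (Sum-≥₂ k₁ {λ _ → 1ℚ} (λ _ → 0≤1) 0[ Fⁿ k₁ ] (1# , 0[ Fⁿ k′ ]) (λ e → 0≢1 (cong proj₁ e)))
        (subst (Sum k₁ (λ _ → 1ℚ) ≤_) Sum-α₁ (Sum-mono k₁ {λ _ → 1ℚ} {λ _ → α₁} (λ _ → le)))))

  -- Otherwise `α₁` would be an integer, whereas 0 < `α₁` < 1; the upper bound is where k ≥ 2
  -- enters.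
  bits-exclusive : ∀ {x} → Bit x → Bit (α₁ - x) → ⊥
  bits-exclusive {x} bx bα = int-gap (subst IsInt (lem α₁ x) (int-+ (int-bit bα) (int-bit bx))) 0<α₁ α₁<1
    where
    lem : ∀ a x → (a - x) + x ≡ a
    lem = solve-∀ ℚring

  q⁻¹-sum : Sum k′ (λ _ → α₁) ≡ q⁻¹
  q⁻¹-sum = trans (subst (λ j → Sum k′ (λ _ → α j) ≡ α 1) (ℕP.+-comm k′ 1) (Sum-const-α k′ 1)) (ℚP.*-identityʳ q⁻¹)

  0<q⁻¹ : 0ℚ < q⁻¹
  0<q⁻¹ = ℚP.<-≤-trans 0<α₁ (subst (α₁ ≤_) q⁻¹-sum (Sum-≥ k′ {λ _ → α₁} (λ _ → 0≤α k₁) 0[ Fⁿ k′ ]))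

  q⁻¹<1 : q⁻¹ < 1ℚ
  q⁻¹<1 with <-or-≥ q⁻¹ 1ℚ
  ... | inj₁ lt = lt
  ... | inj₂ le = ⊥-elim (<≤-absurd 1<q̂ (subst₂ _≤_ (ℚP.*-identityʳ q̂) q̂*q⁻¹
                    (ℚP.*-monoˡ-≤-nonNeg q̂ {{ℚ.nonNegative (ℚP.<⇒≤ 0<q̂)}} le)))

  module Vectors where
    open VS V
    open VSProps V

    add-0· : ∀ v w → add v (smul 0# w) ≡ v
    add-0· v w = trans (cong (add v) (smul-0 w)) (add-idʳ v)

    add-1· : ∀ v w → add v (smul 1# w) ≡ add v w
    add-1· v w = cong (add v) (smul-1 w)

    swap-last : ∀ u v w → add (add u v) w ≡ add (add u w) v
    swap-last u v w = trans (add-assoc u v w) (trans (cong (add u) (add-comm v w)) (sym (add-assoc u w v)))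

    neg-smul : ∀ c w → neg (smul c w) ≡ smul (-F c) w
    neg-smul c w = trans (sym (smul-smul (-F 1#) c w)) (cong (λ x → smul x w) -1*)
      where
      open import Algebra.Properties.Ring R.ring using (-1*x≈-x)
      -1* : (-F 1#) *F c ≡ -F c
      -1* = -1*x≈-x c

    add-cancel : ∀ v w → add (add v w) (neg w) ≡ v
    add-cancel v w = trans (add-assoc v w (neg w)) (trans (cong (add v) (neg-inverse w)) (add-idʳ v))

    add-cancel-smul : ∀ v c w → add (add v (smul c w)) (smul (-F c) w) ≡ v
    add-cancel-smul v c w = trans (cong (add (add v (smul c w))) (sym (neg-smul c w))) (add-cancel v (smul c w))

    combine-coeff : ∀ v c w d z → add (add v (smul c z)) (add w (smul d z)) ≡ add (add v w) (smul (c +F d) z)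
    combine-coeff v c w d z = trans (interchange v (smul c z) w (smul d z)) (cong (add (add v w)) (sym (add-smul c d z)))

    smul-combine : ∀ s v c z → smul s (add v (smul c z)) ≡ add (smul s v) (smul (s *F c) z)
    smul-combine s v c z = trans (smul-add s v (smul c z)) (cong (add (smul s v)) (sym (smul-smul s c z)))

    subtract : ∀ v u → add v (neg (add v u)) ≡ neg u
    subtract v u = begin
      add v (neg (add v u))           ≡⟨ cong (add v) (smul-add (-F 1#) v u) ⟩
      add v (add (neg v) (neg u))     ≡⟨ add-assoc v (neg v) (neg u) ⟨
      add (add v (neg v)) (neg u)     ≡⟨ cong (λ x → add x (neg u)) (neg-inverse v) ⟩
      add 𝟘 (neg u)                   ≡⟨ add-idˡ (neg u) ⟩
      neg u                           ∎
      where open ≡-Reasoning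

  open Vectors public

  module Glue (g : Vecs n → ℚ) (bool : Boolean k V g) (g0 : g 0[ V ] ≡ 0ℚ) (ψ : T ⊸ V) (ψ-inj : Inj ψ)
    (star : ∀ v → TrivialCoset (λ t → g (v +[ V ] (ψ $ t)))) (on-ψ : ∀ t → g (ψ $ t) ≡ 0ℚ) where

    -- The integral and the nonintegral weights. By `star` each vector is of one kind, and the kind
    -- is the same along its whole coset.
    Z NZ : Car V → Set
    Z v  = Bit (g v)
    NZ v = Bit (α₁ - g v)

    exclusive : ∀ v → Z v → NZ v → ⊥
    exclusive v = bits-exclusive

    at-0 : ∀ v → v +[ V ] (ψ $ 0[ T ]) ≡ v
    at-0 v = trans (cong (VS.add V v) (0-hom ψ)) (VSProps.add-idʳ V v)

    star-Z : ∀ v → Z v → OneAtMost (λ t → g (v +[ V ] (ψ $ t)))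
    star-Z v z with star v
    ... | inj₁ o = o
    ... | inj₂ o = ⊥-elim (exclusive v z (subst NZ (at-0 v) (proj₁ o 0[ T ])))

    star-NZ : ∀ v → NZ v → OneAtMost (λ t → α₁ - g (v +[ V ] (ψ $ t)))
    star-NZ v nz with star v
    ... | inj₁ o = ⊥-elim (exclusive v (subst Z (at-0 v) (proj₁ o 0[ T ])) nz)
    ... | inj₂ o = o

    Z-or-NZ : ∀ v → Z v ⊎ NZ v
    Z-or-NZ v with star v
    ... | inj₁ o = inj₁ (subst Z (at-0 v) (proj₁ o 0[ T ]))
    ... | inj₂ o = inj₂ (subst NZ (at-0 v) (proj₁ o 0[ T ]))

    Z-ψ : ∀ t → Z (ψ $ t)
    Z-ψ t = inj₁ (on-ψ t)

    Z-shift : ∀ v t → Z v → Z (v +[ V ] (ψ $ t))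
    Z-shift v t z = proj₁ (star-Z v z) t

    NZ-shift : ∀ v t → NZ v → NZ (v +[ V ] (ψ $ t))
    NZ-shift v t z = proj₁ (star-NZ v z) t

    Z-scale : ∀ s v → Z v → Z (s ·[ V ] v)
    Z-scale s v z with s ≟F 0#
    ... | yes refl = inj₁ (trans (cong g (VS.smul-0 V v)) g0)
    ... | no ne    = subst Bit (sym (homogeneous bool s v ne)) z

    NZ-scale⁻¹ : ∀ s v → s ≢ 0# → NZ v → NZ (s ·[ V ] v)
    NZ-scale⁻¹ s v ne nz = subst (λ x → Bit (α₁ - x)) (sym (homogeneous bool s v ne)) nz

    L : Car V → Car V → 𝔽 ⊗ 𝔽 ⊗ T ⊸ V
    L v w = ray V v ∘L fstL ⊹ (ray V w ∘L fstL ∘L sndL ⊹ ψ ∘L sndL ∘L sndL)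

    -- Only independence modulo ψ T gives a line of the quotient, to which k-spaces can be applied.
    -- The other two cases are settled by scaling and by shifts inside a coset.
    data Dependence (v w : Car V) : Set where
      indep  : Inj (L v w) → Dependence v w
      dep-v  : ∀ c t → v ≡ c ·[ V ] w +[ V ] (ψ $ t) → Dependence v w
      dep-w  : ∀ t → w ≡ ψ $ t → Dependence v w

    divide : ∀ x v u → (ne : x ≢ 0#) → x ·[ V ] v +[ V ] u ≡ 0[ V ] → v ≡ (inv x ne *F (-F 1#)) ·[ V ] u
    divide x v u ne e = begin
      v                                          ≡⟨ VS.smul-1 V v ⟨
      1# ·[ V ] v                                ≡⟨ cong (λ s → s ·[ V ] v) (inv-* x ne) ⟨
      (inv x ne *F x) ·[ V ] v                   ≡⟨ VS.smul-smul V (inv x ne) x v ⟩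
      inv x ne ·[ V ] (x ·[ V ] v)               ≡⟨ cong (VS.smul V (inv x ne)) (VSProps.isolate V (x ·[ V ] v) u e) ⟩
      inv x ne ·[ V ] (VSProps.neg V u)          ≡⟨ VS.smul-smul V (inv x ne) (-F 1#) u ⟨
      (inv x ne *F (-F 1#)) ·[ V ] u             ∎
      where open ≡-Reasoning

    relation : ∀ v w x y t → x ·[ V ] v +[ V ] (y ·[ V ] w +[ V ] (ψ $ t)) ≡ 0[ V ] →
               (x , y , t) ≢ 0[ 𝔽 ⊗ 𝔽 ⊗ T ] → Dec (x ≡ 0#) → Dec (y ≡ 0#) → Dependence v w
    relation v w x y t e ne (no x≢0) _ = dep-v (s *F y) (s ·[ T ] t) (begin
        v                                             ≡⟨ divide x v _ x≢0 e ⟩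
        s ·[ V ] (y ·[ V ] w +[ V ] (ψ $ t))          ≡⟨ VS.smul-add V s _ _ ⟩
        s ·[ V ] (y ·[ V ] w) +[ V ] s ·[ V ] (ψ $ t) ≡⟨ cong₂ (VS.add V) (sym (VS.smul-smul V s y w)) (sym (·-hom ψ s t)) ⟩
        (s *F y) ·[ V ] w +[ V ] (ψ $ (s ·[ T ] t))     ∎)
      where
      open ≡-Reasoning
      s : Carrier
      s = inv x x≢0 *F (-F 1#)
    relation v w x y t e ne (yes refl) (no y≢0) = dep-w (s ·[ T ] t)
      (trans (divide y w (ψ $ t) y≢0 (trans (sym (0·+ V v _)) e)) (sym (·-hom ψ s t)))
      where
      s : Carrier
      s = inv y y≢0 *F (-F 1#)
    relation v w x y t e ne (yes refl) (yes refl) = ⊥-elim (ne (cong (λ z → 0# , 0# , z)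
      (ψ-inj t (trans (sym (trans (0·+ V v _) (0·+ V w (ψ $ t)))) e))))

    enum-L : Enum (Car (𝔽 ⊗ 𝔽 ⊗ T)) (q ℕ.* (q ℕ.* q ℕ.^ k))
    enum-L = enum-× enum-F (enum-× enum-F (enum-Pow enum-F k))

    dependence : ∀ v w → Dependence v w
    dependence v w = decide (search enum-L {λ u → L v w $ u ≡ 0[ V ] × u ≢ 0[ 𝔽 ⊗ 𝔽 ⊗ T ]}
      (λ u → VS._≟V_ V (L v w $ u) 0[ V ] ×-dec ¬? (VS._≟V_ (𝔽 ⊗ 𝔽 ⊗ T) u 0[ 𝔽 ⊗ 𝔽 ⊗ T ])))
      where
      decide : _ → Dependence v w
      decide (inj₁ ((x , y , t) , e , ne)) = relation v w x y t e ne (x ≟F 0#) (y ≟F 0#)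
      decide (inj₂ none) = indep λ u e → non-neg u e (VS._≟V_ (𝔽 ⊗ 𝔽 ⊗ T) u 0[ 𝔽 ⊗ 𝔽 ⊗ T ])
        where
        non-neg : ∀ u → L v w $ u ≡ 0[ V ] → Dec (u ≡ 0[ 𝔽 ⊗ 𝔽 ⊗ T ]) → u ≡ 0[ 𝔽 ⊗ 𝔽 ⊗ T ]
        non-neg u e (yes z) = z
        non-neg u e (no ne) = ⊥-elim (none u (e , ne))

    ι : Fⁿ k′ ⊸ T
    ι = zeroL & zeroL & idL

    -- The share of the point v of V / ψ T in the total of a k-space through the (k - 2)-space ψ ι,
    -- which itself contributes 0.
    C : Car V → ℚ
    C v = Sum k′ (λ μ → g (v +[ V ] (ψ $ ι $ μ)))

    line-bit : ∀ v w → Inj (L v w) → Bit (ΣF (λ y → C (v +[ V ] y ·[ V ] w)) + C w)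
    line-bit v w i = subst Bit eq (bit bool frame frame-inj)
      where
      frame : Fⁿ k ⊸ V
      frame = L v w ∘L (fstL & fstL ∘L sndL & ι ∘L sndL ∘L sndL)
      frame-inj : Inj frame
      frame-inj (x , y , μ) e = cong (λ u → proj₁ u , proj₁ (proj₂ u) , proj₂ (proj₂ (proj₂ (proj₂ u))))
        (i (x , y , ι $ μ) e)
      eq : ksum k (λ c → g (frame $ c)) ≡ ΣF (λ y → C (v +[ V ] y ·[ V ] w)) + C w
      eq = cong₂ _+_
        (sumL-cong elements λ y _ → Sum-cong k′ λ μ → cong g
          (trans (1·+ V v _) (sym (VS.add-assoc V v (y ·[ V ] w) (ψ $ ι $ μ)))))
        (trans (cong₂ _+_
          (Sum-cong k′ λ μ → cong g (trans (0·+ V v _) (1·+ V w (ψ $ ι $ μ))))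
          (ksum-zero k′ {λ μ → g (frame $ (0# , 0# , μ))} λ μ _ → trans (cong g (trans (0·+ V v _) (0·+ V w (ψ $ ι $ μ)))) (on-ψ (ι $ μ))))
          (ℚP.+-identityʳ (C w)))

    κ-of : ∀ {v} → Z v ⊎ NZ v → ℚ
    κ-of (inj₁ _) = 0ℚ
    κ-of (inj₂ _) = q⁻¹

    -- The residue of `C v` modulo ℤ: a (k - 2)-flat with all weights `α₁` sums to 1/q, and
    -- exceptions change this by integers.
    κ : Car V → ℚ
    κ v = κ-of (Z-or-NZ v)

    κ-Z : ∀ v → Z v → κ v ≡ 0ℚ
    κ-Z v z with Z-or-NZ v
    ... | inj₁ _  = refl
    ... | inj₂ nz = ⊥-elim (exclusive v z nz)

    κ-NZ : ∀ v → NZ v → κ v ≡ q⁻¹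
    κ-NZ v nz with Z-or-NZ v
    ... | inj₁ z = ⊥-elim (exclusive v z nz)
    ... | inj₂ _ = refl

    0≤κ : ∀ v → 0ℚ ≤ κ v
    0≤κ v with Z-or-NZ v
    ... | inj₁ _ = ≤-refl
    ... | inj₂ _ = 0≤q⁻¹

    κ≤q⁻¹ : ∀ v → κ v ≤ q⁻¹
    κ≤q⁻¹ v with Z-or-NZ v
    ... | inj₁ _ = 0≤q⁻¹
    ... | inj₂ _ = ≤-refl

    C-NZ : ∀ v → C v ≡ q⁻¹ - Sum k′ (λ μ → α₁ - g (v +[ V ] (ψ $ ι $ μ)))
    C-NZ v = trans (Sum-cong k′ λ μ → lem α₁ (g (v +[ V ] (ψ $ ι $ μ))))
      (trans (Sum-- k′ (λ _ → α₁) (λ μ → α₁ - g (v +[ V ] (ψ $ ι $ μ))))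
             (cong (_- Sum k′ (λ μ → α₁ - g (v +[ V ] (ψ $ ι $ μ)))) q⁻¹-sum))
      where
      lem : ∀ a x → x ≡ a - (a - x)
      lem = solve-∀ ℚring

    C-int : ∀ v → IsInt (κ v - C v)
    C-int v = go (Z-or-NZ v)
      where
      go : Z v ⊎ NZ v → IsInt (κ v - C v)
      go (inj₁ z) = subst IsInt (trans (sym (ℚP.+-identityˡ (- C v))) (cong (_- C v) (sym (κ-Z v z))))
        (int-neg (int-Sum k′ (λ μ → g (v +[ V ] (ψ $ ι $ μ))) (λ μ → int-bit (Z-shift v (ι $ μ) z))))
      go (inj₂ nz) = subst IsInt (sym (trans (cong₂ _-_ (κ-NZ v nz) (C-NZ v)) (lem q⁻¹ S)))
        (int-Sum k′ (λ μ → α₁ - g (v +[ V ] (ψ $ ι $ μ))) (λ μ → int-bit (NZ-shift v (ι $ μ) nz)))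
        where
        S : ℚ
        S = Sum k′ (λ μ → α₁ - g (v +[ V ] (ψ $ ι $ μ)))
        lem : ∀ a s → a - (a - s) ≡ s
        lem = solve-∀ ℚring

    -- Modulo ℤ, the weight of a k-space over a projective line of V / ψ T is 1/q times the number of its
    -- points off the hyperplane of integral weights; so that number is 0 or q.
    line-int : ∀ v w → Inj (L v w) → IsInt (ΣF (λ y → κ (v +[ V ] y ·[ V ] w)) + κ w)
    line-int v w i = subst IsInt (lem SK SC (κ w) (C w))
      (int-+ (int-+ (subst IsInt (Sum-- 1 (λ y → κ (pt (proj₁ y))) (λ y → C (pt (proj₁ y))))
                      (int-Sum 1 (λ y → κ (pt (proj₁ y)) - C (pt (proj₁ y))) (λ y → C-int (pt (proj₁ y)))))
                    (C-int w))
             (int-bit (line-bit v w i)))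
      where
      pt : Carrier → Car V
      pt y = v +[ V ] y ·[ V ] w
      SK SC : ℚ
      SK = ΣF (λ y → κ (pt y))
      SC = ΣF (λ y → C (pt y))
      lem : ∀ a b c d → ((a - b) + (c - d)) + (b + d) ≡ a + c
      lem = solve-∀ ℚring

    -- At most q - 1 summands 1/q are left.
    κ-sum≤1 : ∀ (f : Carrier → Car V) y₀ → κ (f y₀) ≡ 0ℚ → ΣF (λ y → κ (f y)) < 1ℚ
    κ-sum≤1 f y₀ e = ℚP.≤-<-trans {S} {1ℚ - q⁻¹} {1ℚ} (≤-by {S} {1ℚ - q⁻¹} {(1ℚ - S) - q⁻¹} (0≤b-a {q⁻¹} {1ℚ - S} q⁻¹≤) (lem₁ S q⁻¹))
        (subst (1ℚ - q⁻¹ <_) (ℚP.+-identityʳ 1ℚ) (ℚP.+-monoʳ-< 1ℚ (ℚP.neg-antimono-< 0<q⁻¹)))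
      where
      S : ℚ
      S = ΣF (λ y → κ (f y))
      total : ΣF (λ y → q⁻¹ - κ (f y)) ≡ 1ℚ - S
      total = trans (Sum-- 1 (λ _ → q⁻¹) (λ y → κ (f (proj₁ y)))) (cong (_- S) (trans (ΣF-const q⁻¹) q̂*q⁻¹))
      q⁻¹≤ : q⁻¹ ≤ 1ℚ - S
      q⁻¹≤ = subst₂ _≤_ (trans (cong (λ z → q⁻¹ - z) e) (ℚP.+-identityʳ q⁻¹)) total
        (Sum-≥ 1 {λ y → q⁻¹ - κ (f (proj₁ y))} (λ y → 0≤b-a {κ (f (proj₁ y))} {q⁻¹} (κ≤q⁻¹ (f (proj₁ y)))) (y₀ , tt))
      lem₁ : ∀ s r → s + ((1ℚ - s) - r) ≡ 1ℚ - r
      lem₁ = solve-∀ ℚring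

    -- As κ w = 0, the residues of the points v + y w would add up to an integer; but v + w
    -- contributes 1/q and v contributes 0, so their sum lies strictly between 0 and 1.
    Z-add-indep : ∀ v w → Inj (L v w) → Z v → Z w → NZ (v +[ V ] w) → ⊥
    Z-add-indep v w i zv zw nz = int-gap
      (subst IsInt (trans (cong (S +_) (κ-Z w zw)) (ℚP.+-identityʳ S)) (line-int v w i))
      (ℚP.<-≤-trans 0<q⁻¹ (subst (_≤ S) (trans (cong κ (add-1· v w)) (κ-NZ (v +[ V ] w) nz))
        (Sum-≥ 1 {λ y → κ (pt (proj₁ y))} (λ y → 0≤κ (pt (proj₁ y))) (1# , tt))))
      (κ-sum≤1 pt 0# (trans (cong κ (add-0· v w)) (κ-Z v zv)))
      where
      pt : Carrier → Car V
      pt y = v +[ V ] y ·[ V ] w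
      S : ℚ
      S = ΣF (λ y → κ (pt y))

    Z-add : ∀ v w → Z v → Z w → Z (v +[ V ] w)
    Z-add v w zv zw = go (dependence v w) (Z-or-NZ (v +[ V ] w))
      where
      go : Dependence v w → Z (v +[ V ] w) ⊎ NZ (v +[ V ] w) → Z (v +[ V ] w)
      go _ (inj₁ z) = z
      go (indep i) (inj₂ nz) = ⊥-elim (Z-add-indep v w i zv zw nz)
      go (dep-w t e) (inj₂ _) = subst (λ u → Z (v +[ V ] u)) (sym e) (Z-shift v t zv)
      go (dep-v c t e) (inj₂ _) = subst Z eq (Z-shift ((c +F 1#) ·[ V ] w) t (Z-scale (c +F 1#) w zw))
        where
        open ≡-Reasoning
        eq : (c +F 1#) ·[ V ] w +[ V ] (ψ $ t) ≡ v +[ V ] w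
        eq = begin
          (c +F 1#) ·[ V ] w +[ V ] (ψ $ t)               ≡⟨ cong (λ u → u +[ V ] (ψ $ t)) (VS.add-smul V c 1# w) ⟩
          (c ·[ V ] w +[ V ] 1# ·[ V ] w) +[ V ] (ψ $ t)  ≡⟨ swap-last _ _ _ ⟩
          (c ·[ V ] w +[ V ] (ψ $ t)) +[ V ] 1# ·[ V ] w  ≡⟨ cong₂ (VS.add V) (sym e) (VS.smul-1 V w) ⟩
          v +[ V ] w                                      ∎

    NZ-add : ∀ v w → NZ v → Z w → NZ (v +[ V ] w)
    NZ-add v w nv zw with Z-or-NZ (v +[ V ] w)
    ... | inj₂ nz = nz
    ... | inj₁ z  = ⊥-elim (exclusive v (subst Z (add-cancel v w) (Z-add _ _ z (Z-scale (-F 1#) w zw))) nv)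

    -- Otherwise w and all q points v + y w have residue 1/q, and 1 + 1/q is not an integer. So w
    -- spans a complement of the integral vectors, which makes them a hyperplane.
    meets : ∀ w → NZ w → ∀ v → ∃ λ y → Z (v +[ V ] y ·[ V ] w)
    meets w nw v = go (dependence v w)
      where
      pt : Carrier → Car V
      pt y = v +[ V ] y ·[ V ] w
      Z? : ∀ v → Dec (Z v)
      Z? v with Z-or-NZ v
      ... | inj₁ z = yes z
      ... | inj₂ nz = no λ z → exclusive v z nz
      to-NZ : ∀ v → ¬ Z v → NZ v
      to-NZ v nz with Z-or-NZ v
      ... | inj₁ z = ⊥-elim (nz z)
      ... | inj₂ z = z
      all-NZ : Inj (L v w) → (∀ y → ¬ Z (pt y)) → ⊥
      all-NZ i none = int-gap (subst IsInt eq (int-+ (line-int v w i) (0 , 1 , refl))) 0<q⁻¹ q⁻¹<1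
        where
        lem : ∀ a → (1ℚ + a) + (0ℚ - (1ℚ + 0ℚ)) ≡ a
        lem = solve-∀ ℚring
        eq : (ΣF (λ y → κ (pt y)) + κ w) + (0ℚ - (1ℚ + 0ℚ)) ≡ q⁻¹
        eq = trans (cong (_+ (0ℚ - (1ℚ + 0ℚ))) (cong₂ _+_
          (trans (sumL-cong elements (λ y _ → κ-NZ (pt y) (to-NZ (pt y) (none y)))) (trans (ΣF-const q⁻¹) q̂*q⁻¹))
          (κ-NZ w nw))) (lem q⁻¹)
      go : Dependence v w → ∃ λ y → Z (pt y)
      go (dep-w t e) = ⊥-elim (exclusive w (subst Z (sym e) (Z-ψ t)) nw)
      go (dep-v c t e) = -F c , subst Z (sym eq) (Z-ψ t)
        where
        eq : v +[ V ] (-F c) ·[ V ] w ≡ ψ $ t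
        eq = trans (cong (λ u → u +[ V ] (-F c) ·[ V ] w) (trans e (VS.add-comm V _ _))) (add-cancel-smul (ψ $ t) c w)
      go (indep i) = pick (search enum-F {λ y → Z (pt y)} (λ y → Z? (pt y)))
        where
        pick : ∃ (λ y → Z (pt y)) ⊎ (∀ y → ¬ Z (pt y)) → ∃ λ y → Z (pt y)
        pick (inj₁ p) = p
        pick (inj₂ none) = ⊥-elim (all-NZ i none)

-- Exceptional points and the four shapes of a weight.

module Shapes (F : FiniteField) (k′ : ℕ) (n : ℕ) where
  open import Data.Rational using (_+_; _*_; _-_; -_; _≤_; _<_)
  open GlobalShape F k′ n public

  -- In this order, weights for type I, type II, the complement of type III and the complement of
  -- type IV. The last two are complements because the weight vanishes on the hyperplane.
  data Form (g : Vecs n → ℚ) : Set where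
    zero-form  : (∀ v → g v ≡ 0ℚ) → Form g
    point-form : ∀ P → P ≢ 0[ V ] → g P ≡ 1ℚ → (∀ v → Bit (g v)) →
                 (∀ v → g v ≡ 1ℚ → ∃ λ c → v ≡ c ·[ V ] P) → Form g
    hyperplane-form : (a : V ⊸ 𝔽) (z : Car V) → a $ z ≢ 0# → (∀ v → a $ v ≡ 0# → g v ≡ 0ℚ) →
                      (∀ v → a $ v ≢ 0# → g v ≡ α₁) → Form g
    both-form  : (a : V ⊸ 𝔽) (P : Car V) → a $ P ≢ 0# → (∀ v → a $ v ≡ 0# → g v ≡ 0ℚ) →
                 α₁ - g P ≡ 1ℚ → (∀ v → a $ v ≢ 0# → Bit (α₁ - g v)) →
                 (∀ v → α₁ - g v ≡ 1ℚ → ∃ λ c → v ≡ c ·[ V ] P) → Form g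

  enum-V : Enum (Car V) (q ℕ.^ n)
  enum-V = enum-Pow enum-F n

  not-1 : ∀ {x} → Bit x → x ≢ 1ℚ → x ≡ 0ℚ
  not-1 (inj₁ e) ne = e
  not-1 (inj₂ e) ne = ⊥-elim (ne e)

  module Classify (g : Vecs n → ℚ) (bool : Boolean k V g) (g0 : g 0[ V ] ≡ 0ℚ) (ψ : T ⊸ V) (ψ-inj : Inj ψ)
    (star : ∀ v → TrivialCoset (λ t → g (v +[ V ] (ψ $ t)))) (on-ψ : ∀ t → g (ψ $ t) ≡ 0ℚ) where
    open Glue g bool g0 ψ ψ-inj star on-ψ

    C≥ : ∀ v → Z v → g v ≤ C v
    C≥ v z = subst (λ u → g u ≤ C v) (trans (cong (λ t → v +[ V ] (ψ $ t)) (0-hom ι)) (at-0 v))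
      (Sum-≥ k′ {λ μ → g (v +[ V ] (ψ $ ι $ μ))} (λ μ → 0≤bit (Z-shift v (ι $ μ) z)) 0[ Fⁿ k′ ])

    0≤C : ∀ v → Z v → 0ℚ ≤ C v
    0≤C v z = Sum-nonneg k′ {λ μ → g (v +[ V ] (ψ $ ι $ μ))} (λ μ → 0≤bit (Z-shift v (ι $ μ) z))

    coset-unique : ∀ (f : Car V → ℚ) v t → OneAtMost (λ t → f (v +[ V ] (ψ $ t))) → f v ≡ 1ℚ →
                   f (v +[ V ] (ψ $ t)) ≡ 1ℚ → v +[ V ] (ψ $ t) ≡ v
    coset-unique f v t o e e′ with VS._≟V_ T t 0[ T ]
    ... | yes refl = at-0 v
    ... | no ne = ⊥-elim (proj₂ o t 0[ T ] ne e′ (trans (cong f (at-0 v)) e))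

    1≢0 : ∀ {x} → x ≡ 1ℚ → x ≡ 0ℚ → ⊥
    1≢0 e e′ = 0≢1ℚ (trans (sym e′) e)

    -- Two points of weight 1 that are independent modulo ψ T would give a k-space of weight at
    -- least 2. Dependent ones meet, after scaling P, in one coset, where `star` allows a single
    -- exception.
    positive-unique : (∀ v → Z v) → ∀ P → g P ≡ 1ℚ → ∀ v → g v ≡ 1ℚ → ∃ λ c → v ≡ c ·[ V ] P
    positive-unique allZ P gP v gv = go (dependence v P)
      where
      go : Dependence v P → ∃ λ c → v ≡ c ·[ V ] P
      go (dep-w t e) = ⊥-elim (1≢0 (trans (cong g (sym e)) gP) (on-ψ t))
      go (indep i) = ⊥-elim (<≤-absurd 1<2 (≤-trans {1ℚ + 1ℚ} {ΣF (λ y → C (v +[ V ] y ·[ V ] P)) + C P} {1ℚ}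
        (ℚP.+-mono-≤ {1ℚ} {ΣF (λ y → C (v +[ V ] y ·[ V ] P))} {1ℚ} {C P}
          (≤-trans {1ℚ} {C (v +[ V ] 0# ·[ V ] P)} {ΣF (λ y → C (v +[ V ] y ·[ V ] P))}
            (subst (_≤ C (v +[ V ] 0# ·[ V ] P)) (trans (cong g (add-0· v P)) gv) (C≥ (v +[ V ] 0# ·[ V ] P) (allZ _)))
            (Sum-≥ 1 {λ y → C (v +[ V ] proj₁ y ·[ V ] P)} (λ y → 0≤C (v +[ V ] proj₁ y ·[ V ] P) (allZ _)) (0# , tt)))
          (subst (_≤ C P) gP (C≥ P (allZ P))))
        (bit≤1 (line-bit v P i))))
      go (dep-v c t e) = c , on-c (c ≟F 0#)
        where
        on-c : Dec (c ≡ 0#) → v ≡ c ·[ V ] P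
        on-c (yes refl) = ⊥-elim (1≢0 (trans (cong g (sym (trans e (0·+ V P (ψ $ t))))) gv) (on-ψ t))
        on-c (no ne) = trans e (coset-unique g (c ·[ V ] P) t (star-Z (c ·[ V ] P) (allZ _))
          (trans (homogeneous bool c P ne) gP) (trans (cong g (sym e)) gv))

    all-Z : (∀ v → Z v) → Form g
    all-Z allZ = go (search enum-V {λ v → g v ≡ 1ℚ} (λ v → g v ℚP.≟ 1ℚ))
      where
      go : ∃ (λ v → g v ≡ 1ℚ) ⊎ (∀ v → g v ≢ 1ℚ) → Form g
      go (inj₂ none) = zero-form λ v → not-1 (allZ v) (none v)
      go (inj₁ (P , gP)) = point-form P (λ { refl → 1≢0 gP g0 }) gP allZ (positive-unique allZ P gP)

    module WithNonzero (z : Car V) (nz : NZ z) where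
      -- The difference of two integral points of the line is a multiple of z, and a nonzero
      -- multiple would make z integral.
      coefficient-unique : ∀ v c d → Z (v +[ V ] c ·[ V ] z) → Z (v +[ V ] d ·[ V ] z) → c ≡ d
      coefficient-unique v c d zc zd = VSProps.sub-zero 𝔽 c d (go (s ≟F 0#))
        where
        s : Carrier
        s = c +F ((-F 1#) *F d)
        eq : (v +[ V ] c ·[ V ] z) +[ V ] (-F 1#) ·[ V ] (v +[ V ] d ·[ V ] z) ≡ s ·[ V ] z
        eq = begin
          (v +[ V ] c ·[ V ] z) +[ V ] (-F 1#) ·[ V ] (v +[ V ] d ·[ V ] z)
            ≡⟨ cong (VS.add V (v +[ V ] c ·[ V ] z)) (smul-combine (-F 1#) v d z) ⟩
          (v +[ V ] c ·[ V ] z) +[ V ] ((-F 1#) ·[ V ] v +[ V ] ((-F 1#) *F d) ·[ V ] z)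
            ≡⟨ combine-coeff v c ((-F 1#) ·[ V ] v) ((-F 1#) *F d) z ⟩
          (v +[ V ] (-F 1#) ·[ V ] v) +[ V ] s ·[ V ] z
            ≡⟨ cong (λ u → u +[ V ] s ·[ V ] z) (VSProps.neg-inverse V v) ⟩
          0[ V ] +[ V ] s ·[ V ] z
            ≡⟨ VS.add-idˡ V (s ·[ V ] z) ⟩
          s ·[ V ] z ∎
          where open ≡-Reasoning
        go : Dec (s ≡ 0#) → s ≡ 0#
        go (yes e) = e
        go (no ne) = ⊥-elim (exclusive z (subst Bit (homogeneous bool s z ne)
          (subst Z eq (Z-add _ _ zc (Z-scale (-F 1#) _ zd)))) nz)

      coefficient : Car V → Carrier
      coefficient v = proj₁ (meets z nz v)

      coefficient-Z : ∀ v → Z (v +[ V ] coefficient v ·[ V ] z)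
      coefficient-Z v = proj₂ (meets z nz v)

      -- The hyperplane of the integral points is the kernel of the projection along z.
      a : V ⊸ 𝔽
      a = record
        { _$_   = coefficient
        ; +-hom = λ v w → coefficient-unique (v +[ V ] w) _ _ (coefficient-Z (v +[ V ] w))
            (subst Z (combine-coeff v (coefficient v) w (coefficient w) z) (Z-add _ _ (coefficient-Z v) (coefficient-Z w)))
        ; ·-hom = λ s v → coefficient-unique (s ·[ V ] v) _ _ (coefficient-Z (s ·[ V ] v))
            (subst Z (smul-combine s v (coefficient v) z) (Z-scale s _ (coefficient-Z v))) }

      a-Z : ∀ v → coefficient v ≡ 0# → Z v
      a-Z v e = subst Z (trans (cong (λ c → v +[ V ] c ·[ V ] z) e) (add-0· v z)) (coefficient-Z v)

      Z-a : ∀ v → Z v → coefficient v ≡ 0#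
      Z-a v zv = coefficient-unique v _ _ (coefficient-Z v) (subst Z (sym (add-0· v z)) zv)

      a-NZ : ∀ v → coefficient v ≢ 0# → NZ v
      a-NZ v ne with Z-or-NZ v
      ... | inj₁ zv = ⊥-elim (ne (Z-a v zv))
      ... | inj₂ nv = nv

      az≢0 : coefficient z ≢ 0#
      az≢0 e = exclusive z (a-Z z e) nz

    κ₁ : Fⁿ k₁ ⊸ T
    κ₁ = zeroL & idL

    -- The total of the k-space spanned by w and a hyperplane of ψ T, when w lies outside ψ T.
    E : Car V → ℚ
    E w = Sum k₁ (λ u → g (w +[ V ] (ψ $ κ₁ $ u)))

    E-bit : ∀ w → NZ w → Bit (E w)
    E-bit w nw = subst Bit eq (bit bool frame frame-inj)
      where
      frame : Fⁿ k ⊸ V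
      frame = ray V w ∘L fstL ⊹ ψ ∘L κ₁ ∘L sndL
      frame-inj : Inj frame
      frame-inj (s , u) e = go (s ≟F 0#)
        where
        go : Dec (s ≡ 0#) → (s , u) ≡ 0[ Fⁿ k ]
        go (no ne) = ⊥-elim (exclusive w (subst Z (sym (trans (divide s w _ ne e)
          (sym (·-hom ψ (inv s ne *F (-F 1#)) (κ₁ $ u))))) (Z-ψ _)) nw)
        go (yes s≡0) = cong₂ _,_ s≡0 (cong proj₂ (ψ-inj (κ₁ $ u)
          (trans (sym (0·+ V w (ψ $ κ₁ $ u))) (trans (cong (λ x → x ·[ V ] w +[ V ] (ψ $ κ₁ $ u)) (sym s≡0)) e))))
      eq : ksum k (λ c → g (frame $ c)) ≡ E w
      eq = trans (cong₂ _+_ (Sum-cong k₁ λ u → cong g (1·+ V w (ψ $ κ₁ $ u)))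
             (ksum-zero k₁ {λ u → g (frame $ (0# , u))} λ u _ → trans (cong g (0·+ V w (ψ $ κ₁ $ u))) (on-ψ (κ₁ $ u))))
             (ℚP.+-identityʳ (E w))

    side : Carrier → Car T
    side u = 0# , u , 0[ Fⁿ k′ ]

    E-split : ∀ w → E w ≡ ΣF (λ u → C (w +[ V ] (ψ $ side u)))
    E-split w = sumL-cong elements λ u _ → Sum-cong k′ λ μ → cong g (sym (begin
      (w +[ V ] (ψ $ side u)) +[ V ] (ψ $ ι $ μ)     ≡⟨ VS.add-assoc V w _ _ ⟩
      w +[ V ] ((ψ $ side u) +[ V ] (ψ $ ι $ μ))     ≡⟨ cong (VS.add V w) (+-hom ψ (side u) (ι $ μ)) ⟨
      w +[ V ] (ψ $ (side u +[ T ] (ι $ μ)))         ≡⟨ cong (λ t → w +[ V ] (ψ $ t)) (cong₂ _,_ (R.+-identityˡ 0#)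
                                                          (cong₂ _,_ (R.+-identityʳ u) (VS.add-idˡ (Fⁿ k′) μ))) ⟩
      w +[ V ] (ψ $ κ₁ $ (u , μ))                    ∎))
      where open ≡-Reasoning

    -- A point P of positive weight in the hyperplane would force every translate of a (k−1)-flat off
    -- the hyperplane to have weight 0, hence two exceptions in one coset.
    module NoPositive (P : Car V) (zP : Z P) (gP : g P ≡ 1ℚ) where
      independent : ∀ z → NZ z → Inj (L z P)
      independent z nz = go (dependence z P)
        where
        go : Dependence z P → Inj (L z P)
        go (indep i) = i
        go (dep-w t e) = ⊥-elim (1≢0 (trans (cong g (sym e)) gP) (on-ψ t))
        go (dep-v c t e) = ⊥-elim (exclusive z (subst Z (sym e) (Z-shift (c ·[ V ] P) t (Z-scale c P zP))) nz)

      -- P alone already uses up the largest possible total 1 of the k-space.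
      line-nonpos : ∀ z → NZ z → ΣF (λ y → C (z +[ V ] y ·[ V ] P)) ≤ 0ℚ
      line-nonpos z nz = ≤-by {S} {0ℚ} {0ℚ - S} (subst (0ℚ ≤_) (lem S (C P) 1ℚ)
          (0≤-+ (0≤b-a {S + C P} {1ℚ} (bit≤1 (line-bit z P (independent z nz)))) (0≤b-a {1ℚ} {C P} (subst (_≤ C P) gP (C≥ P zP))))) (lem′ S)
        where
        S : ℚ
        S = ΣF (λ y → C (z +[ V ] y ·[ V ] P))
        lem : ∀ s c o → (o - (s + c)) + (c - o) ≡ 0ℚ - s
        lem = solve-∀ ℚring
        lem′ : ∀ s → s + (0ℚ - s) ≡ 0ℚ
        lem′ = solve-∀ ℚring

      -- Adding `line-nonpos` over the translates by `side u` assembles the shares `C` into totals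
      -- `E` of k-spaces. These are bits with sum at most 0.
      E-zero : ∀ z → NZ z → E z ≡ 0ℚ
      E-zero z nz = ℚP.≤-antisym (≤-trans {E z} {S} {0ℚ}
          (subst (λ u → E u ≤ S) (add-0· z P) (Sum-≥ 1 {λ y → E (pt (proj₁ y))} (λ y → 0≤bit (E-bit (pt (proj₁ y)) (pt-NZ (proj₁ y)))) (0# , tt)))
          (subst (_≤ 0ℚ) total (subst (ΣF (λ u → ΣF (λ y → C (shifted u y))) ≤_) (Sum-0 1)
            (Sum-mono 1 {λ u → ΣF (λ y → C (shifted (proj₁ u) y))} {λ _ → 0ℚ}
              (λ u → line-nonpos (z +[ V ] (ψ $ side (proj₁ u))) (NZ-shift z (side (proj₁ u)) nz))))))
        (0≤bit (E-bit z nz))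
        where
        pt : Carrier → Car V
        pt y = z +[ V ] y ·[ V ] P
        pt-NZ : ∀ y → NZ (pt y)
        pt-NZ y = NZ-add z (y ·[ V ] P) nz (Z-scale y P zP)
        shifted : Carrier → Carrier → Car V
        shifted u y = (z +[ V ] (ψ $ side u)) +[ V ] y ·[ V ] P
        S : ℚ
        S = ΣF (λ y → E (pt y))
        total : ΣF (λ u → ΣF (λ y → C (shifted u y))) ≡ S
        total = trans (sumL-swap (λ u y → C (shifted u y)) elements elements)
          (sumL-cong elements λ y _ → trans
            (sumL-cong elements λ u _ → cong C (swap-last z (ψ $ side u) (y ·[ V ] P)))
            (sym (E-split (pt y))))

      -- Without an exception all weights of the (k - 1)-flat are `α₁`, and they sum to 1 instead of
      -- 0.
      exception : ∀ z → NZ z → ∃ λ u → α₁ - g (z +[ V ] (ψ $ κ₁ $ u)) ≡ 1ℚ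
      exception z nz = go (search (enum-Pow enum-F k₁) {λ u → f u ≡ 1ℚ} (λ u → f u ℚP.≟ 1ℚ))
        where
        f : Vecs k₁ → ℚ
        f u = α₁ - g (z +[ V ] (ψ $ κ₁ $ u))
        go : ∃ (λ u → f u ≡ 1ℚ) ⊎ (∀ u → f u ≢ 1ℚ) → ∃ λ u → f u ≡ 1ℚ
        go (inj₁ p) = p
        go (inj₂ none) = ⊥-elim (1≢0 Sum-α₁ (trans (Sum-cong k₁ λ u →
          x-y≡0⇒x≡y α₁ (g (z +[ V ] (ψ $ κ₁ $ u))) (not-1 (NZ-shift z (κ₁ $ u) nz) (none u))) (E-zero z nz)))

      absurd : ∀ z → NZ z → ⊥
      absurd z nz = proj₂ (star-NZ z nz) t₀ t₁ t₀≢t₁ (proj₂ ex₀)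
          (trans (cong (λ v → α₁ - g v) eq) (proj₂ ex₁))
        where
        -- Shifting by `e₁` gives a disjoint parallel flat inside the same coset, hence a second
        -- exception there.
        e₁ : Car T
        e₁ = 1# , 0[ Fⁿ k₁ ]
        ex₀ = exception z nz
        ex₁ = exception (z +[ V ] (ψ $ e₁)) (NZ-shift z e₁ nz)
        t₀ t₁ : Car T
        t₀ = κ₁ $ proj₁ ex₀
        t₁ = e₁ +[ T ] (κ₁ $ proj₁ ex₁)
        t₀≢t₁ : t₀ ≢ t₁
        t₀≢t₁ e = 0≢1 (trans (cong proj₁ e) (R.+-identityʳ 1#))
        eq : z +[ V ] (ψ $ t₁) ≡ (z +[ V ] (ψ $ e₁)) +[ V ] (ψ $ κ₁ $ proj₁ ex₁)
        eq = trans (cong (VS.add V z) (+-hom ψ e₁ (κ₁ $ proj₁ ex₁))) (sym (VS.add-assoc V z _ _))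

    module Exceptional (g-Z : ∀ v → Z v → g v ≡ 0ℚ) (P : Car V) (nP : NZ P) (fP : α₁ - g P ≡ 1ℚ) where
      f : Car V → ℚ
      f v = α₁ - g v

      f-homogeneous : ∀ s v → s ≢ 0# → f (s ·[ V ] v) ≡ f v
      f-homogeneous s v ne = cong (λ x → α₁ - x) (homogeneous bool s v ne)

      proportional : ∀ Q → NZ Q → f Q ≡ 1ℚ → ∀ c t → Q ≡ c ·[ V ] P +[ V ] (ψ $ t) → ∃ λ c → Q ≡ c ·[ V ] P
      proportional Q nQ fQ c t e = c , go (c ≟F 0#)
        where
        go : Dec (c ≡ 0#) → Q ≡ c ·[ V ] P
        go (yes refl) = ⊥-elim (exclusive Q (subst Z (sym (trans e (0·+ V P (ψ $ t)))) (Z-ψ t)) nQ)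
        go (no ne) = trans e (coset-unique f (c ·[ V ] P) t (star-NZ (c ·[ V ] P) (NZ-scale⁻¹ c P ne nP))
          (trans (f-homogeneous c P ne) fP) (trans (cong f (sym e)) fQ))

      C-Z : ∀ w → Z w → C w ≡ 0ℚ
      C-Z w zw = Sum-zero k′ (λ μ → g-Z _ (Z-shift w (ι $ μ) zw))

      -- Two exceptions Q and P, with w = Q + y P in the hyperplane, lie on a k-space of weight ≤ 1 − 2.
      two-absurd : ∀ Q → NZ Q → f Q ≡ 1ℚ → ∀ y → Z (Q +[ V ] y ·[ V ] P) → Inj (L Q (Q +[ V ] y ·[ V ] P)) → ⊥
      two-absurd Q nQ fQ y zw i = <≤-absurd 1<2 (≤-trans {1ℚ + 1ℚ} {SD} {1ℚ}
          (subst₂ (λ x x′ → x + x′ ≤ SD) at-Q at-P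
            (Sum-≥₂ k₁ {D} 0≤D (0# , 0[ Fⁿ k′ ]) (-F 1# , 0[ Fⁿ k′ ]) 0≢-1))
          SD≤1)
        where
        w : Car V
        w = Q +[ V ] y ·[ V ] P
        D : Vecs k₁ → ℚ
        D (x , μ) = f ((Q +[ V ] x ·[ V ] w) +[ V ] (ψ $ ι $ μ))
        SD : ℚ
        SD = Sum k₁ D
        D-bit : ∀ u → Bit (D u)
        D-bit (x , μ) = NZ-shift (Q +[ V ] x ·[ V ] w) (ι $ μ) (NZ-add Q (x ·[ V ] w) nQ (Z-scale x w zw))
        0≤D : ∀ u → 0ℚ ≤ D u
        0≤D u = 0≤bit (D-bit u)
        0≢-1 : (0# , 0[ Fⁿ k′ ]) ≢ (-F 1# , 0[ Fⁿ k′ ])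
        0≢-1 e = 0≢1 (trans (sym (R.-‿inverseʳ 1#)) (trans (cong (1# +F_) (sym (cong proj₁ e))) (R.+-identityʳ 1#)))
        ψι0 : ∀ v → v +[ V ] (ψ $ ι $ 0[ Fⁿ k′ ]) ≡ v
        ψι0 v = trans (cong (λ t → v +[ V ] (ψ $ t)) (0-hom ι)) (at-0 v)
        at-Q : D (0# , 0[ Fⁿ k′ ]) ≡ 1ℚ
        at-Q = trans (cong f (trans (ψι0 _) (add-0· Q w))) fQ
        y≢0 : y ≢ 0#
        y≢0 e = exclusive Q (subst Z (trans (cong (λ y → Q +[ V ] y ·[ V ] P) e) (add-0· Q P)) zw) nQ
        -1≢0 : -F 1# ≢ 0#
        -1≢0 e = 0≢-1 (cong (_, 0[ Fⁿ k′ ]) (sym e))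
        -- For x = -1 the point is Q - w = -y P, a nonzero multiple of P.
        at-P : D (-F 1# , 0[ Fⁿ k′ ]) ≡ 1ℚ
        at-P = trans (cong f (trans (ψι0 _) (subtract Q (y ·[ V ] P))))
          (trans (f-homogeneous (-F 1#) (y ·[ V ] P) -1≢0) (trans (f-homogeneous y P y≢0) fP))
        total : ΣF (λ x → C (Q +[ V ] x ·[ V ] w)) + C w ≡ 1ℚ - SD
        total = trans (cong₂ _+_ (trans (sumL-cong elements (λ x _ → Sum-cong k′ λ μ → lem α₁ (g ((Q +[ V ] x ·[ V ] w) +[ V ] (ψ $ ι $ μ)))))
            (trans (Sum-- k₁ (λ _ → α₁) D) (cong (_- SD) Sum-α₁))) (C-Z w zw)) (ℚP.+-identityʳ (1ℚ - SD))
          where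
          lem : ∀ a x → x ≡ a - (a - x)
          lem = solve-∀ ℚring
        SD≤1 : SD ≤ 1ℚ
        SD≤1 = ≤-by {SD} {1ℚ} {1ℚ - SD} (subst (0ℚ ≤_) total (0≤bit (line-bit Q w i))) (lem SD)
          where
          lem : ∀ s → s + (1ℚ - s) ≡ 1ℚ
          lem = solve-∀ ℚring

      -- The point w is where the line through Q in direction P meets the hyperplane. If w lies in ψ
      -- T, then Q is in the coset of a multiple of P, and `star` forbids a second exception there.
      unique-exception : ∀ Q → NZ Q → f Q ≡ 1ℚ → ∃ λ c → Q ≡ c ·[ V ] P
      unique-exception Q nQ fQ = go (dependence Q w)
        where
        y : Carrier
        y = proj₁ (meets P nP Q)
        w : Car V
        w = Q +[ V ] y ·[ V ] P
        zw : Z w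
        zw = proj₂ (meets P nP Q)
        go : Dependence Q w → ∃ λ c → Q ≡ c ·[ V ] P
        go (indep i) = ⊥-elim (two-absurd Q nQ fQ y zw i)
        go (dep-v c t e) = ⊥-elim (exclusive Q (subst Z (sym e) (Z-shift (c ·[ V ] w) t (Z-scale c w zw))) nQ)
        go (dep-w t e) = proportional Q nQ fQ (-F y) t
          (trans (sym (add-cancel-smul Q y P)) (trans (cong (λ u → u +[ V ] (-F y) ·[ V ] P) e) (VS.add-comm V _ _)))

    some-NZ : ∀ z → NZ z → Form g
    some-NZ z nz = go (search enum-V {λ v → α₁ - g v ≡ 1ℚ} (λ v → (α₁ - g v) ℚP.≟ 1ℚ))
      where
      open WithNonzero z nz
      g-Z : ∀ v → Z v → g v ≡ 0ℚ
      g-Z v zv = not-1 zv (λ gv → NoPositive.absurd v zv gv z nz)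
      go : ∃ (λ v → α₁ - g v ≡ 1ℚ) ⊎ (∀ v → α₁ - g v ≢ 1ℚ) → Form g
      go (inj₂ none) = hyperplane-form a z az≢0 (λ v e → g-Z v (a-Z v e))
        (λ v ne → sym (x-y≡0⇒x≡y α₁ (g v) (not-1 (a-NZ v ne) (none v))))
      go (inj₁ (P , fP)) = both-form a P (λ e → exclusive P (a-Z P e) (inj₂ fP)) (λ v e → g-Z v (a-Z v e)) fP a-NZ
        (λ v fv → Exceptional.unique-exception g-Z P (inj₂ fP) fP v (inj₂ fv) fv)

    bit? : ∀ x → Dec (Bit x)
    bit? x with x ℚP.≟ 0ℚ | x ℚP.≟ 1ℚ
    ... | yes e | _     = yes (inj₁ e)
    ... | no _  | yes e = yes (inj₂ e)
    ... | no n₀ | no n₁ = no λ { (inj₁ e) → n₀ e ; (inj₂ e) → n₁ e }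

    classify : Form g
    classify = go (search enum-V {NZ} (λ v → bit? (α₁ - g v)))
      where
      to-Z : ∀ v → ¬ NZ v → Z v ⊎ NZ v → Z v
      to-Z v no-nz (inj₁ z) = z
      to-Z v no-nz (inj₂ nz) = ⊥-elim (no-nz nz)
      go : ∃ NZ ⊎ (∀ v → ¬ NZ v) → Form g
      go (inj₁ (z , nz)) = some-NZ z nz
      go (inj₂ none) = all-Z λ v → to-Z v (none v) (Z-or-NZ v)

-- From an arbitrary weight to one of the four shapes.

-- The zero subspace must hold T and the `cosetDim` coordinates of the coset argument; the outer
-- `suc` and the last summand are the levels that `middle` gives up.
totalDim : (q k′ : ℕ) → ℕ
totalDim q k′ = levelDim q (suc k′) (suc ((suc (suc k′) ℕ.+ cosetDim q k′) ℕ.+ suc k′))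

module Reduction (F : FiniteField) (k′ n : ℕ) where
  open import Data.Rational using (_+_; _*_; _-_; -_; _≤_; _<_)
  open Shapes F k′ n public

  Same : (g g′ : Vecs n → ℚ) → Set
  Same g g′ = ∀ (φ : Fⁿ k ⊸ V) → Inj φ → ksum k (λ c → g′ (φ $ c)) ≡ ksum k (λ c → g (φ $ c))

  erase-dec : ∀ (g : Vecs n → ℚ) v → Dec (v ≡ 0[ V ]) → ℚ
  erase-dec g v (yes _) = 0ℚ
  erase-dec g v (no _)  = g v

  -- `Boolean` does not constrain the value at 0, but the integral vectors form a subspace only if 0
  -- is one of them.
  erase : (Vecs n → ℚ) → Vecs n → ℚ
  erase g v = erase-dec g v (VS._≟V_ V v 0[ V ])

  erase-0 : ∀ g → erase g 0[ V ] ≡ 0ℚ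
  erase-0 g with VS._≟V_ V 0[ V ] 0[ V ]
  ... | yes _ = refl
  ... | no ne = ⊥-elim (ne refl)

  erase-≢0 : ∀ g v → v ≢ 0[ V ] → erase g v ≡ g v
  erase-≢0 g v ne with VS._≟V_ V v 0[ V ]
  ... | yes e = ⊥-elim (ne e)
  ... | no _  = refl

  erase-same : ∀ g → Same g (erase g)
  erase-same g φ i = ksum-cong k λ v ne → erase-≢0 g (φ $ v) (inj-≢0 φ i ne)

  erase-Boolean : ∀ g → Boolean k V g → Boolean k V (erase g)
  erase-Boolean g bool = record
    { homogeneous = λ s v ne → go s v ne (VS._≟V_ V v 0[ V ])
    ; bit = λ φ i → subst Bit (sym (erase-same g φ i)) (bit bool φ i) }
    where
    go : ∀ s v → s ≢ 0# → Dec (v ≡ 0[ V ]) → erase g (s ·[ V ] v) ≡ erase g v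
    go s v ne (yes refl) = cong (erase g) (VSProps.smul-𝟘 V s)
    go s v ne (no v≢0) = trans (erase-≢0 g _ (λ e → v≢0 (VSProps.cancel-smul V s v ne e)))
      (trans (homogeneous bool s v ne) (sym (erase-≢0 g v v≢0)))

  module Local (g : Vecs n → ℚ) (bool : Boolean k V g) (g0 : g 0[ V ] ≡ 0ℚ)
    (ψU : Fⁿ (k ℕ.+ N) ⊸ V) (ψU-inj : Inj ψU) (on-U : ∀ v → v ≢ 0[ Fⁿ (k ℕ.+ N) ] → g (ψU $ v) ≡ 0ℚ) where

    Ψ : T ⊗ Fⁿ N ⊸ V
    Ψ = ψU ∘L append k N

    Ψ-inj : Inj Ψ
    Ψ-inj = ∘-inj ψU (append k N) ψU-inj (append-inj k N)

    on-Ψ : ∀ u → g (Ψ $ u) ≡ 0ℚ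
    on-Ψ u = go (VS._≟V_ (T ⊗ Fⁿ N) u 0[ T ⊗ Fⁿ N ])
      where
      go : Dec (u ≡ 0[ T ⊗ Fⁿ N ]) → g (Ψ $ u) ≡ 0ℚ
      go (yes refl) = trans (cong g (0-hom Ψ)) g0
      go (no ne) = on-U (append k N $ u) (inj-≢0 (append k N) (append-inj k N) ne)

    ψ : T ⊸ V
    ψ = Ψ ∘L (idL & zeroL)

    ψ-inj : Inj ψ
    ψ-inj t e = cong proj₁ (Ψ-inj (t , 0[ Fⁿ N ]) e)

    -- For v outside the zero subspace, v and that subspace span a direct sum, on which
    -- `coset-trivial` applies. For v inside, the coset of ψ T lies in the zero subspace.
    outside : ∀ v → (∀ u → v ≢ Ψ $ u) → TrivialCoset (λ t → g (v +[ V ] (ψ $ t)))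
    outside v out = TrivialCoset-cong (λ t → cong g (1·+ V v (ψ $ t)))
      (coset-trivial (λ z → g (θ $ z)) (pullback θ θ-inj bool)
        (λ t z → trans (cong g (0·+ V v (Ψ $ (t , z)))) (on-Ψ (t , z))))
      where
      θ : A ⊗ Fⁿ N ⊸ V
      θ = ray V v ∘L fstL ∘L fstL ⊹ Ψ ∘L (sndL ∘L fstL & sndL)
      θ-inj : Inj θ
      θ-inj ((s , t) , z) e = go (s ≟F 0#)
        where
        open ≡-Reasoning
        go : Dec (s ≡ 0#) → ((s , t) , z) ≡ 0[ A ⊗ Fⁿ N ]
        go (yes refl) = cong (λ u → (0# , proj₁ u) , proj₂ u) (Ψ-inj (t , z) (trans (sym (0·+ V v _)) e))
        go (no ne) = ⊥-elim (out ((inv s ne *F (-F 1#)) ·[ T ⊗ Fⁿ N ] (t , z)) (begin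
          v                                                       ≡⟨ VS.smul-1 V v ⟨
          1# ·[ V ] v                                             ≡⟨ cong (λ s → s ·[ V ] v) (inv-* s ne) ⟨
          (inv s ne *F s) ·[ V ] v                                ≡⟨ VS.smul-smul V (inv s ne) s v ⟩
          inv s ne ·[ V ] (s ·[ V ] v)                            ≡⟨ cong (VS.smul V (inv s ne)) (VSProps.isolate V (s ·[ V ] v) (Ψ $ (t , z)) e) ⟩
          inv s ne ·[ V ] (VSProps.neg V (Ψ $ (t , z)))           ≡⟨ VS.smul-smul V (inv s ne) (-F 1#) (Ψ $ (t , z)) ⟨
          (inv s ne *F (-F 1#)) ·[ V ] (Ψ $ (t , z))              ≡⟨ ·-hom Ψ (inv s ne *F (-F 1#)) (t , z) ⟨
          Ψ $ ((inv s ne *F (-F 1#)) ·[ T ⊗ Fⁿ N ] (t , z))       ∎))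

    star : ∀ v → TrivialCoset (λ t → g (v +[ V ] (ψ $ t)))
    star v = go (search (enum-× (enum-Pow enum-F k) (enum-Pow enum-F N)) {λ u → v ≡ Ψ $ u} (λ u → VS._≟V_ V v (Ψ $ u)))
      where
      go : ∃ (λ u → v ≡ Ψ $ u) ⊎ (∀ u → v ≢ Ψ $ u) → TrivialCoset (λ t → g (v +[ V ] (ψ $ t)))
      go (inj₂ out) = outside v out
      go (inj₁ (u , e)) = inj₁ ((λ t → inj₁ (zeros t)) , λ t _ _ e₁ _ → 0≢1ℚ (trans (sym (zeros t)) e₁))
        where
        zeros : ∀ t → g (v +[ V ] (ψ $ t)) ≡ 0ℚ
        zeros t = trans (cong g (trans (cong (λ w → w +[ V ] (ψ $ t)) e) (sym (+-hom Ψ u (t , 0[ Fⁿ N ])))))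
          (on-Ψ (u +[ T ⊗ Fⁿ N ] (t , 0[ Fⁿ N ])))

    form : Form g
    form = Classify.classify g bool g0 ψ ψ-inj star (λ t → on-Ψ (t , 0[ Fⁿ N ]))

  ReducedForm : (Vecs n → ℚ) → Set
  ReducedForm g = Σ (Vecs n → ℚ) λ g′ → Boolean k V g′ × (Same g g′ ⊎ Complementary n g g′) × Form g′

  erased-form : ∀ g → ZeroSubspace (k ℕ.+ N) n g → ReducedForm g
  erased-form g (g′ , bool , rel , ψ , inj , zeros) = erase g′ , erase-Boolean g′ bool , relate rel ,
      Local.form (erase g′) (erase-Boolean g′ bool) (erase-0 g′) ψ inj
        (λ v ne → trans (erase-≢0 g′ (ψ $ v) (inj-≢0 ψ inj ne)) (zeros v ne))
    where
    relate : g′ ≡ g ⊎ Complementary n g g′ → Same g (erase g′) ⊎ Complementary n g (erase g′)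
    relate (inj₁ refl) = inj₁ (erase-same g′)
    relate (inj₂ c)    = inj₂ λ φ i → trans (erase-same g′ φ i) (c φ i)

  abstract
    reduced-form : totalDim q k′ ℕ.≤ n → ∀ g → Boolean k V g → ReducedForm g
    reduced-form le g bool = erased-form g (zero-subspace (k ℕ.+ N) n (ℕP.m≤m+n k N) le g bool)

-- Nested pairs versus coordinate functions, and normalized vectors.

module Coordinates (F : FiniteField) (k′ n₀ : ℕ) where
  open import Data.Rational using (_+_; _*_; _-_; -_; _≤_; _<_)
  open Reduction F k′ n₀ public
  module D = Defs.VectorSpace F

  toFun : ∀ n → Vecs n → D.Vec n
  -- The vector of length 0 has to be the one listed by allVectors, up to definitional equality.
  toFun zero    tt      = head-or (λ ()) (D.allVectors zero)
  toFun (suc n) (x , v) = D.cons x (toFun n v)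

  fromFun : ∀ n → D.Vec n → Vecs n
  fromFun zero    f = tt
  fromFun (suc n) f = f zero , fromFun n (λ i → f (suc i))

  to-from : ∀ n f i → toFun n (fromFun n f) i ≡ f i
  to-from (suc n) f zero    = refl
  to-from (suc n) f (suc i) = to-from n (λ i → f (suc i)) i

  toFun-injective : ∀ n v w → (∀ i → toFun n v i ≡ toFun n w i) → v ≡ w
  toFun-injective zero    tt      tt      e = refl
  toFun-injective (suc n) (x , v) (y , w) e = cong₂ _,_ (e zero) (toFun-injective n v w (λ i → e (suc i)))

  from-to : ∀ n v → fromFun n (toFun n v) ≡ v
  from-to n v = toFun-injective n _ v (to-from n (toFun n v))

  toFun-+ : ∀ n v w i → toFun n (v +[ Fⁿ n ] w) i ≡ toFun n v i +F toFun n w i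
  toFun-+ (suc n) v w zero    = refl
  toFun-+ (suc n) v w (suc i) = toFun-+ n (proj₂ v) (proj₂ w) i

  toFun-· : ∀ n s v i → toFun n (s ·[ Fⁿ n ] v) i ≡ s *F toFun n v i
  toFun-· (suc n) s v zero    = refl
  toFun-· (suc n) s v (suc i) = toFun-· n s (proj₂ v) i

  toFun-0 : ∀ n i → toFun n 0[ Fⁿ n ] i ≡ 0#
  toFun-0 (suc n) zero    = refl
  toFun-0 (suc n) (suc i) = toFun-0 n i

  sumF-cong : ∀ {m} {f g : Fin m → Carrier} → (∀ i → f i ≡ g i) → D.sumF f ≡ D.sumF g
  sumF-cong {zero}  e = refl
  sumF-cong {suc m} e = cong₂ _+F_ (e zero) (sumF-cong (λ i → e (suc i)))

  ==-sound : ∀ x y → x D.== y ≡ true → x ≡ y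
  ==-sound x y e with x ≟F y
  ... | yes p = p
  ==-sound x y () | no _

  ==-complete : ∀ x y → x ≡ y → x D.== y ≡ true
  ==-complete x y e with x ≟F y
  ... | yes _ = refl
  ... | no ne = ⊥-elim (ne e)

  ==-≢ : ∀ x y → x ≢ y → x D.== y ≡ false
  ==-≢ x y ne with x ≟F y
  ... | yes e = ⊥-elim (ne e)
  ... | no _  = refl

  allVectors-complete : ∀ n v → toFun n v ∈ D.allVectors n
  allVectors-complete zero    tt      = here refl
  allVectors-complete (suc n) (x , v) = ∈-concatMap⁺ (λ x → List.map (D.cons x) (D.allVectors n))
    (Any.map (λ { refl → ∈-map⁺ (D.cons x) (allVectors-complete n v) }) (complete x))

  allVectors-sound : ∀ n f → f ∈ D.allVectors n → ∃ λ v → f ≡ toFun n v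
  allVectors-sound zero    f (here refl) = tt , refl
  allVectors-sound (suc n) f m with Any.satisfied (∈-concatMap⁻ (λ x → List.map (D.cons x) (D.allVectors n)) {xs = elements} m)
  ... | x , m′ with ∈-map⁻ (D.cons x) m′
  ... | g , m″ , refl with allVectors-sound n g m″
  ... | v , refl = (x , v) , refl

  sum-allVectors : ∀ n (f : D.Vec n → ℚ) → sumL f (D.allVectors n) ≡ Sum n (λ v → f (toFun n v))
  sum-allVectors zero    f = ℚP.+-identityʳ _
  sum-allVectors (suc n) f = trans (sumL-concatMap f (λ x → List.map (D.cons x) (D.allVectors n)) elements)
    (sumL-cong elements λ x _ → trans (sumL-map f (D.cons x) (D.allVectors n)) (sum-allVectors n (λ v → f (D.cons x v))))

  sum-filter : ∀ {A : Set} (p : A → Bool) (w : A → ℚ) xs →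
    D.sumℚ (List.map w (filter (λ x → p x BoolP.≟ true) xs)) ≡ sumL (λ x → guard (p x) (w x)) xs
  sum-filter p w [] = refl
  sum-filter p w (x ∷ xs) with p x
  ... | true  = cong (w x +_) (sum-filter p w xs)
  ... | false = trans (sum-filter p w xs) (sym (ℚP.+-identityˡ _))

  unit : ∀ m → Fin m → Vecs m
  unit (suc m) zero    = 1# , 0[ Fⁿ m ]
  unit (suc m) (suc i) = 0# , unit m i

  combination : ∀ {V} m → (Fin m → Car V) → Fⁿ m ⊸ V
  combination         zero    b = zeroL
  combination {V = V} (suc m) b = ray V (b zero) ∘L fstL ⊹ combination {V} m (λ i → b (suc i)) ∘L sndL

  combination-unit : ∀ {V} m (φ : Fⁿ m ⊸ V) c → (combination {V} m (λ i → φ $ unit m i) $ c) ≡ φ $ c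
  combination-unit {V = V} zero    φ tt = sym (0-hom φ)
  combination-unit {V = V} (suc m) φ (x , c) = begin
    x ·[ V ] (φ $ (1# , 0[ Fⁿ m ])) +[ V ] (combination {V} m (λ i → φ $ (0# , unit m i)) $ c)
      ≡⟨ cong₂ (VS.add V) (sym (·-hom φ x (1# , 0[ Fⁿ m ]))) (combination-unit {V} m (φ ∘L (zeroL & idL)) c) ⟩
    (φ $ (x ·[ Fⁿ (suc m) ] (1# , 0[ Fⁿ m ]))) +[ V ] (φ $ (0# , c))
      ≡⟨ +-hom φ (x ·[ Fⁿ (suc m) ] (1# , 0[ Fⁿ m ])) (0# , c) ⟨
    φ $ ((x ·[ Fⁿ (suc m) ] (1# , 0[ Fⁿ m ])) +[ Fⁿ (suc m) ] (0# , c))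
      ≡⟨ cong (φ $_) (cong₂ _,_ (trans (cong (_+F 0#) (R.*-identityʳ x)) (R.+-identityʳ x))
           (trans (cong (λ z → z +[ Fⁿ m ] c) (VSProps.smul-𝟘 (Fⁿ m) x)) (VS.add-idˡ (Fⁿ m) c))) ⟩
    φ $ (x , c) ∎
    where open ≡-Reasoning

  toFun-combination : ∀ n m (b : Fin m → Vecs n) c j →
    toFun n (combination {Fⁿ n} m b $ c) j ≡ D.sumF (λ i → toFun m c i *F toFun n (b i) j)
  toFun-combination n zero    b tt      j = toFun-0 n j
  toFun-combination n (suc m) b (x , c) j = trans (toFun-+ n _ _ j)
    (cong₂ _+F_ (toFun-· n x (b zero) j) (toFun-combination n m (λ i → b (suc i)) c j))

  normalize-dec : ∀ n (x : Carrier) (v : Vecs n) → Dec (x ≡ 0#) → Vecs n → Vecs (suc n)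
  normalize-dec n x v (yes _) w = 0# , w
  normalize-dec n x v (no ne) w = inv x ne ·[ Fⁿ (suc n) ] (x , v)

  normalize : ∀ n → Vecs n → Vecs n
  normalize zero    tt      = tt
  normalize (suc n) (x , v) = normalize-dec n x v (x ≟F 0#) (normalize n v)

  isNormal : ∀ n → Vecs n → Bool
  isNormal n v = D.normalized (toFun n v)

  isNormal-0 : ∀ n v → isNormal (suc n) (0# , v) ≡ isNormal n v
  isNormal-0 n v = cong (λ b → if b then isNormal n v else (0# D.== 1#)) (==-complete 0# 0# refl)

  isNormal-≢0 : ∀ n x v → x ≢ 0# → isNormal (suc n) (x , v) ≡ (x D.== 1#)
  isNormal-≢0 n x v ne = cong (λ b → if b then isNormal n v else (x D.== 1#)) (==-≢ x 0# ne)

  1≢0F : 1# ≢ 0#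
  1≢0F e = 0≢1 (sym e)

  isNormal-1 : ∀ n v → isNormal (suc n) (1# , v) ≡ true
  isNormal-1 n v = trans (isNormal-≢0 n 1# v 1≢0F) (==-complete 1# 1# refl)

  normalize-isNormal : ∀ n v → v ≢ 0[ Fⁿ n ] → isNormal n (normalize n v) ≡ true
  normalize-isNormal zero    tt      ne = ⊥-elim (ne refl)
  normalize-isNormal (suc n) (x , v) ne = go (x ≟F 0#)
    where
    go : (d : Dec (x ≡ 0#)) → isNormal (suc n) (normalize-dec n x v d (normalize n v)) ≡ true
    go (yes refl) = trans (isNormal-0 n (normalize n v)) (normalize-isNormal n v (λ e → ne (cong (0# ,_) e)))
    go (no x≢0) = trans (cong (λ y → isNormal (suc n) (y , inv x x≢0 ·[ Fⁿ n ] v)) (inv-* x x≢0))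
                        (isNormal-1 n _)

  normalize-scale : ∀ n v → v ≢ 0[ Fⁿ n ] → ∃ λ s → s ≢ 0# × normalize n v ≡ s ·[ Fⁿ n ] v
  normalize-scale zero    tt      ne = ⊥-elim (ne refl)
  normalize-scale (suc n) (x , v) ne = go (x ≟F 0#)
    where
    go : (d : Dec (x ≡ 0#)) → ∃ λ s → s ≢ 0# × normalize-dec n x v d (normalize n v) ≡ s ·[ Fⁿ (suc n) ] (x , v)
    go (yes refl) = let s , s≢0 , e = normalize-scale n v (λ e → ne (cong (0# ,_) e))
                    in s , s≢0 , cong₂ _,_ (sym (R.zeroʳ s)) e
    go (no x≢0) = inv x x≢0 ,
      inv≢0 x x≢0 , refl

  normalize-normal : ∀ n v → isNormal n v ≡ true → normalize n v ≡ v
  normalize-normal zero    tt      e = refl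
  normalize-normal (suc n) (x , v) e = go (x ≟F 0#)
    where
    go : (d : Dec (x ≡ 0#)) → normalize-dec n x v d (normalize n v) ≡ (x , v)
    go (yes refl) = cong (0# ,_) (normalize-normal n v (trans (sym (isNormal-0 n v)) e))
    go (no x≢0) = on-1 x (==-sound x 1# (trans (sym (isNormal-≢0 n x v x≢0)) e)) x≢0
      where
      on-1 : ∀ x → x ≡ 1# → (x≢0 : x ≢ 0#) → inv x x≢0 ·[ Fⁿ (suc n) ] (x , v) ≡ (x , v)
      on-1 x refl x≢0 = trans (cong (λ s → s ·[ Fⁿ (suc n) ] (1# , v)) (trans (sym (R.*-identityʳ _)) (inv-* 1# x≢0)))
                              (VS.smul-1 (Fⁿ (suc n)) (1# , v))

  *-≢0 : ∀ s x → s ≢ 0# → x ≢ 0# → s *F x ≢ 0#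
  *-≢0 s x s≢0 x≢0 e = x≢0 (VSProps.cancel-smul 𝔽 s x s≢0 e)

  normalize-homogeneous : ∀ n s v → s ≢ 0# → normalize n (s ·[ Fⁿ n ] v) ≡ normalize n v
  normalize-homogeneous zero    s tt      ne = refl
  normalize-homogeneous (suc n) s (x , v) ne = go (x ≟F 0#) ((s *F x) ≟F 0#)
    where
    go : (d : Dec (x ≡ 0#)) (d′ : Dec (s *F x ≡ 0#)) →
      normalize-dec n (s *F x) (s ·[ Fⁿ n ] v) d′ (normalize n (s ·[ Fⁿ n ] v)) ≡ normalize-dec n x v d (normalize n v)
    go (yes _) (yes _) = cong (0# ,_) (normalize-homogeneous n s v ne)
    go (yes refl) (no sx≢0) = ⊥-elim (sx≢0 (R.zeroʳ s))
    go (no x≢0) (yes e) = ⊥-elim (*-≢0 s x ne x≢0 e)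
    go (no x≢0) (no sx≢0) = trans (sym (VS.smul-smul (Fⁿ (suc n)) t s (x , v))) (cong (λ r → r ·[ Fⁿ (suc n) ] (x , v)) (begin
        t *F s                     ≡⟨ R.*-identityʳ (t *F s) ⟨
        (t *F s) *F 1#             ≡⟨ cong ((t *F s) *F_) (proj₂ (inverseF x x≢0)) ⟨
        (t *F s) *F (x *F u)       ≡⟨ R.*-assoc (t *F s) x u ⟨
        ((t *F s) *F x) *F u       ≡⟨ cong (_*F u) (R.*-assoc t s x) ⟩
        (t *F (s *F x)) *F u       ≡⟨ cong (_*F u) (inv-* (s *F x) sx≢0) ⟩
        1# *F u                    ≡⟨ R.*-identityˡ u ⟩
        u                          ∎))
      where
      open ≡-Reasoning
      t u : Carrier
      t = inv (s *F x) sx≢0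
      u = inv x x≢0

  isNormal-≢𝟘 : ∀ n v → isNormal n v ≡ true → v ≢ 0[ Fⁿ n ]
  isNormal-≢𝟘 zero    tt      () refl
  isNormal-≢𝟘 (suc n) (x , v) e refl = isNormal-≢𝟘 n 0[ Fⁿ n ] (trans (sym (isNormal-0 n 0[ Fⁿ n ])) e) refl

  ΣF-two : ∀ (G : Carrier → ℚ) → (∀ x → x ≢ 0# → x ≢ 1# → G x ≡ 0ℚ) → ΣF G ≡ G 1# + G 0#
  ΣF-two G z = trans (Sum-without 1 (G ∘ proj₁) (0# , tt)) (trans (cong (G 0# +_)
    (trans (Sum-single 1 (without 1 (0# , tt) (G ∘ proj₁)) (1# , tt) off) (without-≢ 1 (0# , tt) (G ∘ proj₁) (λ e → 1≢0F (cong proj₁ e)))))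
    (ℚP.+-comm (G 0#) (G 1#)))
    where
    off : ∀ v → v ≢ (1# , tt) → without 1 (0# , tt) (G ∘ proj₁) v ≡ 0ℚ
    off (x , tt) ne = go (x ≟F 0#)
      where
      go : Dec (x ≡ 0#) → without 1 (0# , tt) (G ∘ proj₁) (x , tt) ≡ 0ℚ
      go (yes refl) = without-≡ 1 (0# , tt) (G ∘ proj₁)
      go (no x≢0) = trans (without-≢ 1 (0# , tt) (G ∘ proj₁) (λ e → x≢0 (cong proj₁ e)))
                          (z x x≢0 (λ e → ne (cong (_, tt) e)))

  -- A normalized vector starts with 1, followed by anything, or with 0, followed by a normalized
  -- vector; this is the recursion of `ksum`.
  ksum-normal : ∀ m (f : Vecs m → ℚ) → ksum m f ≡ Sum m (λ c → guard (isNormal m c) (f c))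
  ksum-normal zero    f = refl
  ksum-normal (suc m) f = sym (trans
    (ΣF-two (λ x → Sum m (λ c → guard (isNormal (suc m) (x , c)) (f (x , c)))) λ x x≢0 x≢1 →
      Sum-zero m λ c → cong (λ b → guard b (f (x , c))) (trans (isNormal-≢0 m x c x≢0) (==-≢ x 1# x≢1)))
    (cong₂ _+_
      (Sum-cong m λ c → cong (λ b → guard b (f (1# , c))) (isNormal-1 m c))
      (trans (Sum-cong m λ c → cong (λ b → guard b (f (0# , c))) (isNormal-0 m c)) (sym (ksum-normal m (λ c → f (0# , c)))))))

-- Subspaces given by bases, and point sums as weights of injections.

module Translation (F : FiniteField) (k′ n : ℕ) where
  open import Data.Rational using (_+_; _*_; _-_; -_; _≤_; _<_)
  open Coordinates F k′ n public


  vec : Car V → D.Vec n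
  vec = toFun n

  basis-vector : D.Subspace n k → Fin k → Car V
  basis-vector S i = fromFun n (D.basis S i)

  φ : D.Subspace n k → Fⁿ k ⊸ V
  φ S = combination {V} k (basis-vector S)

  φ-linComb : ∀ S c j → vec (φ S $ c) j ≡ D.linComb (toFun k c) (D.basis S) j
  φ-linComb S c j = trans (toFun-combination n k (basis-vector S) c j)
    (sumF-cong λ i → cong (toFun k c i *F_) (to-from n (D.basis S i) j))

  φ-inj : ∀ S → Inj (φ S)
  φ-inj S c e = toFun-injective k c 0[ Fⁿ k ] λ i → trans
    (D.independent S (toFun k c) (λ j → trans (sym (φ-linComb S c j)) (trans (cong (λ v → vec v j) e) (toFun-0 n j))) i)
    (sym (toFun-0 k i))

  member-sound : ∀ S v → (vec v D.∈S S) ≡ true → ∃ λ c → v ≡ φ S $ c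
  member-sound S v e with anyB-sound (λ c → vec v D.==V D.linComb c (D.basis S)) (D.allVectors k) e
  ... | f , m , p with allVectors-sound k f m
  ... | c , refl = c , toFun-injective n v (φ S $ c) λ j → trans
    (==-sound _ _ (allB-sound (λ i → vec v i D.== D.linComb (toFun k c) (D.basis S) i) (allFin n) p j (∈-allFin j)))
    (sym (φ-linComb S c j))

  member-complete : ∀ S c → (vec (φ S $ c) D.∈S S) ≡ true
  member-complete S c = anyB-complete (λ d → vec (φ S $ c) D.==V D.linComb d (D.basis S)) (D.allVectors k)
    (toFun k c) (allVectors-complete k c)
    (allB-complete (λ i → vec (φ S $ c) i D.== D.linComb (toFun k c) (D.basis S) i) (allFin n)
      (λ i → ==-complete _ _ (φ-linComb S c i)))

  -- Turns an arbitrary injection into a subspace with a basis, so that the hypothesis on point sums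
  -- yields `bit` for every injection.
  span : (ψ : Fⁿ k ⊸ V) → Inj ψ → D.Subspace n k
  span ψ i = D.subspace (λ j → vec (ψ $ unit k j)) λ c e j → begin
      c j                           ≡⟨ to-from k c j ⟨
      toFun k (fromFun k c) j       ≡⟨ cong (λ v → toFun k v j) (i (fromFun k c) (kernel c e)) ⟩
      toFun k 0[ Fⁿ k ] j           ≡⟨ toFun-0 k j ⟩
      0#                            ∎
    where
    open ≡-Reasoning
    kernel : ∀ c → (∀ j → D.linComb c (λ j → vec (ψ $ unit k j)) j ≡ 0#) → ψ $ fromFun k c ≡ 0[ V ]
    kernel c e = toFun-injective n _ _ λ j → begin
      vec (ψ $ fromFun k c) j
        ≡⟨ cong (λ v → vec v j) (combination-unit {V} k ψ (fromFun k c)) ⟨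
      vec (combination {V} k (λ i → ψ $ unit k i) $ fromFun k c) j
        ≡⟨ toFun-combination n k (λ i → ψ $ unit k i) (fromFun k c) j ⟩
      D.sumF (λ i → toFun k (fromFun k c) i *F vec (ψ $ unit k i) j)
        ≡⟨ sumF-cong (λ i → cong (_*F vec (ψ $ unit k i) j) (to-from k c i)) ⟩
      D.linComb c (λ j → vec (ψ $ unit k j)) j
        ≡⟨ e j ⟩
      0#
        ≡⟨ toFun-0 n j ⟨
      vec 0[ V ] j ∎

  φ-span : ∀ ψ i c → φ (span ψ i) $ c ≡ ψ $ c
  φ-span ψ i c = trans (toFun-injective n (φ (span ψ i) $ c) (combination {V} k (λ j → ψ $ unit k j) $ c)
      (λ j → trans (φ-linComb (span ψ i) c j) (sym (toFun-combination n k (λ j → ψ $ unit k j) c j))))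
    (combination-unit {V} k ψ c)

  module PointSums (wt : D.Vec n → ℚ) where
    -- Precomposition with `normalize` gives homogeneity, and on nonzero vectors it reads `wt` only
    -- at the representatives that `pointSum` uses.
    weight : Vecs n → ℚ
    weight v = wt (vec (normalize n v))

    -- Both sides sum over pairs of a normalized coefficient vector c and the normalized multiple v of φ S c.
    pointSum-ksum : ∀ S → D.pointSum wt S ≡ ksum k (λ c → weight (φ S $ c))
    pointSum-ksum S = begin
      D.pointSum wt S
        ≡⟨ sum-filter (λ v → D.normalized v ∧ (v D.∈S S)) wt (D.allVectors n) ⟩
      sumL (λ v → guard (D.normalized v ∧ (v D.∈S S)) (wt v)) (D.allVectors n)
        ≡⟨ sum-allVectors n (λ v → guard (D.normalized v ∧ (v D.∈S S)) (wt v)) ⟩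
      Sum n (λ v → guard (isNormal n v ∧ (vec v D.∈S S)) (wt (vec v)))
        ≡⟨ Sum-cong n (λ v → fibre v (isNormal n v ∧ (vec v D.∈S S)) refl) ⟩
      Sum n (λ v → Sum k (λ c → I c v))
        ≡⟨ Sum-swap n k (λ v c → I c v) ⟩
      Sum k (λ c → Sum n (I c))
        ≡⟨ Sum-cong k single ⟩
      Sum k (λ c → guard (isNormal k c) (weight (φ S $ c)))
        ≡⟨ ksum-normal k (λ c → weight (φ S $ c)) ⟨
      ksum k (λ c → weight (φ S $ c)) ∎
      where
      open ≡-Reasoning
      point : Vecs k → Vecs n
      point c = normalize n (φ S $ c)
      I-dec : ∀ c v → Dec (v ≡ point c) → ℚ
      I-dec c v (yes _) = guard (isNormal k c) (wt (vec v))
      I-dec c v (no _)  = 0ℚ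
      I : Vecs k → Vecs n → ℚ
      I c v = I-dec c v (VS._≟V_ V v (point c))
      I-≡ : ∀ c v → v ≡ point c → I c v ≡ guard (isNormal k c) (wt (vec v))
      I-≡ c v e with VS._≟V_ V v (point c)
      ... | yes _ = refl
      ... | no ne = ⊥-elim (ne e)
      I-≢ : ∀ c v → v ≢ point c → I c v ≡ 0ℚ
      I-≢ c v ne with VS._≟V_ V v (point c)
      ... | yes e = ⊥-elim (ne e)
      ... | no _  = refl
      I-not-normal : ∀ c v → isNormal k c ≡ false → I c v ≡ 0ℚ
      I-not-normal c v e = go (VS._≟V_ V v (point c))
        where
        go : (d : Dec (v ≡ point c)) → I-dec c v d ≡ 0ℚ
        go (yes _) = cong (λ b → guard b (wt (vec v))) e
        go (no _)  = refl
      single : ∀ c → Sum n (I c) ≡ guard (isNormal k c) (weight (φ S $ c))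
      single c = trans (Sum-single n (I c) (point c) (I-≢ c)) (I-≡ c (point c) refl)
      point-multiple : ∀ c → isNormal k c ≡ true → ∃ λ s → s ≢ 0# × point c ≡ φ S $ (s ·[ Fⁿ k ] c)
      point-multiple c e =
        let s , s≢0 , p = normalize-scale n (φ S $ c) (inj-≢0 (φ S) (φ-inj S) (isNormal-≢𝟘 k c e))
        in s , s≢0 , trans p (sym (·-hom (φ S) s c))
      -- Equal points have proportional coefficients because `φ S` is injective, and proportional
      -- normalized vectors coincide.
      point-unique : ∀ c d → isNormal k c ≡ true → isNormal k d ≡ true → point c ≡ point d → c ≡ d
      point-unique c d ec ed e =
        let s , s≢0 , p = point-multiple c ec
            t , t≢0 , r = point-multiple d ed
        in begin
          c                                  ≡⟨ normalize-normal k c ec ⟨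
          normalize k c                      ≡⟨ normalize-homogeneous k s c s≢0 ⟨
          normalize k (s ·[ Fⁿ k ] c)        ≡⟨ cong (normalize k) (injective (φ S) (φ-inj S) (trans (sym p) (trans e r))) ⟩
          normalize k (t ·[ Fⁿ k ] d)        ≡⟨ normalize-homogeneous k t d t≢0 ⟩
          normalize k d                      ≡⟨ normalize-normal k d ed ⟩
          d                                  ∎
      fibre : ∀ v b → isNormal n v ∧ (vec v D.∈S S) ≡ b →
              guard (isNormal n v ∧ (vec v D.∈S S)) (wt (vec v)) ≡ Sum k (λ c → I c v)
      fibre v true e = trans (cong (λ b → guard b (wt (vec v))) e) (sym (trans
          (Sum-single k (λ c → I c v) c others)
          (trans (I-≡ c v (sym at-c)) (cong (λ b → guard b (wt (vec v))) normal-c))))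
        where
        c₀ : Vecs k
        c₀ = proj₁ (member-sound S v (proj₂ (∧-split e)))
        v≡ : v ≡ φ S $ c₀
        v≡ = proj₂ (member-sound S v (proj₂ (∧-split e)))
        normal-v : isNormal n v ≡ true
        normal-v = proj₁ (∧-split e)
        c₀≢0 : c₀ ≢ 0[ Fⁿ k ]
        c₀≢0 z = isNormal-≢𝟘 n v normal-v (trans v≡ (trans (cong (φ S $_) z) (0-hom (φ S))))
        c : Vecs k
        c = normalize k c₀
        normal-c : isNormal k c ≡ true
        normal-c = normalize-isNormal k c₀ c₀≢0
        at-c : point c ≡ v
        at-c = let s , s≢0 , p = normalize-scale k c₀ c₀≢0 in begin
          normalize n (φ S $ c)                       ≡⟨ cong (λ c → normalize n (φ S $ c)) p ⟩
          normalize n (φ S $ (s ·[ Fⁿ k ] c₀))        ≡⟨ cong (normalize n) (·-hom (φ S) s c₀) ⟩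
          normalize n (s ·[ V ] (φ S $ c₀))           ≡⟨ normalize-homogeneous n s (φ S $ c₀) s≢0 ⟩
          normalize n (φ S $ c₀)                      ≡⟨ cong (normalize n) (sym v≡) ⟩
          normalize n v                               ≡⟨ normalize-normal n v normal-v ⟩
          v                                           ∎
        others : ∀ d → d ≢ c → I d v ≡ 0ℚ
        others d d≢c = go (isNormal k d) refl
          where
          go : ∀ b → isNormal k d ≡ b → I d v ≡ 0ℚ
          go false e = I-not-normal d v e
          go true e = I-≢ d v λ p → d≢c (point-unique d c e normal-c (trans (sym p) (sym at-c)))
      fibre v false e = trans (cong (λ b → guard b (wt (vec v))) e) (sym (Sum-zero k λ c → zero-at c (isNormal k c) refl))
        where
        zero-at : ∀ c b → isNormal k c ≡ b → I c v ≡ 0ℚ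
        zero-at c false en = I-not-normal c v en
        zero-at c true en = I-≢ c v λ p → clash p
          where
          clash : v ≡ point c → ⊥
          clash p = let s , s≢0 , r = point-multiple c en in
            case-false (trans (sym e) (cong₂ _∧_
              (trans (cong (isNormal n) p) (normalize-isNormal n (φ S $ c) (inj-≢0 (φ S) (φ-inj S) (isNormal-≢𝟘 k c en))))
              (trans (cong (λ v → vec v D.∈S S) (trans p r)) (member-complete S (s ·[ Fⁿ k ] c)))))
            where
            case-false : false ≡ true → ⊥
            case-false ()

    bit-ind : ∀ b → Bit (ind b)
    bit-ind true  = inj₂ refl
    bit-ind false = inj₁ refl

    weight-Boolean : (Y : D.Subspace n k → Bool) → (∀ S → D.pointSum wt S ≡ ind (Y S)) → Boolean k V weight
    weight-Boolean Y h = record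
      { homogeneous = λ s v ne → cong (λ v → wt (vec v)) (normalize-homogeneous n s v ne)
      ; bit = λ ψ i → subst Bit (trans (sym (h (span ψ i))) (trans (pointSum-ksum (span ψ i))
          (ksum-cong k λ c _ → cong weight (φ-span ψ i c)))) (bit-ind (Y (span ψ i))) }

-- Reading off the types from the shapes.

module Triviality (F : FiniteField) (k′ n : ℕ) where
  open import Data.Rational using (_+_; _*_; _-_; -_; _≤_; _<_)
  open Translation F k′ n public

  -- Up to a scalar, v is one of the representatives over which `ksum` runs.
  ksum-≥ : ∀ m (f : Vecs m → ℚ) → (∀ v → v ≢ 0[ Fⁿ m ] → 0ℚ ≤ f v) →
    (∀ s v → s ≢ 0# → f (s ·[ Fⁿ m ] v) ≡ f v) → ∀ v → v ≢ 0[ Fⁿ m ] → f v ≤ ksum m f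
  ksum-≥ zero    f le hom tt      ne = ⊥-elim (ne refl)
  ksum-≥ (suc m) f le hom (x , v) ne = go (x ≟F 0#)
    where
    S K : ℚ
    S = Sum m (λ v → f (1# , v))
    K = ksum m (λ v → f (0# , v))
    le₁ : ∀ v → 0ℚ ≤ f (1# , v)
    le₁ v = le (1# , v) (λ e → 1≢0F (cong proj₁ e))
    le₀ : ∀ v → v ≢ 0[ Fⁿ m ] → 0ℚ ≤ f (0# , v)
    le₀ v ne = le (0# , v) (λ e → ne (cong proj₂ e))
    go : Dec (x ≡ 0#) → f (x , v) ≤ S + K
    go (yes refl) = ≤-trans {f (0# , v)} {K} {S + K}
      (ksum-≥ m (λ v → f (0# , v)) le₀
        (λ s v s≢0 → trans (cong (λ x → f (x , s ·[ Fⁿ m ] v)) (sym (R.zeroʳ s))) (hom s (0# , v) s≢0)) v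
        (λ e → ne (cong (0# ,_) e)))
      (≤-by {K} {S + K} {S} (Sum-nonneg m le₁) (ℚP.+-comm K S))
    go (no x≢0) = ≤-trans {f (x , v)} {S} {S + K}
      (subst (_≤ S) (trans (cong (λ y → f (y , inv x x≢0 ·[ Fⁿ m ] v)) (sym (inv-* x x≢0))) (hom (inv x x≢0) (x , v) (inv≢0 x x≢0)))
        (Sum-≥ m {λ v → f (1# , v)} le₁ (inv x x≢0 ·[ Fⁿ m ] v)))
      (≤-by {S} {S + K} {K} (ksum-nonneg m {λ v → f (0# , v)} le₀) refl)

  -- The geometric bound (1 + q + ... + q^m) + 1 ≤ 2 q^m for q ≥ 2, multiplied by `α₁`.
  ksum-α-bound : ∀ m → ksum (suc m) (λ _ → α₁) + α₁ ≤ Sum m (λ _ → α₁) + Sum m (λ _ → α₁)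
  ksum-α-bound zero = ≤-by {(α₁ + 0ℚ) + α₁} {α₁ + α₁} {0ℚ} ≤-refl (lem α₁)
    where
    lem : ∀ a → ((a + 0ℚ) + a) + 0ℚ ≡ a + a
    lem = solve-∀ ℚring
  ksum-α-bound (suc m) = subst (_≤ S₂ + S₂) (sym (ℚP.+-assoc S₂ K α₁)) (ℚP.+-monoʳ-≤ S₂ (≤-trans {K + α₁} {S₁ + S₁} {S₂} (ksum-α-bound m) 2A≤S₂))
    where
    S₁ S₂ K : ℚ
    S₁ = Sum m (λ _ → α₁)
    S₂ = Sum (suc m) (λ _ → α₁)
    K = ksum (suc m) (λ _ → α₁)
    0≤S₁ : 0ℚ ≤ S₁
    0≤S₁ = Sum-nonneg m {λ _ → α₁} (λ _ → 0≤α k₁)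
    2A≤S₂ : S₁ + S₁ ≤ S₂
    2A≤S₂ = subst₂ _≤_ (lem S₁) (sym (ΣF-const S₁)) (ℚP.*-monoʳ-≤-nonNeg S₁ {{ℚ.nonNegative 0≤S₁}} 2≤q̂)
      where
      lem : ∀ a → (1ℚ + 1ℚ) * a ≡ a + a
      lem = solve-∀ ℚring

  ksum-α<2 : ksum k (λ _ → α₁) < 1ℚ + 1ℚ
  ksum-α<2 = ℚP.<-≤-trans {K} {K + α₁} {1ℚ + 1ℚ} (subst (_< K + α₁) (ℚP.+-identityʳ K) (ℚP.+-monoʳ-< K 0<α₁))
    (subst (λ s → K + α₁ ≤ s + s) Sum-α₁ (ksum-α-bound k₁))
    where
    K : ℚ
    K = ksum k (λ _ → α₁)

  functional-vector : V ⊸ 𝔽 → Car V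
  functional-vector a = fromFun n (λ i → a $ unit n i)

  dot-functional : ∀ a v → D.dot (vec (functional-vector a)) v ≡ a $ fromFun n v
  dot-functional a v = trans (sumF-cong λ i → trans (cong (_*F v i) (to-from n (λ i → a $ unit n i) i))
      (trans (R.*-comm (a $ unit n i) (v i)) (cong (_*F (a $ unit n i)) (sym (to-from n v i)))))
    (trans (sym (evaluate n (λ i → a $ unit n i) (fromFun n v))) (combination-unit {𝔽} n a (fromFun n v)))
    where
    evaluate : ∀ m (b : Fin m → Carrier) c → combination {𝔽} m b $ c ≡ D.sumF (λ i → toFun m c i *F b i)
    evaluate zero    b tt      = refl
    evaluate (suc m) b (x , c) = cong (x *F b zero +F_) (evaluate m (λ i → b (suc i)) c)

  dot-vec : ∀ a v → D.dot (vec (functional-vector a)) (vec v) ≡ a $ v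
  dot-vec a v = trans (dot-functional a (vec v)) (cong (a $_) (from-to n v))

  kernel-combination : ∀ (a : V ⊸ 𝔽) m (b : Fin m → Car V) → (∀ i → a $ b i ≡ 0#) → ∀ c → a $ (combination {V} m b $ c) ≡ 0#
  kernel-combination a zero    b z tt      = 0-hom a
  kernel-combination a (suc m) b z (x , c) = trans (+-hom a _ _) (trans (cong₂ _+F_
    (trans (·-hom a x (b zero)) (trans (cong (x *F_) (z zero)) (R.zeroʳ x)))
    (kernel-combination a m (λ i → b (suc i)) (λ i → z (suc i)) c)) (R.+-identityʳ 0#))

  unit-combination : ∀ m (b : Fin m → Car V) i → combination {V} m b $ unit m i ≡ b i
  unit-combination (suc m) b zero = trans (cong₂ (VS.add V) (VS.smul-1 V (b zero)) (0-hom (combination {V} m (λ i → b (suc i)))))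
    (VSProps.add-idʳ V (b zero))
  unit-combination (suc m) b (suc i) = trans (0·+ V (b zero) (combination {V} m (λ i → b (suc i)) $ unit m i)) (unit-combination m (λ i → b (suc i)) i)

  ⊆H-sound : ∀ S a → (S D.⊆H vec (functional-vector a)) ≡ true → ∀ c → a $ (φ S $ c) ≡ 0#
  ⊆H-sound S a e = kernel-combination a k (basis-vector S) λ i → trans (sym (dot-functional a (D.basis S i)))
    (==-sound (D.dot (vec (functional-vector a)) (D.basis S i)) 0# (allB-sound (λ i → D.dot (vec (functional-vector a)) (D.basis S i) D.== 0#) (allFin k) e i (∈-allFin i)))

  ⊆H-complete : ∀ S a → (∀ c → a $ (φ S $ c) ≡ 0#) → (S D.⊆H vec (functional-vector a)) ≡ true
  ⊆H-complete S a z = allB-complete (λ i → D.dot (vec (functional-vector a)) (D.basis S i) D.== 0#) (allFin k) λ i →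
    ==-complete (D.dot (vec (functional-vector a)) (D.basis S i)) 0# (trans (dot-functional a (D.basis S i))
      (trans (cong (a $_) (sym (unit-combination k (basis-vector S) i))) (z (unit k i))))

  not-⊆H : ∀ S a → (S D.⊆H vec (functional-vector a)) ≡ false → ∃ λ c → a $ (φ S $ c) ≢ 0#
  not-⊆H S a e = go (search (enum-Pow enum-F k) {λ c → a $ (φ S $ c) ≢ 0#} (λ c → ¬? ((a $ (φ S $ c)) ≟F 0#)))
    where
    decided : ∀ c → Dec (a $ (φ S $ c) ≡ 0#) → ¬ (a $ (φ S $ c) ≢ 0#) → a $ (φ S $ c) ≡ 0#
    decided c (yes z) _ = z
    decided c (no ne) nn = ⊥-elim (nn ne)
    go : ∃ (λ c → a $ (φ S $ c) ≢ 0#) ⊎ (∀ c → ¬ (a $ (φ S $ c) ≢ 0#)) → ∃ λ c → a $ (φ S $ c) ≢ 0#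
    go (inj₁ p) = p
    go (inj₂ none) with trans (sym e) (⊆H-complete S a (λ c → decided c ((a $ (φ S $ c)) ≟F 0#) (none c)))
    ... | ()

  nonzero-vec : ∀ v → v ≢ 0[ V ] → D.NonZero (vec v)
  nonzero-vec v ne z = ne (toFun-injective n v 0[ V ] λ j → trans (z j) (sym (toFun-0 n j)))

  nonzero-functional : ∀ a z → a $ z ≢ 0# → D.NonZero (vec (functional-vector a))
  nonzero-functional a z ne zeros = ne (trans (sym (dot-vec a z)) (sum-zero (λ i → trans (cong (_*F vec z i) (zeros i)) (R.zeroˡ (vec z i)))))
    where
    sum-zero : ∀ {m} {f : Fin m → Carrier} → (∀ i → f i ≡ 0#) → D.sumF f ≡ 0#
    sum-zero {zero}  e = refl
    sum-zero {suc m} e = trans (cong₂ _+F_ (e zero) (sum-zero (λ i → e (suc i)))) (R.+-identityʳ 0#)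

  functional-≢0 : ∀ (a : V ⊸ 𝔽) v → a $ v ≢ 0# → v ≢ 0[ V ]
  functional-≢0 a v ne refl = ne (0-hom a)

  module Represent (g : Vecs n → ℚ) (bool : Boolean k V g) where
    total : D.Subspace n k → ℚ
    total S = ksum k (λ c → g (φ S $ c))

    total-bit : ∀ S → Bit (total S)
    total-bit S = bit bool (φ S) (φ-inj S)

    Represents : (D.Subspace n k → Bool) → Set
    Represents X = ∀ S → total S ≡ ind (X S)

    zero-total : ∀ S → (∀ c → c ≢ 0[ Fⁿ k ] → g (φ S $ c) ≡ 0ℚ) → total S ≡ 0ℚ
    zero-total S z = ksum-zero k z

    -- The total is known to be a bit, so a positive lower bound already makes it 1.
    one-total : ∀ S → (∀ c → c ≢ 0[ Fⁿ k ] → 0ℚ ≤ g (φ S $ c)) → ∀ c → c ≢ 0[ Fⁿ k ] → 0ℚ < g (φ S $ c) → total S ≡ 1ℚ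
    one-total S le c ne pos with total-bit S
    ... | inj₂ e = e
    ... | inj₁ e = ⊥-elim (<≤-absurd pos (subst (g (φ S $ c) ≤_) e
      (ksum-≥ k (λ c → g (φ S $ c)) le
        (λ s v s≢0 → trans (cong g (·-hom (φ S) s v)) (homogeneous bool s (φ S $ v) s≢0)) c ne)))

    φ≢0 : ∀ S c → c ≢ 0[ Fⁿ k ] → φ S $ c ≢ 0[ V ]
    φ≢0 S c = inj-≢0 (φ S) (φ-inj S)

    coefficient-≢0 : ∀ S c → φ S $ c ≢ 0[ V ] → c ≢ 0[ Fⁿ k ]
    coefficient-≢0 S c ne refl = ne (0-hom (φ S))

    multiple-member : ∀ S P c d → c ≢ 0[ Fⁿ k ] → φ S $ c ≡ d ·[ V ] P → (vec P D.∈S S) ≡ true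
    multiple-member S P c d c≢0 e = go (d ≟F 0#)
      where
      open ≡-Reasoning
      go : Dec (d ≡ 0#) → (vec P D.∈S S) ≡ true
      go (yes refl) = ⊥-elim (φ≢0 S c c≢0 (trans e (VS.smul-0 V P)))
      go (no d≢0) = trans (cong (λ v → vec v D.∈S S) (begin
          P                                      ≡⟨ VS.smul-1 V P ⟨
          1# ·[ V ] P                            ≡⟨ cong (λ s → s ·[ V ] P) (inv-* d d≢0) ⟨
          (inv d d≢0 *F d) ·[ V ] P              ≡⟨ VS.smul-smul V (inv d d≢0) d P ⟩
          inv d d≢0 ·[ V ] (d ·[ V ] P)          ≡⟨ cong (VS.smul V (inv d d≢0)) e ⟨
          inv d d≢0 ·[ V ] (φ S $ c)             ≡⟨ ·-hom (φ S) (inv d d≢0) c ⟨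
          φ S $ (inv d d≢0 ·[ Fⁿ k ] c)          ∎)) (member-complete S (inv d d≢0 ·[ Fⁿ k ] c))

    point-represents : ∀ P → P ≢ 0[ V ] → g P ≡ 1ℚ → (∀ v → Bit (g v)) →
      (∀ v → g v ≡ 1ℚ → ∃ λ c → v ≡ c ·[ V ] P) → Represents (λ S → vec P D.∈S S)
    point-represents P P≢0 gP bits unique S = go (vec P D.∈S S) refl
      where
      go : ∀ b → (vec P D.∈S S) ≡ b → total S ≡ ind (vec P D.∈S S)
      go true e = let c , p = member-sound S P e in
        trans (one-total S (λ c _ → 0≤bit (bits (φ S $ c))) c (coefficient-≢0 S c (λ z → P≢0 (trans p z)))
          (subst (0ℚ <_) (trans (sym gP) (cong g p)) 0<1)) (cong ind (sym e))
      go false e = trans (zero-total S λ c ne → not-1 (bits (φ S $ c)) λ one →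
          let d , p = unique (φ S $ c) one in true≢false (trans (sym (multiple-member S P c d ne p)) e))
          (cong ind (sym e))
        where
        true≢false : true ≡ false → ⊥
        true≢false ()

    hyperplane-represents : (a : V ⊸ 𝔽) → (∀ v → a $ v ≡ 0# → g v ≡ 0ℚ) → (∀ v → a $ v ≢ 0# → g v ≡ α₁) →
      Represents (λ S → not (S D.⊆H vec (functional-vector a)))
    hyperplane-represents a on off S = go (S D.⊆H vec (functional-vector a)) refl
      where
      0≤g : ∀ v → Dec (a $ v ≡ 0#) → 0ℚ ≤ g v
      0≤g v (yes z) = subst (0ℚ ≤_) (sym (on v z)) ≤-refl
      0≤g v (no ne) = subst (0ℚ ≤_) (sym (off v ne)) (0≤α k₁)
      go : ∀ b → (S D.⊆H vec (functional-vector a)) ≡ b → total S ≡ ind (not (S D.⊆H vec (functional-vector a)))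
      go true e = trans (zero-total S λ c _ → on (φ S $ c) (⊆H-sound S a e c)) (cong (ind ∘ not) (sym e))
      go false e = let c , ne = not-⊆H S a e in
        trans (one-total S (λ c _ → 0≤g (φ S $ c) ((a $ (φ S $ c)) ≟F 0#)) c (coefficient-≢0 S c (functional-≢0 a (φ S $ c) ne))
          (subst (0ℚ <_) (sym (off (φ S $ c) ne)) 0<α₁)) (cong (ind ∘ not) (sym e))

    both-represents : (a : V ⊸ 𝔽) (P : Car V) → a $ P ≢ 0# → (∀ v → a $ v ≡ 0# → g v ≡ 0ℚ) →
      α₁ - g P ≡ 1ℚ → (∀ v → a $ v ≢ 0# → Bit (α₁ - g v)) →
      (∀ v → α₁ - g v ≡ 1ℚ → ∃ λ c → v ≡ c ·[ V ] P) →
      Represents (λ S → not ((vec P D.∈S S) ∨ (S D.⊆H vec (functional-vector a))))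
    both-represents a P aP≢0 on fP bits unique S = go (vec P D.∈S S) refl (S D.⊆H vec (functional-vector a)) refl
      where
      H∈ : D.Subspace n k → Bool
      H∈ S = S D.⊆H vec (functional-vector a)
      0≤α-g : ∀ v → Dec (a $ v ≡ 0#) → 0ℚ ≤ α₁ - g v
      0≤α-g v (yes z) = subst (0ℚ ≤_) (sym (trans (cong (λ x → α₁ - x) (on v z)) (ℚP.+-identityʳ α₁))) (0≤α k₁)
      0≤α-g v (no ne) = 0≤bit (bits v ne)
      -- S meets the complement of H in q^(k-1) points, but the cruder bound total S < 2 − 1 suffices.
      contains-P : (vec P D.∈S S) ≡ true → total S ≡ 0ℚ
      contains-P e with total-bit S
      ... | inj₁ z = z
      ... | inj₂ one = ⊥-elim (<≤-absurd ksum-α<2 (subst₂ _≤_ (cong₂ _+_ fP′ one) total-eq (ℚP.+-monoˡ-≤ (total S) D≤)))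
        where
        c : Vecs k
        c = proj₁ (member-sound S P e)
        K SD : ℚ
        K = ksum k (λ _ → α₁)
        SD = ksum k (λ c → α₁ - g (φ S $ c))
        fP′ : α₁ - g (φ S $ c) ≡ 1ℚ
        fP′ = trans (cong (λ v → α₁ - g v) (sym (proj₂ (member-sound S P e)))) fP
        D≤ : α₁ - g (φ S $ c) ≤ SD
        D≤ = ksum-≥ k (λ c → α₁ - g (φ S $ c)) (λ c _ → 0≤α-g (φ S $ c) ((a $ (φ S $ c)) ≟F 0#))
          (λ s v s≢0 → cong (λ x → α₁ - x) (trans (cong g (·-hom (φ S) s v)) (homogeneous bool s (φ S $ v) s≢0)))
          c (coefficient-≢0 S c (λ z → functional-≢0 a P aP≢0 (trans (proj₂ (member-sound S P e)) z)))
        lem : ∀ x y → (x - y) + y ≡ x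
        lem = solve-∀ ℚring
        total-eq : SD + total S ≡ K
        total-eq = trans (cong (_+ total S) (ksum-- k (λ _ → α₁) (λ c → g (φ S $ c)))) (lem K (total S))
      go : ∀ b → (vec P D.∈S S) ≡ b → ∀ b′ → H∈ S ≡ b′ → total S ≡ ind (not ((vec P D.∈S S) ∨ H∈ S))
      go true e b′ e′ = trans (contains-P e) (cong (λ b → ind (not (b ∨ H∈ S))) (sym e))
      go false e true e′ = trans (zero-total S λ c _ → on (φ S $ c) (⊆H-sound S a e′ c))
        (cong₂ (λ b b′ → ind (not (b ∨ b′))) (sym e) (sym e′))
      go false e false e′ = let c , ne = not-⊆H S a e′
                                c≢0 = coefficient-≢0 S c (functional-≢0 a (φ S $ c) ne) in
        trans (one-total S (λ c c≢0 → 0≤g c c≢0 ((a $ (φ S $ c)) ≟F 0#)) c c≢0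
          (subst (0ℚ <_) (sym (value c c≢0 ne)) 0<α₁)) (cong₂ (λ b b′ → ind (not (b ∨ b′))) (sym e) (sym e′))
        where
        true≢false : true ≡ false → ⊥
        true≢false ()
        value : ∀ c → c ≢ 0[ Fⁿ k ] → a $ (φ S $ c) ≢ 0# → g (φ S $ c) ≡ α₁
        value c c≢0 ne = sym (x-y≡0⇒x≡y α₁ (g (φ S $ c)) (not-1 (bits (φ S $ c) ne) λ one →
          let d , p = unique (φ S $ c) one in true≢false (trans (sym (multiple-member S P c d c≢0 p)) e)))
        0≤g : ∀ c → c ≢ 0[ Fⁿ k ] → Dec (a $ (φ S $ c) ≡ 0#) → 0ℚ ≤ g (φ S $ c)
        0≤g c c≢0 (yes z) = subst (0ℚ ≤_) (sym (on (φ S $ c) z)) ≤-refl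
        0≤g c c≢0 (no ne) = subst (0ℚ ≤_) (sym (value c c≢0 ne)) (0≤α k₁)

    BasicUpToComplement : Set
    BasicUpToComplement = Σ (D.Subspace n k → Bool) λ X → D.Basic X × (Represents X ⊎ Represents (λ S → not (X S)))

    form-basic : Form g → BasicUpToComplement
    form-basic (zero-form z) = (λ _ → false) , D.typeI , inj₁ λ S → zero-total S (λ c _ → z (φ S $ c))
    form-basic (point-form P P≢0 gP bits unique) =
      (λ S → vec P D.∈S S) , D.typeII (vec P) (nonzero-vec P P≢0) , inj₁ (point-represents P P≢0 gP bits unique)
    form-basic (hyperplane-form a z az≢0 on off) =
      (λ S → S D.⊆H vec (functional-vector a)) , D.typeIII (vec (functional-vector a)) (nonzero-functional a z az≢0) ,
      inj₂ (hyperplane-represents a on off)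
    form-basic (both-form a P aP≢0 on fP bits unique) =
      (λ S → (vec P D.∈S S) ∨ (S D.⊆H vec (functional-vector a))) ,
      D.typeIV (vec P) (vec (functional-vector a)) (nonzero-vec P (functional-≢0 a P aP≢0)) (nonzero-functional a P aP≢0)
        (λ e → aP≢0 (trans (sym (dot-vec a P)) e)) ,
      inj₂ (both-represents a P aP≢0 on fP bits unique)

  ind-not : ∀ b → 1ℚ - ind b ≡ ind (not b)
  ind-not true  = refl
  ind-not false = refl

  trivial : totalDim q k′ ℕ.≤ n → (Y : D.Subspace n k → Bool) → D.IsBooleanDegree1 Y → D.Trivial Y
  trivial le Y (wt , h) = finish (reduced-form le weight (weight-Boolean Y h))
    where
    open PointSums wt
    Y-total : ∀ S → ksum k (λ c → weight (φ S $ c)) ≡ ind (Y S)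
    Y-total S = trans (sym (pointSum-ksum S)) (h S)
    finish : ReducedForm weight → D.Trivial Y
    finish (g , bool , rel , form) = conclude rel (form-basic form)
      where
      open Represent g bool
      conclude : Same weight g ⊎ Complementary n weight g → BasicUpToComplement → D.Trivial Y
      conclude (inj₁ same) (X , basic , rep) = X , basic , result rep
        where
        Y≡ : ∀ W → Represents W → ∀ S → Y S ≡ W S
        Y≡ W r S = ind-injective (Y S) (W S) (trans (sym (Y-total S)) (trans (sym (same (φ S) (φ-inj S))) (r S)))
        result : Represents X ⊎ Represents (λ S → not (X S)) → _
        result (inj₁ r) = inj₁ (Y≡ X r)
        result (inj₂ r) = inj₂ (Y≡ (λ S → not (X S)) r)
      conclude (inj₂ comp) (X , basic , rep) = X , basic , result rep
        where
        Y≡ : ∀ W → Represents W → ∀ S → Y S ≡ not (W S)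
        Y≡ W r S = begin
          Y S              ≡⟨ BoolP.not-involutive (Y S) ⟨
          not (not (Y S))  ≡⟨ cong not (ind-injective (not (Y S)) (W S) (begin
            ind (not (Y S))  ≡⟨ ind-not (Y S) ⟨
            1ℚ - ind (Y S)   ≡⟨ cong (λ x → 1ℚ - x) (Y-total S) ⟨
            1ℚ - ksum k (λ c → weight (φ S $ c)) ≡⟨ comp (φ S) (φ-inj S) ⟨
            total S          ≡⟨ r S ⟩
            ind (W S)        ∎)) ⟩
          not (W S)        ∎
          where open ≡-Reasoning
        result : Represents X ⊎ Represents (λ S → not (X S)) → _
        result (inj₁ r) = inj₂ (Y≡ X r)
        result (inj₂ r) = inj₁ (λ S → trans (Y≡ (λ S → not (X S)) r S) (BoolP.not-involutive (X S)))

-- The bound on the dimension.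

open import Data.Nat using (_≤_; _∸_; _⊔_)

bound : (q k : ℕ) → ℕ
bound q (suc (suc k′)) = suc (suc (suc k′) ℕ.+ totalDim q k′)
bound q _              = 0

-- The bound exceeds k, so the maximum can only be n - k, and n is at least that large.
dimension-bound : ∀ k d n → suc (k ℕ.+ d) ≤ k ⊔ (n ∸ k) → d ℕ.≤ n
dimension-bound k d n le with ℕP.⊔-sel k (n ∸ k)
... | inj₁ e = ⊥-elim (ℕP.<⇒≱ (subst (suc (k ℕ.+ d) ℕ.≤_) e le) (ℕP.m≤m+n k d))
... | inj₂ e = ℕP.≤-trans (ℕP.m≤n+m d (suc k)) (ℕP.≤-trans (subst (suc (k ℕ.+ d) ℕ.≤_) e le) (ℕP.m∸n≤m n k))

theorem1 : (q : ℕ) → IsPrimePower q → (k : ℕ) → 2 ≤ k →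
    Σ ℕ λ c₀ → (F : FiniteField) → FiniteField.size F ≡ q →
    (n : ℕ) → c₀ ≤ k ⊔ (n ∸ k) →
    (Y : VectorSpace.Subspace F n k → Bool) →
    VectorSpace.IsBooleanDegree1 F Y → VectorSpace.Trivial F Y
theorem1 q _ (suc (suc k′)) (s≤s (s≤s z≤n)) = bound q (suc (suc k′)) , λ F size≡q n le Y →
  -- The bound is computed from q before the field is given; only here is q identified with the size
  -- of F.
  Triviality.trivial F k′ n (subst (λ q → totalDim q k′ ℕ.≤ n) (sym size≡q)
    (dimension-bound (suc (suc k′)) (totalDim q k′) n le)) Y
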